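{- For every $\varepsilon>0$, every squarefree monic $Q\in\mathbb F_q[T]$ and every integer $h\ge0$, \[m_5(Q;h)\ll_\varepsilon|Q|\,q^{(2+\varepsilon)h}\Big(\frac{|Q|}{\phi(Q)}\Big)^{ -4}+|Q|\,q^{2h}\Big(\frac{|Q|}{\phi(Q)}\Big)^{27}.\]
   Context: $\mathbb F_q$ is a fixed finite field with $q$ elements. For nonzero $F\in\mathbb F_q[T]$, $|F|=q^{\deg F}$, $|0|=0$. For monic $Q$, $\phi(Q)$ is the number of polynomials $A$ with $\deg A<\deg Q$, $\gcd(A,Q)=1$. With $I(F,h)=\{G\in\mathbb F_q[T]:|F-G|<q^h\}$, \[m_5(Q;h)=\sum_{F\bmod Q}\Big(\#\{G\in I(F,h):\gcd(G,Q)=1\}-\frac{q^h\phi(Q)}{|Q|}\Big)^5,\] $F$ ranging over polynomials with $\deg F<\deg Q$. The implied constant depends only on $\varepsilon$ and $q$. -}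

module Defs where

open import Data.Nat as ℕ using (ℕ; zero; suc)
open import Data.Fin using (Fin)
open import Data.List using (List; []; _∷_; _++_; [_]; length; map; concatMap; filterᵇ; foldr)
open import Data.Bool.ListAction using (any)
open import Data.Bool using (Bool; true; false; not; _∧_; if_then_else_)
open import Data.Product using (∃; Σ; _,_)
open import Data.Sum using (_⊎_)
open import Data.Integer using (+_)
open import Data.Rational as ℚ using (ℚ; 0ℚ; 1ℚ)
open import Algebra.Structures using (IsCommutativeRing)
open import Function.Bundles using (_↔_; Inverse)
open import Relation.Binary.PropositionalEquality using (_≡_; _≢_)
open import Relation.Binary.Definitions using (DecidableEquality)
open import Relation.Nullary using (¬_)
open import Relation.Nullary.Decidable using (⌊_⌋)
open import Data.List.Base using (allFin)

record FiniteField : Set₁ where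
  field
    Carrier : Set
    _+_ _*_ : Carrier → Carrier → Carrier
    -_      : Carrier → Carrier
    0# 1#   : Carrier
    isCommutativeRing : IsCommutativeRing _≡_ _+_ _*_ -_ 0# 1#
    _≟_     : DecidableEquality Carrier
    0≢1     : 0# ≢ 1#
    inverse : ∀ x → x ≢ 0# → ∃ λ y → x * y ≡ 1#
    size    : ℕ
    enum    : Fin size ↔ Carrier

-- Polynomials over F_q, as coefficient lists (lowest degree first).
-- Trailing zero coefficients are allowed; all notions below are
-- invariant under them.

module Poly (𝔽 : FiniteField) where
  open FiniteField 𝔽

  q : ℕ
  q = size

  elems : List Carrier
  elems = map (Inverse.to enum) (allFin size)

  Pol : Set
  Pol = List Carrier

  isZeroC : Carrier → Bool
  isZeroC c = ⌊ c ≟ 0# ⌋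

  _+P_ : Pol → Pol → Pol
  [] +P ys = ys
  (x ∷ xs) +P [] = x ∷ xs
  (x ∷ xs) +P (y ∷ ys) = (x + y) ∷ (xs +P ys)

  -P_ : Pol → Pol
  -P xs = map -_ xs

  _-P_ : Pol → Pol → Pol
  xs -P ys = xs +P (-P ys)

  _*P_ : Pol → Pol → Pol
  [] *P ys = []
  (x ∷ xs) *P ys = map (x *_) ys +P (0# ∷ (xs *P ys))

  coeff : Pol → ℕ → Carrier
  coeff [] i = 0#
  coeff (x ∷ xs) zero = x
  coeff (x ∷ xs) (suc i) = coeff xs i

  _≈P_ : Pol → Pol → Set
  xs ≈P ys = ∀ i → coeff xs i ≡ coeff ys i

  isZeroP : Pol → Bool
  isZeroP xs = foldr (λ c b → isZeroC c ∧ b) true xs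

  _==P_ : Pol → Pol → Bool
  xs ==P ys = isZeroP (xs -P ys)

  -- nlen F = 0 if F = 0, and deg F + 1 otherwise
  nlen : Pol → ℕ
  nlen [] = 0
  nlen (x ∷ xs) with nlen xs
  ... | suc n = suc (suc n)
  ... | zero  = if isZeroC x then 0 else 1

  deg : Pol → ℕ
  deg F = nlen F ℕ.∸ 1

  ∣_∣P : Pol → ℕ
  ∣ F ∣P with nlen F
  ... | zero = 0
  ... | suc n = q ℕ.^ n

  polys : ℕ → List Pol
  polys zero = [ [] ]
  polys (suc n) = concatMap (λ c → map (c ∷_) (polys n)) elems

  count : {A : Set} → (A → Bool) → List A → ℕ
  count p xs = length (filterᵇ p xs)

  _∣P_ : Pol → Pol → Set
  P ∣P A = ∃ λ R → (P *P R) ≈P A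

  -- decidable divisibility: a quotient, if it exists, has degree ≤ deg A
  -- (for P nonzero, or A = 0), so it occurs among polys (length A).
  divᵇ : Pol → Pol → Bool
  divᵇ P A = any (λ R → (P *P R) ==P A) (polys (length A))

  -- gcd(A, Q) = 1 : A and Q have no common divisor of positive degree.
  -- (Any divisor of the nonzero Q has degree < length Q.)
  coprimeᵇ : Pol → Pol → Bool
  coprimeᵇ A Q =
    not (any (λ P → (2 ℕ.≤ᵇ nlen P) ∧ divᵇ P A ∧ divᵇ P Q) (polys (length Q)))

  Monic : Pol → Set
  Monic Q = ∃ λ cs → Q ≡ cs ++ [ 1# ]

  Squarefree : Pol → Set
  Squarefree Q = ∀ P → 1 ℕ.≤ deg P → ¬ ((P *P P) ∣P Q)

  φ : Pol → ℕ
  φ Q = count (λ A → coprimeᵇ A Q) (polys (deg Q))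

  -- #{G ∈ I(F,h) : gcd(G,Q) = 1}.  Every G ∈ I(F,h) has degree
  -- < max(deg Q, h) since deg F < deg Q, so G is enumerated.
  N : Pol → ℕ → Pol → ℕ
  N Q h F = count (λ G → (∣ F -P G ∣P ℕ.<ᵇ q ℕ.^ h) ∧ coprimeᵇ G Q)
                  (polys (deg Q ℕ.⊔ h))

ℕ→ℚ : ℕ → ℚ
ℕ→ℚ n = (+ n) ℚ./ 1

_^Q_ : ℚ → ℕ → ℚ
x ^Q zero = 1ℚ
x ^Q suc n = x ℚ.* (x ^Q n)

sumQ : List ℚ → ℚ
sumQ = foldr ℚ._+_ 0ℚ

-- x / n (n is always ≥ 1 where used; value at n = 0 is irrelevant)
_÷ℕ_ : ℚ → ℕ → ℚ
x ÷ℕ zero = 0ℚ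
x ÷ℕ suc n = x ℚ.* ((+ 1) ℚ./ suc n)

-- For y ≥ 0:  "x ≤ y · B^(n / (suc k))"  (a real power), expressed
-- without reals: either x ≤ 0, or x^(k+1) ≤ y^(k+1) · B^n.
LeMulRPow : ℚ → ℚ → ℕ → ℕ → ℕ → Set
LeMulRPow x y B n k =
  (x ℚ.≤ 0ℚ) ⊎ ((x ^Q suc k) ℚ.≤ ((y ^Q suc k) ℚ.* ℕ→ℚ (B ℕ.^ n)))

module Moments (𝔽 : FiniteField) where
  open Poly 𝔽

  m₅ : Pol → ℕ → ℚ
  m₅ Q h = sumQ (map (λ F → (ℕ→ℚ (N Q h F) ℚ.-
                              (ℕ→ℚ (q ℕ.^ h ℕ.* φ Q) ÷ℕ ∣ Q ∣P)) ^Q 5)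
                     (polys (deg Q)))

-- Write P = φ(Q)/|Q|. Expanding the indicator of coprimality to Q over the divisors of Q, and detecting
-- divisibility by linear functionals in the role of additive characters, m₅(Q; h) becomes |Q| q^(5h) times a
-- sum over nonzero A₁, …, A₅ of degree < deg Q - h with A₁ + … + A₅ = 0, in which Aᵢ has a coefficient of
-- absolute value P / φ(Rᵢ), where Rᵢ is the reduced denominator of Aᵢ / Q.
--
-- The core is an estimate for the decompositions of a given fraction θ / Q into two fractions of norm
-- < q^(-h), weighted by 1/φ of the denominators and by q^min(t, h), where t is the excess of the degrees of
-- the two denominators over that of θ / Q: the weighted number is, up to q^(εh) or a power of |Q|/φ(Q), a
-- multiplicative weight of θ. If the gcd of the two denominators has degree ≥ h, the decompositions with given
-- denominators lie in a coset of a space of known dimension; otherwise the primes common to the two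
-- denominators but foreign to θ have bounded total degree and a determinant argument counts the solutions.
--
-- Splitting off A₁, …, A₄ one at a time from 0 gives four excesses. A nonzero fraction of norm < q^(-h) has a
-- denominator of degree > h; hence, once the Aᵢ are suitably ordered, the numbers min(t, h) add up to at
-- least 3h, which yields |m₅| ≪ |Q| q^(2h) q^(εh) (|Q|/φ(Q))^25. Comparing q^(εh) with (|Q|/φ(Q))² finishes.

module Submission where

open import Defs
open import Level using (0ℓ)
open import Algebra.Bundles using (CommutativeRing)
import Algebra.Properties.Ring
open import Data.Bool using (Bool; true; false; not; _∧_; _∨_; if_then_else_)
import Data.Bool.Properties as 𝔹ₚ
open import Data.Empty using (⊥; ⊥-elim)
open import Data.Fin as Fin using (Fin)
import Data.Integer as ℤ
import Data.Integer.Properties as ℤₚ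
open import Data.List using (List; []; _∷_; _++_; [_]; length; map; concatMap; filterᵇ; allFin; drop; upTo)
import Data.List.Properties as Listₚ
open import Data.List.Membership.Propositional using (_∈_; find)
import Data.List.Membership.Propositional.Properties as ∈ₚ
open import Data.List.Relation.Unary.All as All using (All; []; _∷_)
import Data.List.Relation.Unary.All.Properties as Allₚ
open import Data.List.Relation.Unary.AllPairs as AllPairs using (AllPairs; []; _∷_)
import Data.List.Relation.Unary.AllPairs.Properties as AllPairsₚ
open import Data.List.Relation.Unary.Any as Any using (Any; here; there; any?)
import Data.List.Relation.Unary.Unique.Propositional.Properties as Uniqueₚ
open import Data.Nat as ℕ using (ℕ; zero; suc; z≤n; s≤s; _∸_; _⊔_; _⊓_)
open import Data.Nat.DivMod using (_/_; m/n*n≤m; m/n/o≡m/[n*o]; /-monoˡ-≤; m*n/n≡m; m≡m%n+[m/n]*n; m%n<n)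
import Data.Nat.Properties as ℕₚ
open import Data.Nat.Solver using () renaming (module +-*-Solver to ℕ-Solver)
open import Data.Product using (∃; _,_; _×_; proj₁; proj₂)
open import Data.Rational as ℚ using (ℚ; 0ℚ; 1ℚ)
import Data.Rational.Properties as ℚₚ
open import Data.Rational.Solver using (module +-*-Solver)
import Data.Rational.Unnormalised as ℚᵘ
import Data.Rational.Unnormalised.Properties as ℚᵘₚ
open import Data.Sum using (_⊎_; inj₁; inj₂)
open import Function using (_∘_; case_of_)
open import Function.Bundles using (Inverse)
open import Relation.Binary.Bundles using (Setoid)
open import Relation.Binary.PropositionalEquality hiding ([_]; J)
open import Relation.Nullary using (¬_; Dec; yes; no)
open import Relation.Nullary.Decidable using (⌊_⌋)

-- No cancellation is used: coefficients enter through absolute values only, and five factors q^h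
-- must shrink to q^(2h). The missing q^(3h) comes from the gains q^min(t, h). The cap at h is
-- natural: in the critical case a class of decompositions has at most q^max(t - h, 0) members, and
-- count times gain is then q^t, which factors over primes. The obstacle is the set B of primes
-- shared by the two denominators but absent from that of θ / Q. When the gcd has degree < h, fixing
-- B and the patterns at the other primes leaves at most one decomposition, but there are too many
-- sets B. So only j = deg B is fixed, and the decompositions with any B of that degree are counted
-- together; the part of the weight carried by B is at most a divisor bound times q^(-2j). Write Z =
-- |Q|/φ(Q) = 1/P. The splitting with index k costs Z^(2^(k+1)), in all Z^(2+4+8+16) = Z^30, and the
-- five factors P reduce this to Z^25. In the final comparison 27 = 25 + 2, while 25 + 4 < 30 = 2 ·
-- 15 lets Z^29 be absorbed.

module RingIdentities {c ℓ} (R : CommutativeRing c ℓ) where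
  open CommutativeRing R using (_≈_; _+_; _*_; commutativeSemiring) renaming (Carrier to X; refl to ≈-refl)
  open import Algebra.Solver.Ring.NaturalCoefficients.Default commutativeSemiring

  interchange : ∀ (a b c d : X) → (a + b) + (c + d) ≈ (a + c) + (b + d)
  interchange = solve 4 (λ a b c d → (a :+ b) :+ (c :+ d) := (a :+ c) :+ (b :+ d)) ≈-refl

  rotate-last : ∀ (a b c d : X) → a + (b + (c + d)) ≈ (a + d) + (b + c)
  rotate-last = solve 4 (λ a b c d → a :+ (b :+ (c :+ d)) := (a :+ d) :+ (b :+ c)) ≈-refl

  swap-last : ∀ (a b c d : X) → ((a + b) + c) + d ≈ (b + c) + (a + d)
  swap-last = solve 4 (λ a b c d → ((a :+ b) :+ c) :+ d := (b :+ c) :+ (a :+ d)) ≈-refl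

  interchange* : ∀ (a b c d : X) → (a * b) * (c * d) ≈ (a * c) * (b * d)
  interchange* = solve 4 (λ a b c d → (a :* b) :* (c :* d) := (a :* c) :* (b :* d)) ≈-refl

  bezout-step : ∀ (v b q r u m : X) → v * (b * q + r) + (u * b + m * b) ≈ (u * b + v * r) + (v * q + m) * b
  bezout-step = solve 6 (λ v b q r u m → v :* (b :* q :+ r) :+ (u :* b :+ m :* b) := (u :* b :+ v :* r) :+ (v :* q :+ m) :* b) ≈-refl

  bezout-product : ∀ (u a v p u′ v′ r : X) → ((u * a + v * p) * u′ + u * (v′ * r)) * a + (v * v′) * (p * r) ≈ (u * a + v * p) * (u′ * a + v′ * r)
  bezout-product = solve 7 (λ u a v p u′ v′ r →
    ((u :* a :+ v :* p) :* u′ :+ u :* (v′ :* r)) :* a :+ (v :* v′) :* (p :* r) := (u :* a :+ v :* p) :* (u′ :* a :+ v′ :* r)) ≈-refl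

  euclid-step : ∀ (u a b v p : X) → u * (a * b) + (v * b) * p ≈ (u * a + v * p) * b
  euclid-step = solve 5 (λ u a b v p → u :* (a :* b) :+ (v :* b) :* p := (u :* a :+ v :* p) :* b) ≈-refl

-- Polynomials as a commutative ring; degree bounds and division by monic polynomials

module PolyRing (𝔽 : FiniteField) where
  open import Data.Nat using (_≤_; _<_)
  open FiniteField 𝔽 public
    using (Carrier; 0#; 1#; _≟_; 0≢1; inverse; size; enum; isCommutativeRing)
    renaming (_+_ to infixl 6 _+F_; _*_ to infixl 7 _*F_; -_ to infix 8 -F_)
  open Poly 𝔽 public
    renaming (_+P_ to infixl 6 _+P_; _-P_ to infixl 6 _-P_; _*P_ to infixl 7 _*P_; -P_ to infix 8 -P_)

  𝔽ring : CommutativeRing 0ℓ 0ℓ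
  𝔽ring = record { isCommutativeRing = isCommutativeRing }

  module F = CommutativeRing 𝔽ring
  module Fₚ = Algebra.Properties.Ring F.ring
  module Fᵢ = RingIdentities 𝔽ring

  infix 4 _≈_
  -- A record rather than a function type, so that unification recovers both polynomials from a
  -- proof.
  record _≈_ (A B : Pol) : Set where
    constructor mk
    field at : ∀ i → coeff A i ≡ coeff B i
  open _≈_ public

  ≈-refl : ∀ {A} → A ≈ A
  ≈-refl = mk λ i → refl

  ≈-sym : ∀ {A B} → A ≈ B → B ≈ A
  ≈-sym e = mk λ i → sym (at e i)

  ≈-trans : ∀ {A B C} → A ≈ B → B ≈ C → A ≈ C
  ≈-trans e f = mk λ i → trans (at e i) (at f i)

  ≡⇒≈ : ∀ {A B} → A ≡ B → A ≈ B
  ≡⇒≈ refl = ≈-refl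

  scal : Carrier → Pol → Pol
  scal c = map (c *F_)

  T : Pol → Pol
  T A = 0# ∷ A

  coeff-+ : ∀ A B i → coeff (A +P B) i ≡ coeff A i +F coeff B i
  coeff-+ [] B i = sym (F.+-identityˡ _)
  coeff-+ (x ∷ A) [] i = sym (F.+-identityʳ _)
  coeff-+ (x ∷ A) (y ∷ B) zero = refl
  coeff-+ (x ∷ A) (y ∷ B) (suc i) = coeff-+ A B i

  coeff-neg : ∀ A i → coeff (-P A) i ≡ -F coeff A i
  coeff-neg [] i = sym Fₚ.-0#≈0#
  coeff-neg (x ∷ A) zero = refl
  coeff-neg (x ∷ A) (suc i) = coeff-neg A i

  coeff-scal : ∀ c A i → coeff (scal c A) i ≡ c *F coeff A i
  coeff-scal c [] i = sym (F.zeroʳ c)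
  coeff-scal c (x ∷ A) zero = refl
  coeff-scal c (x ∷ A) (suc i) = coeff-scal c A i

  coeff-*∷ : ∀ x A B i → coeff ((x ∷ A) *P B) i ≡ x *F coeff B i +F coeff (T (A *P B)) i
  coeff-*∷ x A B i = trans (coeff-+ (scal x B) _ i) (cong (_+F _) (coeff-scal x B i))

  +-cong : ∀ {A A′ B B′} → A ≈ A′ → B ≈ B′ → A +P B ≈ A′ +P B′
  +-cong {A} {A′} {B} {B′} e f = mk λ i →
    trans (coeff-+ A B i) (trans (cong₂ _+F_ (at e i) (at f i)) (sym (coeff-+ A′ B′ i)))

  neg-cong : ∀ {A B} → A ≈ B → -P A ≈ -P B
  neg-cong {A} {B} e = mk λ i → trans (coeff-neg A i) (trans (cong (λ z → -F z) (at e i)) (sym (coeff-neg B i)))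

  scal-cong : ∀ c {A B} → A ≈ B → scal c A ≈ scal c B
  scal-cong c {A} {B} e = mk λ i → trans (coeff-scal c A i) (trans (cong (c *F_) (at e i)) (sym (coeff-scal c B i)))

  T-cong : ∀ {A B} → A ≈ B → T A ≈ T B
  T-cong e = mk λ { zero → refl ; (suc i) → at e i }

  T[]≈[] : T [] ≈ []
  T[]≈[] = mk λ { zero → refl ; (suc i) → refl }

  +-comm : ∀ A B → A +P B ≈ B +P A
  +-comm A B = mk λ i → trans (coeff-+ A B i) (trans (F.+-comm _ _) (sym (coeff-+ B A i)))

  +-assoc : ∀ A B C → (A +P B) +P C ≈ A +P (B +P C)
  +-assoc A B C = mk λ i → begin
    coeff ((A +P B) +P C) i ≡⟨ coeff-+ (A +P B) C i ⟩
    coeff (A +P B) i +F coeff C i ≡⟨ cong (_+F _) (coeff-+ A B i) ⟩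
    (coeff A i +F coeff B i) +F coeff C i ≡⟨ F.+-assoc _ _ _ ⟩
    coeff A i +F (coeff B i +F coeff C i) ≡⟨ cong (_ +F_) (coeff-+ B C i) ⟨
    coeff A i +F coeff (B +P C) i ≡⟨ coeff-+ A (B +P C) i ⟨
    coeff (A +P (B +P C)) i ∎
    where open ≡-Reasoning

  +-identityʳ : ∀ A → A +P [] ≈ A
  +-identityʳ A = mk λ i → trans (coeff-+ A [] i) (F.+-identityʳ _)

  neg-inverseʳ : ∀ A → A +P (-P A) ≈ []
  neg-inverseʳ A = mk λ i → trans (coeff-+ A (-P A) i) (trans (cong (coeff A i +F_) (coeff-neg A i)) (F.-‿inverseʳ _))

  *-congʳ : ∀ A {B C} → B ≈ C → A *P B ≈ A *P C
  *-congʳ [] e = ≈-refl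
  *-congʳ (x ∷ A) e = +-cong (scal-cong x e) (T-cong (*-congʳ A e))

  tail-≈ : ∀ {x y A B} → (x ∷ A) ≈ (y ∷ B) → A ≈ B
  tail-≈ e = mk λ i → at e (suc i)

  *-zeroˡ-≈ : ∀ A B → A ≈ [] → A *P B ≈ []
  *-zeroˡ-≈ [] B e = ≈-refl
  *-zeroˡ-≈ (x ∷ A) B e = mk λ i → trans (coeff-*∷ x A B i)
    (trans (cong₂ _+F_ (trans (cong (_*F _) (at e 0)) (F.zeroˡ _))
                       (at (≈-trans (T-cong (*-zeroˡ-≈ A B (mk λ j → at e (suc j)))) T[]≈[]) i))
           (F.+-identityˡ _))

  *-congˡ : ∀ {A A′} B → A ≈ A′ → A *P B ≈ A′ *P B
  *-congˡ {[]} {A′} B e = ≈-sym (*-zeroˡ-≈ A′ B (≈-sym e))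
  *-congˡ {x ∷ A} {[]} B e = *-zeroˡ-≈ (x ∷ A) B e
  *-congˡ {x ∷ A} {y ∷ A′} B e = +-cong
    (≡⇒≈ (cong (λ z → scal z B) (at e 0))) (T-cong (*-congˡ B (tail-≈ e)))

  *-cong : ∀ {A A′ B B′} → A ≈ A′ → B ≈ B′ → A *P B ≈ A′ *P B′
  *-cong {A} {A′} {B} {B′} e f = ≈-trans (*-congʳ A f) (*-congˡ B′ e)

  *-consʳ : ∀ A y B → A *P (y ∷ B) ≈ scal y A +P T (A *P B)
  *-consʳ [] y B = ≈-sym T[]≈[]
  *-consʳ (x ∷ A) y B = mk λ
    { zero → cong (_+F 0#) (F.*-comm x y)
    ; (suc i) → begin
        coeff (scal x B +P (A *P (y ∷ B))) i
          ≡⟨ at (+-cong (≈-refl {scal x B}) (*-consʳ A y B)) i ⟩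
        coeff (scal x B +P (scal y A +P T (A *P B))) i
          ≡⟨ at (≈-trans (≈-sym (+-assoc (scal x B) (scal y A) _)) (≈-trans (+-cong (+-comm (scal x B) (scal y A)) ≈-refl) (+-assoc (scal y A) (scal x B) _))) i ⟩
        coeff (scal y A +P (scal x B +P T (A *P B))) i ∎ }
    where open ≡-Reasoning

  *-zeroʳ : ∀ A → A *P [] ≈ []
  *-zeroʳ [] = ≈-refl
  *-zeroʳ (x ∷ A) = ≈-trans (T-cong (*-zeroʳ A)) T[]≈[]

  *-comm : ∀ A B → A *P B ≈ B *P A
  *-comm [] B = ≈-sym (*-zeroʳ B)
  *-comm (x ∷ A) B = ≈-trans (+-cong ≈-refl (T-cong (*-comm A B))) (≈-sym (*-consʳ B x A))

  scal-+ : ∀ c A B → scal c (A +P B) ≈ scal c A +P scal c B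
  scal-+ c A B = mk λ i → begin
    coeff (scal c (A +P B)) i ≡⟨ coeff-scal c (A +P B) i ⟩
    c *F coeff (A +P B) i ≡⟨ cong (c *F_) (coeff-+ A B i) ⟩
    c *F (coeff A i +F coeff B i) ≡⟨ F.distribˡ c _ _ ⟩
    c *F coeff A i +F c *F coeff B i ≡⟨ cong₂ _+F_ (coeff-scal c A i) (coeff-scal c B i) ⟨
    coeff (scal c A) i +F coeff (scal c B) i ≡⟨ coeff-+ (scal c A) (scal c B) i ⟨
    coeff (scal c A +P scal c B) i ∎
    where open ≡-Reasoning

  +-interchange : ∀ A B C D → (A +P B) +P (C +P D) ≈ (A +P C) +P (B +P D)
  +-interchange A B C D = mk λ i → begin
    coeff ((A +P B) +P (C +P D)) i ≡⟨ expand A B C D i ⟩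
    (coeff A i +F coeff B i) +F (coeff C i +F coeff D i) ≡⟨ Fᵢ.interchange (coeff A i) (coeff B i) (coeff C i) (coeff D i) ⟩
    (coeff A i +F coeff C i) +F (coeff B i +F coeff D i) ≡⟨ expand A C B D i ⟨
    coeff ((A +P C) +P (B +P D)) i ∎
    where
      open ≡-Reasoning
      expand : ∀ A B C D i → coeff ((A +P B) +P (C +P D)) i ≡ (coeff A i +F coeff B i) +F (coeff C i +F coeff D i)
      expand A B C D i = trans (coeff-+ (A +P B) (C +P D) i) (cong₂ _+F_ (coeff-+ A B i) (coeff-+ C D i))

  *-distribˡ : ∀ A B C → A *P (B +P C) ≈ (A *P B) +P (A *P C)
  *-distribˡ [] B C = ≈-refl
  *-distribˡ (x ∷ A) B C = ≈-trans
    (+-cong (scal-+ x B C) (≈-trans (T-cong (*-distribˡ A B C)) (mk λ { zero → sym (F.+-identityˡ 0#) ; (suc i) → refl })))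
    (+-interchange (scal x B) (scal x C) (T (A *P B)) (T (A *P C)))

  *-distribʳ : ∀ A B C → (B +P C) *P A ≈ (B *P A) +P (C *P A)
  *-distribʳ A B C = ≈-trans (*-comm (B +P C) A) (≈-trans (*-distribˡ A B C) (+-cong (*-comm A B) (*-comm A C)))

  scal-*ˡ : ∀ c A B → scal c A *P B ≈ scal c (A *P B)
  scal-*ˡ c [] B = ≈-refl
  scal-*ˡ c (x ∷ A) B = ≈-trans
    (+-cong (mk λ i → trans (coeff-scal (c *F x) B i) (trans (F.*-assoc c x _)
              (sym (trans (coeff-scal c (scal x B) i) (cong (c *F_) (coeff-scal x B i))))))
            (≈-trans {_} {T (scal c (A *P B))} {scal c (T (A *P B))} (T-cong (scal-*ˡ c A B)) (mk λ { zero → sym (F.zeroʳ c) ; (suc i) → refl })))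
    (≈-sym (scal-+ c (scal x B) (T (A *P B))))

  T-*ˡ : ∀ A B → T A *P B ≈ T (A *P B)
  T-*ˡ A B = mk λ i → trans (coeff-*∷ 0# A B i)
    (trans (cong (_+F coeff (T (A *P B)) i) (F.zeroˡ _)) (F.+-identityˡ _))

  T-*ʳ : ∀ A B → A *P T B ≈ T (A *P B)
  T-*ʳ A B = ≈-trans (*-comm A (T B)) (≈-trans (T-*ˡ B A) (T-cong (*-comm B A)))

  *-assoc : ∀ A B C → (A *P B) *P C ≈ A *P (B *P C)
  *-assoc [] B C = ≈-refl
  *-assoc (x ∷ A) B C = ≈-trans (*-distribʳ C (scal x B) (T (A *P B)))
    (+-cong (scal-*ˡ x B C) (≈-trans (T-*ˡ (A *P B) C) (T-cong (*-assoc A B C))))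

  const* : ∀ c A → [ c ] *P A ≈ scal c A
  const* c A = ≈-trans (+-cong ≈-refl T[]≈[]) (+-identityʳ (scal c A))

  *-identityˡ : ∀ A → [ 1# ] *P A ≈ A
  *-identityˡ A = ≈-trans (const* 1# A) (mk λ i → trans (coeff-scal 1# A i) (F.*-identityˡ _))

  polRing : CommutativeRing 0ℓ 0ℓ
  polRing = record
    { Carrier = Pol ; _≈_ = _≈_ ; _+_ = _+P_ ; _*_ = _*P_ ; -_ = -P_ ; 0# = [] ; 1# = [ 1# ]
    ; isCommutativeRing = record
      { isRing = record
        { +-isAbelianGroup = record
          { isGroup = record
            { isMonoid = record
              { isSemigroup = record
                { isMagma = record
                  { isEquivalence = record { refl = ≈-refl ; sym = ≈-sym ; trans = ≈-trans }
                  ; ∙-cong = +-cong }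
                ; assoc = +-assoc }
              ; identity = (λ _ → ≈-refl) , +-identityʳ }
            ; inverse = (λ A → ≈-trans (+-comm (-P A) A) (neg-inverseʳ A)) , neg-inverseʳ
            ; ⁻¹-cong = neg-cong }
          ; comm = +-comm }
        ; *-cong = *-cong
        ; *-assoc = *-assoc
        ; *-identity = *-identityˡ , λ A → ≈-trans (*-comm A [ 1# ]) (*-identityˡ A)
        ; distrib = *-distribˡ , *-distribʳ }
      ; *-comm = *-comm } }

  polSetoid : Setoid 0ℓ 0ℓ
  polSetoid = CommutativeRing.setoid polRing

  module PR = CommutativeRing polRing
  module Pₚ = Algebra.Properties.Ring PR.ring
  module Pᵢ = RingIdentities polRing

  infix 4 _<°_
  record _<°_ (A : Pol) (n : ℕ) : Set where
    constructor bd
    field vanish : ∀ i → n ≤ i → coeff A i ≡ 0#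
  open _<°_ public

  <°-resp : ∀ {A B n} → A ≈ B → A <° n → B <° n
  <°-resp e b = bd λ i le → trans (sym (at e i)) (vanish b i le)

  <°-mono : ∀ {A m n} → m ≤ n → A <° m → A <° n
  <°-mono le b = bd λ i le′ → vanish b i (ℕₚ.≤-trans le le′)

  <°-+ : ∀ {A B n} → A <° n → B <° n → A +P B <° n
  <°-+ {A} {B} a b = bd λ i le → trans (coeff-+ A B i)
    (trans (cong₂ _+F_ (vanish a i le) (vanish b i le)) (F.+-identityˡ 0#))

  <°-neg : ∀ {A n} → A <° n → -P A <° n
  <°-neg {A} a = bd λ i le → trans (coeff-neg A i) (trans (cong (λ z → -F z) (vanish a i le)) Fₚ.-0#≈0#)

  <°-sub : ∀ {A B n} → A <° n → B <° n → A -P B <° n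
  <°-sub a b = <°-+ a (<°-neg b)

  <°-scal : ∀ c {A n} → A <° n → scal c A <° n
  <°-scal c {A} a = bd λ i le → trans (coeff-scal c A i) (trans (cong (c *F_) (vanish a i le)) (F.zeroʳ c))

  <°-∷ : ∀ {x A n} → A <° n → (x ∷ A) <° suc n
  <°-∷ a = bd λ { (suc i) (s≤s le) → vanish a i le }

  <°-tail : ∀ {x A n} → (x ∷ A) <° suc n → A <° n
  <°-tail a = bd λ i le → vanish a (suc i) (s≤s le)

  <°-[] : ∀ {n} → [] <° n
  <°-[] = bd λ i le → refl

  <°0⇒≈[] : ∀ {A} → A <° 0 → A ≈ []
  <°0⇒≈[] a = mk λ i → vanish a i z≤n

  <°-length : ∀ A → A <° length A
  <°-length [] = <°-[]
  <°-length (x ∷ A) = <°-∷ (<°-length A)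

  <°-pred : ∀ {A n} → A <° suc n → coeff A n ≡ 0# → A <° n
  <°-pred {A} {n} a e = bd λ i le → case ℕₚ.m≤n⇒m<n∨m≡n le of λ
    { (inj₁ lt) → vanish a i lt ; (inj₂ refl) → e }

  <°-* : ∀ {A B a b} → A <° suc a → B <° b → A *P B <° a ℕ.+ b
  <°-* {[]} _ _ = <°-[]
  <°-* {x ∷ A} {B} {zero} {b} α β = <°-+ (<°-scal x β)
    (<°-resp (≈-sym (≈-trans (T-cong (*-zeroˡ-≈ A B (<°0⇒≈[] (<°-tail α)))) T[]≈[])) <°-[])
  <°-* {x ∷ A} {B} {suc a} {b} α β = <°-+
    (<°-mono (ℕₚ.m≤n+m b (suc a)) (<°-scal x β)) (<°-∷ (<°-* (<°-tail α) β))

  coeff-*-top : ∀ {A B a b} → A <° suc a → B <° suc b → coeff (A *P B) (a ℕ.+ b) ≡ coeff A a *F coeff B b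
  coeff-*-top {[]} _ _ = sym (F.zeroˡ _)
  coeff-*-top {x ∷ A} {B} {zero} {b} α β = trans (coeff-*∷ x A B b)
    (trans (cong (_ +F_) (at (≈-trans (T-cong (*-zeroˡ-≈ A B (<°0⇒≈[] (<°-tail α)))) T[]≈[]) b)) (F.+-identityʳ _))
  coeff-*-top {x ∷ A} {B} {suc a} {b} α β = trans (coeff-*∷ x A B (suc a ℕ.+ b))
    (trans (cong₂ _+F_ (trans (cong (x *F_) (vanish β _ (s≤s (ℕₚ.m≤n+m b a)))) (F.zeroʳ x))
                       (coeff-*-top (<°-tail α) β))
           (F.+-identityˡ _))

  -- Monic of degree exactly `d`, in a form invariant under trailing zeros, whereas `Monic`
  -- prescribes the shape of the list.
  record Mon (A : Pol) (d : ℕ) : Set where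
    constructor mon
    field
      lead : coeff A d ≡ 1#
      bound : A <° suc d
  open Mon public

  Mon-resp : ∀ {A B d} → A ≈ B → Mon A d → Mon B d
  Mon-resp {d = d} e m = mon (trans (sym (at e d)) (lead m)) (<°-resp e (bound m))

  Mon-1 : Mon [ 1# ] 0
  Mon-1 = mon refl (<°-∷ <°-[])

  Mon-* : ∀ {A B a b} → Mon A a → Mon B b → Mon (A *P B) (a ℕ.+ b)
  Mon-* {A} {B} {a} {b} α β = mon
    (trans (coeff-*-top (bound α) (bound β)) (trans (cong₂ _*F_ (lead α) (lead β)) (F.*-identityˡ 1#)))
    (subst (A *P B <°_) (ℕₚ.+-suc a b) (<°-* (bound α) (bound β)))

  -- As `D` is monic, the top coefficient of `D *P C` is that of `C`. The bound on `C` is lowered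
  -- one step at a time, starting from `length C`.
  Mon-cancel : ∀ {D C d} c → Mon D d → D *P C <° d ℕ.+ c → C <° c
  Mon-cancel {D} {C} {d} c δ b = go (length C) (<°-mono (ℕₚ.m≤n+m _ c) (<°-length C))
    where
      go : ∀ m → C <° c ℕ.+ m → C <° c
      go zero γ = subst (C <°_) (ℕₚ.+-identityʳ c) γ
      go (suc m) γ = go m (<°-pred γ′ (begin
          coeff C (c ℕ.+ m) ≡⟨ F.*-identityˡ _ ⟨
          1# *F coeff C (c ℕ.+ m) ≡⟨ cong (_*F _) (lead δ) ⟨
          coeff D d *F coeff C (c ℕ.+ m) ≡⟨ coeff-*-top (bound δ) γ′ ⟨
          coeff (D *P C) (d ℕ.+ (c ℕ.+ m)) ≡⟨ vanish b _ (ℕₚ.+-monoʳ-≤ d (ℕₚ.m≤m+n c m)) ⟩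
          0# ∎))
        where
          open ≡-Reasoning
          γ′ : C <° suc (c ℕ.+ m)
          γ′ = subst (C <°_) (ℕₚ.+-suc c m) γ

  Mon-cancel-0 : ∀ {D C d} → Mon D d → D *P C <° d → C ≈ []
  Mon-cancel-0 {D} {C} {d} δ b = <°0⇒≈[] (Mon-cancel 0 δ (subst (_ <°_) (sym (ℕₚ.+-identityʳ d)) b))

  -- Division by D, meant for D monic of degree d.
  module Div (D : Pol) (d : ℕ) where
    -- Horner's scheme: if `rem A` has degree < `d`, then `a ∷ rem A` has degree at most `d`, and
    -- subtracting one scalar multiple of `D` restores the bound.
    rem quo : Pol → Pol
    rem [] = []
    rem (a ∷ A) = (a ∷ rem A) -P scal (coeff (a ∷ rem A) d) D
    quo [] = []
    quo (a ∷ A) = coeff (a ∷ rem A) d ∷ quo A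

    rem-quo : ∀ A → A ≈ (D *P quo A) +P rem A
    rem-quo [] = ≈-sym (≈-trans (+-identityʳ _) (*-zeroʳ D))
    rem-quo (a ∷ A) = ≈-sym (begin
      (D *P (c ∷ quo A)) +P (r -P scal c D)
        ≈⟨ +-cong (*-consʳ D c (quo A)) ≈-refl ⟩
      (scal c D +P T (D *P quo A)) +P (r -P scal c D)
        ≈⟨ +-interchange (scal c D) (T (D *P quo A)) r (-P scal c D) ⟩
      (scal c D +P r) +P (T (D *P quo A) +P (-P scal c D))
        ≈⟨ +-cong (+-comm (scal c D) r) (+-comm (T (D *P quo A)) (-P scal c D)) ⟩
      (r +P scal c D) +P ((-P scal c D) +P T (D *P quo A))
        ≈⟨ +-assoc r (scal c D) _ ⟩
      r +P (scal c D +P ((-P scal c D) +P T (D *P quo A)))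
        ≈⟨ +-cong (≈-refl {r}) (≈-trans (≈-sym (+-assoc (scal c D) (-P scal c D) _)) (+-cong (neg-inverseʳ (scal c D)) ≈-refl)) ⟩
      r +P T (D *P quo A)
        ≈⟨ +-comm r (T (D *P quo A)) ⟩
      (0# +F a) ∷ ((D *P quo A) +P rem A)
        ≈⟨ (mk λ { zero → F.+-identityˡ a ; (suc i) → sym (at (rem-quo A) i) }) ⟩
      a ∷ A ∎)
      where
        open import Relation.Binary.Reasoning.Setoid polSetoid
        r : Pol
        r = a ∷ rem A
        c : Carrier
        c = coeff r d

    module _ (δ : Mon D d) where
      <°-rem : ∀ A → rem A <° d
      <°-rem [] = <°-[]
      <°-rem (a ∷ A) = <°-pred (<°-sub (<°-∷ (<°-rem A)) (<°-scal c (bound δ))) (begin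
          coeff (r -P scal c D) d ≡⟨ coeff-+ r (-P scal c D) d ⟩
          c +F coeff (-P scal c D) d ≡⟨ cong (c +F_) (coeff-neg (scal c D) d) ⟩
          c +F (-F coeff (scal c D) d) ≡⟨ cong (λ z → c +F (-F z)) (trans (coeff-scal c D d) (trans (cong (c *F_) (lead δ)) (F.*-identityʳ c))) ⟩
          c +F (-F c) ≡⟨ F.-‿inverseʳ c ⟩
          0# ∎)
        where
          open ≡-Reasoning
          r : Pol
          r = a ∷ rem A
          c : Carrier
          c = coeff r d

      -- The difference of the two remainders is `D` times the difference of the quotients and has
      -- degree < `d`, so the quotients agree.
      rem-unique : ∀ {A K R} → A ≈ (D *P K) +P R → R <° d → rem A ≈ R
      rem-unique {A} {K} {R} e ρ = x∙y⁻¹≈ε⇒x≈y (rem A) R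
          (≈-trans (≈-sym eq) (≈-trans (*-congʳ D z) (*-zeroʳ D)))
        where
          open import Algebra.Properties.Group PR.+-group using (x∙y⁻¹≈ε⇒x≈y)
          open import Relation.Binary.Reasoning.Setoid polSetoid
          eq : D *P (K -P quo A) ≈ rem A -P R
          eq = begin
            D *P (K -P quo A) ≈⟨ *-distribˡ D K (-P quo A) ⟩
            (D *P K) +P (D *P (-P quo A)) ≈⟨ +-cong (≈-refl {D *P K}) (≈-sym (Pₚ.-‿distribʳ-* D (quo A))) ⟩
            (D *P K) -P (D *P quo A) ≈⟨ +-cong (≈-refl {D *P K}) (≈-sym (+-identityʳ _)) ⟩
            (D *P K) +P ((-P (D *P quo A)) +P []) ≈⟨ +-cong (≈-refl {D *P K}) (+-cong (≈-refl { -P (D *P quo A)}) (≈-sym (≈-trans (+-comm (-P R) R) (neg-inverseʳ R)))) ⟩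
            (D *P K) +P ((-P (D *P quo A)) +P ((-P R) +P R)) ≈⟨ Pᵢ.rotate-last (D *P K) (-P (D *P quo A)) (-P R) R ⟩
            ((D *P K) +P R) +P ((-P (D *P quo A)) +P (-P R)) ≈⟨ +-cong (≈-sym e) ≈-refl ⟩
            A +P ((-P (D *P quo A)) +P (-P R)) ≈⟨ +-cong (rem-quo A) ≈-refl ⟩
            ((D *P quo A) +P rem A) +P ((-P (D *P quo A)) +P (-P R)) ≈⟨ +-interchange (D *P quo A) (rem A) (-P (D *P quo A)) (-P R) ⟩
            ((D *P quo A) -P (D *P quo A)) +P (rem A -P R) ≈⟨ +-cong (neg-inverseʳ (D *P quo A)) ≈-refl ⟩
            rem A -P R ∎
          z : K -P quo A ≈ []
          z = Mon-cancel-0 δ (<°-resp (≈-sym eq) (<°-sub (<°-rem A) ρ))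

  isZeroC-true : ∀ {c} → isZeroC c ≡ true → c ≡ 0#
  isZeroC-true {c} e with c ≟ 0#
  ... | yes p = p

  isZeroC-0 : ∀ {c} → c ≡ 0# → isZeroC c ≡ true
  isZeroC-0 {c} e with c ≟ 0#
  ... | yes p = refl
  ... | no ¬p = ⊥-elim (¬p e)

  ∧-true : ∀ {a b} → a ∧ b ≡ true → (a ≡ true) × (b ≡ true)
  ∧-true {true} {true} e = refl , refl

  isZeroP⇒≈[] : ∀ A → isZeroP A ≡ true → A ≈ []
  isZeroP⇒≈[] [] e = ≈-refl
  isZeroP⇒≈[] (x ∷ A) e with ∧-true {isZeroC x} e
  ... | e₁ , e₂ = mk λ { zero → isZeroC-true e₁ ; (suc i) → at (isZeroP⇒≈[] A e₂) i }

  ≈[]⇒isZeroP : ∀ A → A ≈ [] → isZeroP A ≡ true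
  ≈[]⇒isZeroP [] e = refl
  ≈[]⇒isZeroP (x ∷ A) e = cong₂ _∧_ (isZeroC-0 (at e 0)) (≈[]⇒isZeroP A (mk λ i → at e (suc i)))

  ≈[]? : ∀ A → Dec (A ≈ [])
  ≈[]? A with isZeroP A in eq
  ... | true = yes (isZeroP⇒≈[] A eq)
  ... | false = no λ e → case trans (sym eq) (≈[]⇒isZeroP A e) of λ ()

  leading : ∀ n A → A <° n → A ≈ [] ⊎ ∃ λ d → d < n × coeff A d ≢ 0# × A <° suc d
  leading zero A a = inj₁ (<°0⇒≈[] a)
  leading (suc n) A a with coeff A n ≟ 0#
  ... | no ¬p = inj₂ (n , ℕₚ.≤-refl , ¬p , a)
  ... | yes p with leading n A (<°-pred a p)
  ...   | inj₁ z = inj₁ z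
  ...   | inj₂ (d , lt , rest) = inj₂ (d , ℕₚ.m≤n⇒m≤1+n lt , rest)

  normalise : ∀ {A d} → coeff A d ≢ 0# → A <° suc d → ∃ λ c → ∃ λ c⁻¹ → c *F c⁻¹ ≡ 1# × Mon (scal c⁻¹ A) d
  normalise {A} {d} ne a with inverse (coeff A d) ne
  ... | c⁻¹ , e = coeff A d , c⁻¹ , e , mon (trans (coeff-scal c⁻¹ A d) (trans (F.*-comm c⁻¹ _) e)) (<°-scal c⁻¹ a)

-- Divisibility, Bézout identities, and products of distinct primes

module Divisibility (𝔽 : FiniteField) where
  open import Data.Nat using (_≤_; _<_)
  open PolyRing 𝔽
  open import Algebra.Properties.Group PR.+-group public using () renaming (x∙y⁻¹≈ε⇒x≈y to sub≈0⇒≈; x≈y⇒x∙y⁻¹≈ε to ≈⇒sub≈0)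
  module ≈-Reasoning where
    open import Relation.Binary.Reasoning.Setoid polSetoid public

  infix 4 _∣_
  record _∣_ (P A : Pol) : Set where
    constructor dv
    field
      cofactor : Pol
      equality : P *P cofactor ≈ A
  open _∣_ public

  ∣-refl : ∀ {P} → P ∣ P
  ∣-refl {P} = dv [ 1# ] (PR.*-identityʳ P)

  ∣-resp : ∀ {P A B} → A ≈ B → P ∣ A → P ∣ B
  ∣-resp e (dv R f) = dv R (≈-trans f e)

  ∣-respˡ : ∀ {P P′ A} → P ≈ P′ → P ∣ A → P′ ∣ A
  ∣-respˡ {P} {P′} e (dv R f) = dv R (≈-trans (*-congˡ R (≈-sym e)) f)

  ∣-trans : ∀ {P A B} → P ∣ A → A ∣ B → P ∣ B
  ∣-trans {P} {A} {B} (dv R e) (dv S f) = dv (R *P S) (≈-trans (≈-sym (*-assoc P R S)) (≈-trans (*-congˡ S e) f))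

  ∣-0 : ∀ {P A} → A ≈ [] → P ∣ A
  ∣-0 {P} e = dv [] (≈-trans (*-zeroʳ P) (≈-sym e))

  ∣-+ : ∀ {P A B} → P ∣ A → P ∣ B → P ∣ A +P B
  ∣-+ {P} (dv R e) (dv S f) = dv (R +P S) (≈-trans (*-distribˡ P R S) (+-cong e f))

  ∣-neg : ∀ {P A} → P ∣ A → P ∣ -P A
  ∣-neg {P} (dv R e) = dv (-P R) (≈-trans (≈-sym (Pₚ.-‿distribʳ-* P R)) (neg-cong e))

  ∣-sub : ∀ {P A B} → P ∣ A → P ∣ B → P ∣ A -P B
  ∣-sub a b = ∣-+ a (∣-neg b)

  ∣-*ʳ : ∀ {P A} B → P ∣ A → P ∣ A *P B
  ∣-*ʳ {P} B (dv R e) = dv (R *P B) (≈-trans (≈-sym (*-assoc P R B)) (*-congˡ B e))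

  ∣-*ˡ : ∀ {P A} B → P ∣ A → P ∣ B *P A
  ∣-*ˡ {A = A} B a = ∣-resp (*-comm A B) (∣-*ʳ B a)

  sub-cancel : ∀ A B → (A -P B) +P B ≈ A
  sub-cancel A B = ≈-trans (+-assoc A (-P B) B) (≈-trans (+-cong (≈-refl {A}) (≈-trans (+-comm (-P B) B) (neg-inverseʳ B))) (+-identityʳ A))

  add-cancel : ∀ A B → (A +P B) -P B ≈ A
  add-cancel A B = ≈-trans (+-assoc A B (-P B)) (≈-trans (+-cong (≈-refl {A}) (neg-inverseʳ B)) (+-identityʳ A))

  +⇒sub : ∀ {A B C} → A +P B ≈ C → A ≈ C -P B
  +⇒sub {A} {B} e = ≈-trans (≈-sym (add-cancel A B)) (+-cong e ≈-refl)

  ∣-+-cancelʳ : ∀ {P A B} → P ∣ A +P B → P ∣ B → P ∣ A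
  ∣-+-cancelʳ {P} {A} {B} s b = ∣-resp (add-cancel A B) (∣-sub s b)

  scal-∣ : ∀ {c c⁻¹ A} → c *F c⁻¹ ≡ 1# → A ≈ scal c (scal c⁻¹ A)
  scal-∣ {c} {c⁻¹} {A} e = mk λ i → sym (begin
    coeff (scal c (scal c⁻¹ A)) i ≡⟨ coeff-scal c (scal c⁻¹ A) i ⟩
    c *F coeff (scal c⁻¹ A) i ≡⟨ cong (c *F_) (coeff-scal c⁻¹ A i) ⟩
    c *F (c⁻¹ *F coeff A i) ≡⟨ F.*-assoc _ _ _ ⟨
    (c *F c⁻¹) *F coeff A i ≡⟨ cong (_*F coeff A i) e ⟩
    1# *F coeff A i ≡⟨ F.*-identityˡ _ ⟩
    coeff A i ∎)
    where open ≡-Reasoning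

  ∣-scal : ∀ {P A} c → P ∣ A → P ∣ scal c A
  ∣-scal {P} {A} c a = ∣-resp (const* c A) (∣-*ˡ [ c ] a)

  scal-∣ˡ : ∀ {c c⁻¹ A B} → c *F c⁻¹ ≡ 1# → A ∣ B → scal c⁻¹ A ∣ B
  scal-∣ˡ {c} {c⁻¹} {A} e a = ∣-trans
    (∣-resp (≈-sym (scal-∣ e)) (∣-scal c (∣-refl {scal c⁻¹ A}))) a

  module _ {D d} (δ : Mon D d) where
    open Div D d

    ∣⇒rem : ∀ {A} → D ∣ A → isZeroP (rem A) ≡ true
    ∣⇒rem {A} (dv R e) = ≈[]⇒isZeroP _ (rem-unique δ {K = R} {R = []} (≈-trans (≈-sym e) (≈-sym (+-identityʳ (D *P R)))) <°-[])

    rem⇒∣ : ∀ {A} → isZeroP (rem A) ≡ true → D ∣ A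
    rem⇒∣ {A} e = dv (quo A) (≈-sym (≈-trans (rem-quo A)
      (≈-trans (+-cong (≈-refl {D *P quo A}) (isZeroP⇒≈[] _ e)) (+-identityʳ (D *P quo A)))))

    Mon-≉0 : ¬ (D ≈ [])
    Mon-≉0 e = 0≢1 (trans (sym (at e d)) (lead δ))

    Mon-∣-deg : ∀ {A n} → D ∣ A → A <° n → ¬ (A ≈ []) → d < n
    Mon-∣-deg {A} {n} (dv R e) a ne with d ℕₚ.<? n
    ... | yes lt = lt
    ... | no ¬lt = ⊥-elim (ne (≈-trans (≈-sym e) (≈-trans (*-congʳ D
            (Mon-cancel-0 {C = R} δ (<°-resp (≈-sym e) (<°-mono (ℕₚ.≮⇒≥ ¬lt) a)))) (*-zeroʳ D))))

    Mon-cofactor : ∀ {R A n} → Mon A n → D *P R ≈ A → ∃ λ m → Mon R m × d ℕ.+ m ≡ n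
    Mon-cofactor {R} {A} {n} α e = n ∸ d , mon l b , ℕₚ.m+[n∸m]≡n d≤n
      where
        d≤n : d ≤ n
        d≤n = ℕₚ.≤-pred (Mon-∣-deg (dv R e) (bound α) (λ z → 0≢1 (trans (sym (at z n)) (lead α))))
        b : R <° suc (n ∸ d)
        b = Mon-cancel {C = R} (suc (n ∸ d)) δ (<°-resp (≈-sym e)
          (subst (A <°_) (trans (cong suc (sym (ℕₚ.m+[n∸m]≡n d≤n))) (sym (ℕₚ.+-suc d (n ∸ d)))) (bound α)))
        l : coeff R (n ∸ d) ≡ 1#
        l = begin
          coeff R (n ∸ d) ≡⟨ F.*-identityˡ _ ⟨
          1# *F coeff R (n ∸ d) ≡⟨ cong (_*F coeff R (n ∸ d)) (lead δ) ⟨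
          coeff D d *F coeff R (n ∸ d) ≡⟨ coeff-*-top (bound δ) b ⟨
          coeff (D *P R) (d ℕ.+ (n ∸ d)) ≡⟨ at e _ ⟩
          coeff A (d ℕ.+ (n ∸ d)) ≡⟨ cong (coeff A) (ℕₚ.m+[n∸m]≡n d≤n) ⟩
          coeff A n ≡⟨ lead α ⟩
          1# ∎
          where open ≡-Reasoning

  Mon0⇒≈1 : ∀ {A} → Mon A 0 → A ≈ [ 1# ]
  Mon0⇒≈1 {A} α = mk λ { zero → lead α ; (suc i) → vanish (bound α) (suc i) (s≤s z≤n) }

  record Bezout (A B : Pol) : Set where
    field
      g u v : Pol
      combination : (u *P A) +P (v *P B) ≈ g
      g∣A : g ∣ A
      g∣B : g ∣ B

  -- Euclid's algorithm, with the degree bound `k` as fuel. `B` is scaled to a monic polynomial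
  -- before each division.
  bezout : ∀ k A B → B <° k → Bezout A B
  bezout-zero : ∀ A B → B ≈ [] → Bezout A B
  bezout-zero A B e = record
    { g = A ; u = [ 1# ] ; v = []
    ; combination = ≈-trans (+-identityʳ _) (*-identityˡ A)
    ; g∣A = ∣-refl ; g∣B = ∣-0 e }

  bezout zero A B b = bezout-zero A B (<°0⇒≈[] b)
  bezout (suc k) A B b with leading (suc k) B b
  ... | inj₁ z = bezout-zero A B z
  ... | inj₂ (d , lt , ne , b′) with normalise ne b′
  ...   | c , c⁻¹ , e , μ = record
    { g = g ; u = v ; v = [ c⁻¹ ] *P (u -P (v *P quo A))
    ; combination = comb
    ; g∣A = ∣-resp (≈-sym (rem-quo A)) (∣-+ (∣-*ʳ (quo A) g∣A) g∣B)
    ; g∣B = ∣-resp (≈-sym (scal-∣ e)) (∣-scal c g∣A) }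
    where
      B′ : Pol
      B′ = scal c⁻¹ B
      open Div B′ d
      open Bezout (bezout k B′ (rem A) (<°-mono (ℕₚ.≤-pred lt) (<°-rem μ A)))
      open ≈-Reasoning
      comb : (v *P A) +P (([ c⁻¹ ] *P (u -P (v *P quo A))) *P B) ≈ g
      comb = begin
        (v *P A) +P (([ c⁻¹ ] *P (u -P (v *P quo A))) *P B)
          ≈⟨ +-cong (*-congʳ v (rem-quo A)) (≈-trans (*-congˡ B (*-comm [ c⁻¹ ] (u -P (v *P quo A))))
               (≈-trans (*-assoc (u -P (v *P quo A)) [ c⁻¹ ] B) (*-congʳ (u -P (v *P quo A)) (const* c⁻¹ B)))) ⟩
        (v *P ((B′ *P quo A) +P rem A)) +P ((u -P (v *P quo A)) *P B′)
          ≈⟨ +-cong (≈-refl {v *P ((B′ *P quo A) +P rem A)}) (*-distribʳ B′ u (-P (v *P quo A))) ⟩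
        (v *P ((B′ *P quo A) +P rem A)) +P ((u *P B′) +P ((-P (v *P quo A)) *P B′))
          ≈⟨ Pᵢ.bezout-step v B′ (quo A) (rem A) u (-P (v *P quo A)) ⟩
        ((u *P B′) +P (v *P rem A)) +P (((v *P quo A) +P (-P (v *P quo A))) *P B′)
          ≈⟨ +-cong combination (≈-trans (*-congˡ B′ (neg-inverseʳ (v *P quo A))) ≈-refl) ⟩
        g +P []
          ≈⟨ +-identityʳ g ⟩
        g ∎

  -- Every divisor of an irreducible polynomial is constant or associated to it; being associated is
  -- expressed by divisibility in the other direction.
  record Prm : Set where
    field
      poly : Pol
      dg : ℕ
      monic : Mon poly dg
      positive : 1 ≤ dg
      irreducible : ∀ G → G ∣ poly → G <° 1 ⊎ poly ∣ G
  open Prm public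

  -- By irreducibility the gcd is constant, since a gcd divisible by `poly p` would make `poly p`
  -- divide `A`. The constant is scaled to 1.
  coprime-bezout : ∀ p A → ¬ (poly p ∣ A) → ∃ λ u → ∃ λ v → (u *P A) +P (v *P poly p) ≈ [ 1# ]
  coprime-bezout p A ¬d with bezout _ A (poly p) (bound (monic p))
  ... | record { g = g ; u = u ; v = v ; combination = comb ; g∣A = g∣A ; g∣B = g∣p } with irreducible p g g∣p
  ...   | inj₂ p∣g = ⊥-elim (¬d (∣-trans p∣g g∣A))
  ...   | inj₁ const with leading 1 g const
  ...     | inj₁ z = ⊥-elim (Mon-≉0 (monic p) (≈-trans (≈-sym (equality g∣p)) (*-zeroˡ-≈ g (cofactor g∣p) z)))
  ...     | inj₂ (suc _ , s≤s () , _)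
  ...     | inj₂ (zero , _ , ne , g<) with normalise ne g<
  ...       | c , c⁻¹ , e , μ = [ c⁻¹ ] *P u , [ c⁻¹ ] *P v , (begin
      (([ c⁻¹ ] *P u) *P A) +P (([ c⁻¹ ] *P v) *P poly p)
        ≈⟨ +-cong (*-assoc [ c⁻¹ ] u A) (*-assoc [ c⁻¹ ] v (poly p)) ⟩
      ([ c⁻¹ ] *P (u *P A)) +P ([ c⁻¹ ] *P (v *P poly p))
        ≈⟨ *-distribˡ [ c⁻¹ ] (u *P A) (v *P poly p) ⟨
      [ c⁻¹ ] *P ((u *P A) +P (v *P poly p))
        ≈⟨ *-congʳ [ c⁻¹ ] comb ⟩
      [ c⁻¹ ] *P g
        ≈⟨ const* c⁻¹ g ⟩
      scal c⁻¹ g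
        ≈⟨ Mon0⇒≈1 μ ⟩
      [ 1# ] ∎)
      where open ≈-Reasoning

  euclid : ∀ p A B → poly p ∣ A *P B → ¬ (poly p ∣ A) → poly p ∣ B
  euclid p A B ab ¬a with coprime-bezout p A ¬a
  ... | u , v , e = ∣-resp (begin
      (u *P (A *P B)) +P ((v *P B) *P poly p)
        ≈⟨ Pᵢ.euclid-step u A B v (poly p) ⟩
      ((u *P A) +P (v *P poly p)) *P B ≈⟨ *-congˡ B e ⟩
      [ 1# ] *P B ≈⟨ *-identityˡ B ⟩
      B ∎) (∣-+ (∣-*ˡ u ab) (∣-*ˡ (v *P B) ∣-refl))
    where open ≈-Reasoning

  dvd : Prm → Pol → Bool
  dvd p A = isZeroP (Div.rem (poly p) (dg p) A)

  dvd⇒∣ : ∀ p {A} → dvd p A ≡ true → poly p ∣ A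
  dvd⇒∣ p = rem⇒∣ (monic p)

  ∣⇒dvd : ∀ p {A} → poly p ∣ A → dvd p A ≡ true
  ∣⇒dvd p = ∣⇒rem (monic p)

  dvd-cong-⇔ : ∀ p q {A B} → (poly p ∣ A → poly q ∣ B) → (poly q ∣ B → poly p ∣ A) → dvd p A ≡ dvd q B
  dvd-cong-⇔ p q {A} {B} f g with dvd p A in e₁ | dvd q B in e₂
  ... | true | true = refl
  ... | false | false = refl
  ... | true | false = trans (sym (∣⇒dvd q (f (dvd⇒∣ p e₁)))) e₂
  ... | false | true = trans (sym e₁) (∣⇒dvd p (g (dvd⇒∣ q e₂)))

  dvd-resp : ∀ p {A B} → A ≈ B → dvd p A ≡ dvd p B
  dvd-resp p e = dvd-cong-⇔ p p (∣-resp e) (∣-resp (≈-sym e))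

  -- Sets of primes are Boolean predicates on a fixed list; this is the product over such a set, and
  -- `degIf` is its degree.
  prodIf : (Prm → Bool) → List Prm → Pol
  prodIf b [] = [ 1# ]
  prodIf b (p ∷ ps) = if b p then poly p *P prodIf b ps else prodIf b ps

  degIf : (Prm → Bool) → List Prm → ℕ
  degIf b [] = 0
  degIf b (p ∷ ps) = if b p then dg p ℕ.+ degIf b ps else degIf b ps

  prodIf-monic : ∀ b ps → Mon (prodIf b ps) (degIf b ps)
  prodIf-monic b [] = Mon-1
  prodIf-monic b (p ∷ ps) with b p
  ... | true = Mon-* (monic p) (prodIf-monic b ps)
  ... | false = prodIf-monic b ps

  ∣-prodIf : ∀ b ps → All (λ p → b p ≡ true → poly p ∣ prodIf b ps) ps
  ∣-prodIf b [] = []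
  ∣-prodIf b (p ∷ ps) with b p in eq
  ... | true = (λ _ → ∣-*ʳ (prodIf b ps) ∣-refl) ∷ All.map (λ f e → ∣-*ˡ (poly p) (f e)) (∣-prodIf b ps)
  ... | false = (λ e → case trans (sym e) eq of λ ()) ∷ ∣-prodIf b ps

  -- Later primes do not divide earlier ones: the direction in which Euclid's lemma passes the later
  -- primes to the cofactor once an earlier prime is split off.
  Apart : List Prm → Set
  Apart = AllPairs (λ p r → ¬ (poly r ∣ poly p))

  prodIf-∣ : ∀ b {ps A} → Apart ps → All (λ p → b p ≡ true → poly p ∣ A) ps → prodIf b ps ∣ A
  prodIf-∣ b {[]} {A} _ _ = dv A (*-identityˡ A)
  prodIf-∣ b {p ∷ ps} {A} (ap ∷ aps) (f ∷ fs) with b p in eq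
  ... | false = prodIf-∣ b aps fs
  ... | true with f refl
  ...   | dv R e = ∣-resp e (mul (prodIf-∣ b aps (All.zipWith
            (λ { {r} (¬r , h) br → euclid r (poly p) R (∣-resp (≈-sym e) (h br)) ¬r }) (ap , fs))))
    where
      mul : ∀ {D} → D ∣ R → poly p *P D ∣ poly p *P R
      mul {D} (dv S g) = dv S (≈-trans (*-assoc (poly p) D S) (*-congʳ (poly p) g))

  -- The product of the chosen primes divides `A` but has larger degree. The counting arguments
  -- below rest on this.
  few-divisors : ∀ b {ps A} → Apart ps → All (λ p → b p ≡ true → poly p ∣ A) ps → A <° degIf b ps → A ≈ []
  few-divisors b {ps} {A} ap f a with prodIf-∣ b ap f
  ... | dv R e = ≈-trans (≈-sym e) (≈-trans (*-congʳ (prodIf b ps)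
          (Mon-cancel-0 {C = R} (prodIf-monic b ps) (<°-resp (≈-sym e) a))) (*-zeroʳ (prodIf b ps)))

-- Rational arithmetic, indicators and finite sums

module RationalSums where
  open import Data.Bool using (T)
  open import Data.Rational using (_+_; _*_; _-_; -_; _≤_)
  open +-*-Solver using (solve; _:=_; _:+_; _:*_; _:-_; :-_; con)
  open import Data.Rational using (∣_∣; toℚᵘ; nonNegative)
  open import Data.Rational.Properties using (≤-refl; ≤-trans; ≤-reflexive; toℚᵘ-injective; toℚᵘ-fromℚᵘ; toℚᵘ-homo-+; toℚᵘ-homo-*)

  *-mono-≤ : ∀ {a b c d} → 0ℚ ≤ a → a ≤ b → 0ℚ ≤ c → c ≤ d → a * c ≤ b * d
  *-mono-≤ {a} {b} {c} {d} 0≤a a≤b 0≤c c≤d = ≤-trans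
    (ℚₚ.*-monoʳ-≤-nonNeg c {{nonNegative 0≤c}} a≤b)
    (ℚₚ.*-monoˡ-≤-nonNeg b {{nonNegative (≤-trans 0≤a a≤b)}} c≤d)

  *-monoʳ : ∀ {a c d} → 0ℚ ≤ a → c ≤ d → a * c ≤ a * d
  *-monoʳ {a} 0≤a = ℚₚ.*-monoˡ-≤-nonNeg a {{nonNegative 0≤a}}

  *-monoˡ : ∀ {a b c} → 0ℚ ≤ c → a ≤ b → a * c ≤ b * c
  *-monoˡ {c = c} 0≤c = ℚₚ.*-monoʳ-≤-nonNeg c {{nonNegative 0≤c}}

  0≤* : ∀ {a b} → 0ℚ ≤ a → 0ℚ ≤ b → 0ℚ ≤ a * b
  0≤* {a} {b} 0≤a 0≤b = subst (_≤ a * b) (ℚₚ.*-zeroʳ a) (*-monoʳ 0≤a 0≤b)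

  0≤+ : ∀ {a b} → 0ℚ ≤ a → 0ℚ ≤ b → 0ℚ ≤ a + b
  0≤+ {a} {b} 0≤a 0≤b = subst (_≤ a + b) (ℚₚ.+-identityˡ 0ℚ) (ℚₚ.+-mono-≤ 0≤a 0≤b)

  a≤a+b : ∀ a {b} → 0ℚ ≤ b → a ≤ a + b
  a≤a+b a {b} 0≤b = subst (_≤ a + b) (ℚₚ.+-identityʳ a) (ℚₚ.+-monoʳ-≤ a 0≤b)

  b≤a+b : ∀ {a} b → 0ℚ ≤ a → b ≤ a + b
  b≤a+b {a} b 0≤a = subst (_≤ a + b) (ℚₚ.+-identityˡ b) (ℚₚ.+-monoˡ-≤ b 0≤a)

  0≤1 : 0ℚ ≤ 1ℚ
  0≤1 = ℚₚ.nonNegative⁻¹ 1ℚ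

  ≤⇒0≤- : ∀ {a b} → a ≤ b → 0ℚ ≤ b - a
  ≤⇒0≤- {a} {b} le = subst (_≤ b - a) (ℚₚ.+-inverseʳ a) (ℚₚ.+-monoˡ-≤ (- a) le)

  0≤-⇒≤ : ∀ {a b} → 0ℚ ≤ b - a → a ≤ b
  0≤-⇒≤ {a} {b} le = subst₂ _≤_ (ℚₚ.+-identityˡ a) (solve 2 (λ a b → (b :- a) :+ a := b) refl a b) (ℚₚ.+-monoˡ-≤ a le)

  ℕ→ℚ-+ : ∀ m n → ℕ→ℚ (m ℕ.+ n) ≡ ℕ→ℚ m + ℕ→ℚ n
  ℕ→ℚ-+ m n = toℚᵘ-injective (begin
    toℚᵘ (ℕ→ℚ (m ℕ.+ n)) ≈⟨ toℚᵘ-fromℚᵘ (u (m ℕ.+ n)) ⟩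
    u (m ℕ.+ n) ≈⟨ ℚᵘ.*≡* (cong₂ ℤ._*_ (trans (ℤₚ.pos-+ m n) (cong₂ ℤ._+_ (sym (ℤₚ.*-identityʳ (ℤ.+ m))) (sym (ℤₚ.*-identityʳ (ℤ.+ n))))) refl) ⟩
    u m ℚᵘ.+ u n ≈⟨ ℚᵘₚ.+-cong (toℚᵘ-fromℚᵘ (u m)) (toℚᵘ-fromℚᵘ (u n)) ⟨
    toℚᵘ (ℕ→ℚ m) ℚᵘ.+ toℚᵘ (ℕ→ℚ n) ≈⟨ toℚᵘ-homo-+ (ℕ→ℚ m) (ℕ→ℚ n) ⟨
    toℚᵘ (ℕ→ℚ m + ℕ→ℚ n) ∎)
    where
      open ℚᵘₚ.≃-Reasoning
      u : ℕ → ℚᵘ.ℚᵘ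
      u k = ℚᵘ.mkℚᵘ (ℤ.+ k) 0

  ℕ→ℚ-* : ∀ m n → ℕ→ℚ (m ℕ.* n) ≡ ℕ→ℚ m * ℕ→ℚ n
  ℕ→ℚ-* m n = toℚᵘ-injective (begin
    toℚᵘ (ℕ→ℚ (m ℕ.* n)) ≈⟨ toℚᵘ-fromℚᵘ (u (m ℕ.* n)) ⟩
    u (m ℕ.* n) ≈⟨ ℚᵘ.*≡* (cong₂ ℤ._*_ (ℤₚ.pos-* m n) refl) ⟩
    u m ℚᵘ.* u n ≈⟨ ℚᵘₚ.*-cong (toℚᵘ-fromℚᵘ (u m)) (toℚᵘ-fromℚᵘ (u n)) ⟨
    toℚᵘ (ℕ→ℚ m) ℚᵘ.* toℚᵘ (ℕ→ℚ n) ≈⟨ toℚᵘ-homo-* (ℕ→ℚ m) (ℕ→ℚ n) ⟨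
    toℚᵘ (ℕ→ℚ m * ℕ→ℚ n) ∎)
    where
      open ℚᵘₚ.≃-Reasoning
      u : ℕ → ℚᵘ.ℚᵘ
      u k = ℚᵘ.mkℚᵘ (ℤ.+ k) 0

  ℕ→ℚ-nonneg : ∀ n → 0ℚ ≤ ℕ→ℚ n
  ℕ→ℚ-nonneg n = ℚₚ.toℚᵘ-cancel-≤ (ℚᵘₚ.≤-respʳ-≃ (ℚᵘₚ.≃-sym (toℚᵘ-fromℚᵘ (ℚᵘ.mkℚᵘ (ℤ.+ n) 0))) (ℚᵘₚ.nonNegative⁻¹ _))

  ℕ→ℚ-mono : ∀ {m n} → m ℕ.≤ n → ℕ→ℚ m ≤ ℕ→ℚ n
  ℕ→ℚ-mono {m} {n} le = subst (ℕ→ℚ m ≤_) (trans (sym (ℕ→ℚ-+ m (n ℕ.∸ m))) (cong ℕ→ℚ (ℕₚ.m+[n∸m]≡n le)))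
    (a≤a+b _ (ℕ→ℚ-nonneg (n ℕ.∸ m)))

  ℕ→ℚ-cancel-≤ : ∀ {m n} → ℕ→ℚ m ≤ ℕ→ℚ n → m ℕ.≤ n
  ℕ→ℚ-cancel-≤ {m} {n} le = ℕₚ.≮⇒≥ λ n<m → case 1≤0 (≤-trans (ℕ→ℚ-mono n<m) le) of λ { (ℚ.*≤* (ℤ.+≤+ ())) }
    where
      1≤0 : ℕ→ℚ (suc n) ≤ ℕ→ℚ n → 1ℚ ≤ 0ℚ
      1≤0 h = subst₂ _≤_
        (trans (cong (_- ℕ→ℚ n) (ℕ→ℚ-+ 1 n)) (solve 1 (λ x → (con 1ℚ :+ x) :- x := con 1ℚ) refl (ℕ→ℚ n)))
        (ℚₚ.+-inverseʳ (ℕ→ℚ n)) (ℚₚ.+-monoˡ-≤ (- ℕ→ℚ n) h)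

  1≤ℕ→ℚ : ∀ {n} → 1 ℕ.≤ n → 1ℚ ≤ ℕ→ℚ n
  1≤ℕ→ℚ = ℕ→ℚ-mono

  ℕ→ℚ-^ : ∀ b n → ℕ→ℚ (b ℕ.^ n) ≡ ℕ→ℚ b ^Q n
  ℕ→ℚ-^ b zero = refl
  ℕ→ℚ-^ b (suc n) = trans (ℕ→ℚ-* b (b ℕ.^ n)) (cong (ℕ→ℚ b *_) (ℕ→ℚ-^ b n))

  ^Q-+ : ∀ x m n → x ^Q (m ℕ.+ n) ≡ x ^Q m * x ^Q n
  ^Q-+ x zero n = sym (ℚₚ.*-identityˡ _)
  ^Q-+ x (suc m) n = trans (cong (x *_) (^Q-+ x m n)) (sym (ℚₚ.*-assoc x _ _))

  ^Q-*-distrib : ∀ x y n → (x * y) ^Q n ≡ x ^Q n * y ^Q n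
  ^Q-*-distrib x y zero = refl
  ^Q-*-distrib x y (suc n) = trans (cong (x * y *_) (^Q-*-distrib x y n))
    (solve 4 (λ x y a b → (x :* y) :* (a :* b) := (x :* a) :* (y :* b)) refl x y (x ^Q n) (y ^Q n))

  1^Q : ∀ n → 1ℚ ^Q n ≡ 1ℚ
  1^Q zero = refl
  1^Q (suc n) = trans (ℚₚ.*-identityˡ _) (1^Q n)

  ^Q-nonneg : ∀ {x} n → 0ℚ ≤ x → 0ℚ ≤ x ^Q n
  ^Q-nonneg zero h = 0≤1
  ^Q-nonneg (suc n) h = 0≤* h (^Q-nonneg n h)

  ^Q-mono : ∀ {x y} n → 0ℚ ≤ x → x ≤ y → x ^Q n ≤ y ^Q n
  ^Q-mono zero h le = ≤-refl
  ^Q-mono (suc n) h le = *-mono-≤ h le (^Q-nonneg n h) (^Q-mono n h le)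

  1≤^Q : ∀ {x} n → 1ℚ ≤ x → 1ℚ ≤ x ^Q n
  1≤^Q {x} n h = subst (_≤ x ^Q n) (1^Q n) (^Q-mono n 0≤1 h)

  ^Q-monoʳ : ∀ {x m n} → 1ℚ ≤ x → m ℕ.≤ n → x ^Q m ≤ x ^Q n
  ^Q-monoʳ {x} {m} {n} h le = subst₂ _≤_ (ℚₚ.*-identityʳ _)
    (trans (sym (^Q-+ x m (n ℕ.∸ m))) (cong (x ^Q_) (ℕₚ.m+[n∸m]≡n le)))
    (*-monoʳ (^Q-nonneg m (≤-trans 0≤1 h)) (1≤^Q (n ℕ.∸ m) h))

  -- inv n is 1/n for n ≥ 1, and 0 for n = 0.
  inv : ℕ → ℚ
  inv n = 1ℚ ÷ℕ n

  inv-nonneg : ∀ n → 0ℚ ≤ inv n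
  inv-nonneg zero = ≤-refl
  inv-nonneg (suc n) = subst (0ℚ ≤_) (sym (ℚₚ.*-identityˡ _))
    (ℚₚ.toℚᵘ-cancel-≤ (ℚᵘₚ.≤-respʳ-≃ (ℚᵘₚ.≃-sym (toℚᵘ-fromℚᵘ (ℚᵘ.mkℚᵘ (ℤ.+ 1) n))) (ℚᵘₚ.nonNegative⁻¹ _)))

  inv-inverseʳ : ∀ {n} → 1 ℕ.≤ n → ℕ→ℚ n * inv n ≡ 1ℚ
  inv-inverseʳ {suc n} _ = trans (cong (ℕ→ℚ (suc n) *_) (ℚₚ.*-identityˡ _)) (toℚᵘ-injective (begin
    toℚᵘ (ℕ→ℚ (suc n) * (ℤ.+ 1 ℚ./ suc n)) ≈⟨ toℚᵘ-homo-* (ℕ→ℚ (suc n)) (ℤ.+ 1 ℚ./ suc n) ⟩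
    toℚᵘ (ℕ→ℚ (suc n)) ℚᵘ.* toℚᵘ (ℤ.+ 1 ℚ./ suc n) ≈⟨ ℚᵘₚ.*-cong (toℚᵘ-fromℚᵘ (ℚᵘ.mkℚᵘ (ℤ.+ suc n) 0)) (toℚᵘ-fromℚᵘ (ℚᵘ.mkℚᵘ (ℤ.+ 1) n)) ⟩
    ℚᵘ.mkℚᵘ (ℤ.+ suc n) 0 ℚᵘ.* ℚᵘ.mkℚᵘ (ℤ.+ 1) n ≈⟨ ℚᵘₚ.*-inverseʳ (ℚᵘ.mkℚᵘ (ℤ.+ suc n) 0) ⟩
    ℚᵘ.1ℚᵘ ∎))
    where open ℚᵘₚ.≃-Reasoning

  ÷ℕ-inv : ∀ x n → x ÷ℕ n ≡ x * inv n
  ÷ℕ-inv x zero = sym (ℚₚ.*-zeroʳ x)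
  ÷ℕ-inv x (suc n) = cong (x *_) (sym (ℚₚ.*-identityˡ _))

  𝟙 : Bool → ℚ
  𝟙 true = 1ℚ
  𝟙 false = 0ℚ

  𝟙-nonneg : ∀ b → 0ℚ ≤ 𝟙 b
  𝟙-nonneg true = 0≤1
  𝟙-nonneg false = ≤-refl

  𝟙-∧ : ∀ a b → 𝟙 (a ∧ b) ≡ 𝟙 a * 𝟙 b
  𝟙-∧ true b = sym (ℚₚ.*-identityˡ (𝟙 b))
  𝟙-∧ false b = sym (ℚₚ.*-zeroˡ (𝟙 b))

  𝟙-not : ∀ b → 𝟙 (not b) ≡ 1ℚ - 𝟙 b
  𝟙-not true = refl
  𝟙-not false = refl

  𝟙-split : ∀ b {x y} → x ≤ y → x ≤ 𝟙 b * y + 𝟙 (not b) * x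
  𝟙-split true {x} {y} le = ≤-trans le (≤-reflexive (solve 2 (λ x y → y := con 1ℚ :* y :+ con 0ℚ :* x) refl x y))
  𝟙-split false {x} {y} _ = ≤-reflexive (solve 2 (λ x y → x := con 0ℚ :* y :+ con 1ℚ :* x) refl x y)

  𝟙-mono : ∀ b {x y} → (b ≡ true → x ≤ y) → 𝟙 b * x ≤ 𝟙 b * y
  𝟙-mono true le = *-monoʳ 0≤1 (le refl)
  𝟙-mono false {x} {y} _ = ≤-reflexive (trans (ℚₚ.*-zeroˡ x) (sym (ℚₚ.*-zeroˡ y)))

  𝟙-≤ : ∀ b {x y} → 0ℚ ≤ y → (b ≡ true → x ≤ y) → 𝟙 b * x ≤ y
  𝟙-≤ true {x} {y} _ le = subst (_≤ y) (sym (ℚₚ.*-identityˡ x)) (le refl)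
  𝟙-≤ false {x} {y} 0≤y _ = subst (_≤ y) (sym (ℚₚ.*-zeroˡ x)) 0≤y

  T⇒true : ∀ {b} → T b → b ≡ true
  T⇒true {true} _ = refl

  true⇒T : ∀ {b} → b ≡ true → T b
  true⇒T refl = _

  ≤⇒≤ᵇ-true : ∀ {m n} → m ℕ.≤ n → (m ℕ.≤ᵇ n) ≡ true
  ≤⇒≤ᵇ-true le = T⇒true (ℕₚ.≤⇒≤ᵇ le)

  ≤ᵇ-true⇒≤ : ∀ {m n} → (m ℕ.≤ᵇ n) ≡ true → m ℕ.≤ n
  ≤ᵇ-true⇒≤ {m} {n} e = ℕₚ.≤ᵇ⇒≤ m n (true⇒T e)

  ≤ᵇ-false⇒> : ∀ {m n} → (m ℕ.≤ᵇ n) ≡ false → n ℕ.< m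
  ≤ᵇ-false⇒> e = ℕₚ.≰⇒> (λ le → case trans (sym e) (≤⇒≤ᵇ-true le) of λ ())

  private variable
    A B : Set

  ∑ : List A → (A → ℚ) → ℚ
  ∑ [] f = 0ℚ
  ∑ (x ∷ xs) f = f x + ∑ xs f

  infix 5 ∑
  syntax ∑ xs (λ x → e) = ∑[ x ∈ xs ] e

  ∑-sumQ : (xs : List A) (f : A → ℚ) → sumQ (map f xs) ≡ ∑ xs f
  ∑-sumQ [] f = refl
  ∑-sumQ (x ∷ xs) f = cong (f x +_) (∑-sumQ xs f)

  ∑-cong-∈ : (xs : List A) {f g : A → ℚ} → (∀ {x} → x ∈ xs → f x ≡ g x) → ∑ xs f ≡ ∑ xs g
  ∑-cong-∈ [] e = refl
  ∑-cong-∈ (x ∷ xs) e = cong₂ _+_ (e (here refl)) (∑-cong-∈ xs (λ m → e (there m)))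

  ∑-cong : (xs : List A) {f g : A → ℚ} → (∀ x → f x ≡ g x) → ∑ xs f ≡ ∑ xs g
  ∑-cong xs e = ∑-cong-∈ xs (λ {x} _ → e x)

  ∑-mono-∈ : (xs : List A) {f g : A → ℚ} → (∀ {x} → x ∈ xs → f x ≤ g x) → ∑ xs f ≤ ∑ xs g
  ∑-mono-∈ [] e = ≤-refl
  ∑-mono-∈ (x ∷ xs) e = ℚₚ.+-mono-≤ (e (here refl)) (∑-mono-∈ xs (λ m → e (there m)))

  ∑-mono : (xs : List A) {f g : A → ℚ} → (∀ x → f x ≤ g x) → ∑ xs f ≤ ∑ xs g
  ∑-mono xs e = ∑-mono-∈ xs (λ {x} _ → e x)

  ∑-zero : (xs : List A) → ∑ xs (λ _ → 0ℚ) ≡ 0ℚ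
  ∑-zero [] = refl
  ∑-zero (x ∷ xs) = trans (ℚₚ.+-identityˡ _) (∑-zero xs)

  ∑-nonneg : (xs : List A) {f : A → ℚ} → (∀ x → 0ℚ ≤ f x) → 0ℚ ≤ ∑ xs f
  ∑-nonneg xs {f} e = subst (_≤ ∑ xs f) (∑-zero xs) (∑-mono xs e)

  ∑-+ : (xs : List A) (f g : A → ℚ) → ∑ xs (λ x → f x + g x) ≡ ∑ xs f + ∑ xs g
  ∑-+ [] f g = sym (ℚₚ.+-identityˡ 0ℚ)
  ∑-+ (x ∷ xs) f g = trans (cong (f x + g x +_) (∑-+ xs f g))
    (solve 4 (λ a b c d → (a :+ b) :+ (c :+ d) := (a :+ c) :+ (b :+ d)) refl (f x) (g x) (∑ xs f) (∑ xs g))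

  ∑-*ˡ : ∀ c (xs : List A) (f : A → ℚ) → ∑ xs (λ x → c * f x) ≡ c * ∑ xs f
  ∑-*ˡ c [] f = sym (ℚₚ.*-zeroʳ c)
  ∑-*ˡ c (x ∷ xs) f = trans (cong (c * f x +_) (∑-*ˡ c xs f)) (sym (ℚₚ.*-distribˡ-+ c (f x) (∑ xs f)))

  ∑-*ʳ : ∀ c (xs : List A) (f : A → ℚ) → ∑ xs (λ x → f x * c) ≡ ∑ xs f * c
  ∑-*ʳ c xs f = trans (∑-cong xs (λ x → ℚₚ.*-comm (f x) c)) (trans (∑-*ˡ c xs f) (ℚₚ.*-comm c _))

  ∑-swap : (xs : List A) (ys : List B) (f : A → B → ℚ) → (∑[ x ∈ xs ] ∑[ y ∈ ys ] f x y) ≡ (∑[ y ∈ ys ] ∑[ x ∈ xs ] f x y)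
  ∑-swap [] ys f = sym (∑-zero ys)
  ∑-swap (x ∷ xs) ys f = trans (cong (∑ ys (f x) +_) (∑-swap xs ys f)) (sym (∑-+ ys (f x) _))

  ∑-++ : (xs ys : List A) (f : A → ℚ) → ∑ (xs ++ ys) f ≡ ∑ xs f + ∑ ys f
  ∑-++ [] ys f = sym (ℚₚ.+-identityˡ _)
  ∑-++ (x ∷ xs) ys f = trans (cong (f x +_) (∑-++ xs ys f)) (sym (ℚₚ.+-assoc (f x) _ _))

  ∑-map : (g : A → B) (xs : List A) (f : B → ℚ) → ∑ (map g xs) f ≡ ∑ xs (λ x → f (g x))
  ∑-map g [] f = refl
  ∑-map g (x ∷ xs) f = cong (f (g x) +_) (∑-map g xs f)

  ∑-concatMap : (g : A → List B) (xs : List A) (f : B → ℚ) → ∑ (concatMap g xs) f ≡ (∑[ x ∈ xs ] ∑ (g x) f)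
  ∑-concatMap g [] f = refl
  ∑-concatMap g (x ∷ xs) f = trans (∑-++ (g x) (concatMap g xs) f) (cong (∑ (g x) f +_) (∑-concatMap g xs f))

  ∑-const : (xs : List A) (c : ℚ) → ∑ xs (λ _ → c) ≡ ℕ→ℚ (length xs) * c
  ∑-const [] c = sym (ℚₚ.*-zeroˡ c)
  ∑-const (x ∷ xs) c = trans (cong (c +_) (∑-const xs c))
    (trans (trans (cong (_+ ℕ→ℚ (length xs) * c) (sym (ℚₚ.*-identityˡ c))) (sym (ℚₚ.*-distribʳ-+ c 1ℚ (ℕ→ℚ (length xs)))))
           (cong (_* c) (sym (ℕ→ℚ-+ 1 (length xs)))))

  ∑-∣∣ : (xs : List A) (f : A → ℚ) → ∣ ∑ xs f ∣ ≤ ∑ xs (λ x → ∣ f x ∣)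
  ∑-∣∣ [] f = ≤-refl
  ∑-∣∣ (x ∷ xs) f = ≤-trans (ℚₚ.∣p+q∣≤∣p∣+∣q∣ (f x) (∑ xs f)) (ℚₚ.+-monoʳ-≤ ∣ f x ∣ (∑-∣∣ xs f))

  ∑-term : {xs : List A} {f : A → ℚ} → (∀ x → 0ℚ ≤ f x) → ∀ {x} → x ∈ xs → f x ≤ ∑ xs f
  ∑-term {xs = y ∷ xs} {f} e (here refl) = a≤a+b (f y) (∑-nonneg xs e)
  ∑-term {xs = y ∷ xs} {f} e (there m) = ≤-trans (∑-term e m) (b≤a+b _ (e y))

  ∑-count : (p : A → Bool) (xs : List A) → ℕ→ℚ (length (filterᵇ p xs)) ≡ ∑ xs (λ x → 𝟙 (p x))
  ∑-count p [] = refl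
  ∑-count p (x ∷ xs) with p x
  ... | true = trans (ℕ→ℚ-+ 1 (length (filterᵇ p xs))) (cong (1ℚ +_) (∑-count p xs))
  ... | false = trans (∑-count p xs) (sym (ℚₚ.+-identityˡ _))

  ∑-const-𝟙 : (xs : List A) → (∑[ x ∈ xs ] 1ℚ) ≡ ℕ→ℚ (length xs)
  ∑-const-𝟙 xs = trans (∑-const xs 1ℚ) (ℚₚ.*-identityʳ _)

  ∑-𝟙≤1 : {xs : List A} (b : A → Bool) → AllPairs (λ x y → b x ≡ true → b y ≡ true → ⊥) xs → ∑ xs (λ x → 𝟙 (b x)) ≤ 1ℚ
  ∑-𝟙≤1 {xs = []} b _ = 0≤1
  ∑-𝟙≤1 {xs = x ∷ xs} b (h ∷ hs) with b x in eq
  ... | false = subst (_≤ 1ℚ) (sym (ℚₚ.+-identityˡ _)) (∑-𝟙≤1 b hs)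
  ... | true = ≤-reflexive (cong (1ℚ +_) (none xs (All.map (λ f → f refl) h)))
    where
      none : ∀ ys → All (λ y → b y ≡ true → ⊥) ys → ∑ ys (λ y → 𝟙 (b y)) ≡ 0ℚ
      none [] [] = refl
      none (y ∷ ys) (f ∷ fs) with b y
      ... | true = ⊥-elim (f refl)
      ... | false = trans (ℚₚ.+-identityˡ _) (none ys fs)

  -- Every `x` is counted under at least one label `y`; the terms being nonnegative, overlaps only
  -- enlarge the right-hand side.
  ∑-group : (xs : List A) (ys : List B) (_~_ : A → B → Bool) (f : A → ℚ) → (∀ x → 0ℚ ≤ f x) →
            (∀ {x} → x ∈ xs → ∃ λ y → y ∈ ys × (x ~ y) ≡ true) →
            ∑ xs f ≤ (∑[ y ∈ ys ] ∑[ x ∈ xs ] (𝟙 (x ~ y) * f x))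
  ∑-group xs ys _~_ f f≥0 cover = subst (∑ xs f ≤_) (∑-swap xs ys (λ x y → 𝟙 (x ~ y) * f x))
    (∑-mono-∈ xs λ {x} m → let y , m′ , e = cover m in
      ≤-trans (≤-reflexive (trans (sym (ℚₚ.*-identityˡ (f x))) (cong (λ b → 𝟙 b * f x) (sym e))))
              (∑-term (λ y → 0≤* (𝟙-nonneg (x ~ y)) (f≥0 x)) m′))

  ∑-δ : {xs : List A} (b : A → Bool) (G : A → ℚ) {x : A} → x ∈ xs → b x ≡ true →
        (∀ {y} → y ∈ xs → b y ≡ true → y ≡ x) → AllPairs _≢_ xs → ∑ xs (λ y → 𝟙 (b y) * G y) ≡ G x
  ∑-δ {xs = z ∷ xs} b G {x} (here refl) bx only (h ∷ hs) = begin
    𝟙 (b x) * G x + ∑ xs (λ y → 𝟙 (b y) * G y) ≡⟨ cong₂ _+_ (cong (λ t → 𝟙 t * G x) bx) (trans (∑-cong-∈ xs zeros) (∑-zero xs)) ⟩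
    1ℚ * G x + 0ℚ ≡⟨ trans (ℚₚ.+-identityʳ (1ℚ * G x)) (ℚₚ.*-identityˡ (G x)) ⟩
    G x ∎
    where
      open ≡-Reasoning
      zeros : ∀ {y} → y ∈ xs → 𝟙 (b y) * G y ≡ 0ℚ
      zeros {y} m with b y in eq
      ... | false = ℚₚ.*-zeroˡ (G y)
      ... | true = ⊥-elim (All.lookup h m (sym (only (there m) eq)))
  ∑-δ {xs = z ∷ xs} b G {x} (there m) bx only (h ∷ hs) = begin
    𝟙 (b z) * G z + ∑ xs (λ y → 𝟙 (b y) * G y) ≡⟨ cong₂ _+_ zero′ (∑-δ b G m bx (λ m′ → only (there m′)) hs) ⟩
    0ℚ + G x ≡⟨ ℚₚ.+-identityˡ (G x) ⟩
    G x ∎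
    where
      open ≡-Reasoning
      zero′ : 𝟙 (b z) * G z ≡ 0ℚ
      zero′ with b z in eq
      ... | false = ℚₚ.*-zeroˡ (G z)
      ... | true = ⊥-elim (All.lookup h m (only (here refl) eq))

  ∑-δ1 : {xs : List A} (b : A → Bool) {x : A} → x ∈ xs → b x ≡ true →
         (∀ {y} → y ∈ xs → b y ≡ true → y ≡ x) → AllPairs _≢_ xs → ∑ xs (λ y → 𝟙 (b y)) ≡ 1ℚ
  ∑-δ1 {xs = xs} b m bx only u = trans (∑-cong xs (λ y → sym (ℚₚ.*-identityʳ (𝟙 (b y))))) (∑-δ b (λ _ → 1ℚ) m bx only u)

open RationalSums

-- Enumeration of polynomials of bounded degree; factorisation into primes

module Enumeration (𝔽 : FiniteField) where
  open import Data.Nat using (_≤_; _<_)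
  open PolyRing 𝔽
  open Divisibility 𝔽

  elems-complete : ∀ c → c ∈ elems
  elems-complete c = subst (_∈ elems) (Inverse.strictlyInverseˡ enum c)
    (∈ₚ.∈-map⁺ (Inverse.to enum) (∈ₚ.∈-allFin (Inverse.from enum c)))

  elems-unique : AllPairs _≢_ elems
  elems-unique = Uniqueₚ.map⁺ (λ {i} {j} e → trans (sym (Inverse.strictlyInverseʳ enum i))
    (trans (cong (Inverse.from enum) e) (Inverse.strictlyInverseʳ enum j))) (Uniqueₚ.allFin⁺ size)

  length-elems : length elems ≡ q
  length-elems = trans (Listₚ.length-map (Inverse.to enum) (allFin size)) (Listₚ.length-tabulate {n = size} (λ i → i))

  2≤q : 2 ≤ q
  2≤q = two (Inverse.from enum 0#) (Inverse.from enum 1#) λ e → 0≢1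
    (trans (sym (Inverse.strictlyInverseˡ enum 0#)) (trans (cong (Inverse.to enum) e) (Inverse.strictlyInverseˡ enum 1#)))
    where
      two : ∀ {n} (i j : Fin n) → i ≢ j → 2 ≤ n
      two {suc zero} Fin.zero Fin.zero ne = ⊥-elim (ne refl)
      two {suc (suc n)} i j ne = s≤s (s≤s z≤n)

  polys-length : ∀ n {A} → A ∈ polys n → length A ≡ n
  polys-length zero (here refl) = refl
  polys-length (suc n) m with find (∈ₚ.∈-concatMap⁻ (λ c → map (c ∷_) (polys n)) {xs = elems} m)
  ... | c , _ , m′ with ∈ₚ.∈-map⁻ (c ∷_) m′
  ...   | B , m″ , refl = cong suc (polys-length n m″)

  polys-bound : ∀ n {A} → A ∈ polys n → A <° n
  polys-bound n {A} m = subst (A <°_) (polys-length n m) (<°-length A)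

  -- For `A` of degree < `n`, its representative in `polys n`, a list of length exactly `n`; among
  -- such lists `≈` and `≡` agree.
  trunc : ℕ → Pol → Pol
  trunc zero A = []
  trunc (suc n) [] = 0# ∷ trunc n []
  trunc (suc n) (x ∷ A) = x ∷ trunc n A

  trunc-∈ : ∀ n A → trunc n A ∈ polys n
  cons-∈ : ∀ n x A → x ∷ trunc n A ∈ polys (suc n)
  cons-∈ n x A = ∈ₚ.∈-concatMap⁺ (λ c → map (c ∷_) (polys n))
    (Any.map (λ { refl → ∈ₚ.∈-map⁺ (x ∷_) (trunc-∈ n A) }) (elems-complete x))
  trunc-∈ zero A = here refl
  trunc-∈ (suc n) [] = cons-∈ n 0# []
  trunc-∈ (suc n) (x ∷ A) = cons-∈ n x A

  trunc-≈ : ∀ n {A} → A <° n → trunc n A ≈ A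
  trunc-≈ zero a = ≈-sym (<°0⇒≈[] a)
  trunc-≈ (suc n) {[]} a = ≈-trans (T-cong (trunc-≈ n {[]} <°-[])) T[]≈[]
  trunc-≈ (suc n) {x ∷ A} a = mk λ { zero → refl ; (suc i) → at (trunc-≈ n (<°-tail a)) i }

  ≈⇒≡ : ∀ {A B} → length A ≡ length B → A ≈ B → A ≡ B
  ≈⇒≡ {[]} {[]} _ _ = refl
  ≈⇒≡ {x ∷ A} {y ∷ B} l e = cong₂ _∷_ (at e 0) (≈⇒≡ (ℕₚ.suc-injective l) (tail-≈ e))

  polys-≈⇒≡ : ∀ n {A B} → A ∈ polys n → B ∈ polys n → A ≈ B → A ≡ B
  polys-≈⇒≡ n a b e = ≈⇒≡ (trans (polys-length n a) (sym (polys-length n b))) e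

  polys-unique : ∀ n → AllPairs _≢_ (polys n)
  polys-unique zero = [] ∷ []
  polys-unique (suc n) = AllPairsₚ.concat⁺
    (Allₚ.map⁺ (All.universal (λ c → Uniqueₚ.map⁺ Listₚ.∷-injectiveʳ (polys-unique n)) elems))
    (AllPairsₚ.map⁺ (AllPairs.map (λ {c} {d} c≢d → Allₚ.map⁺ (All.universal (λ A →
      Allₚ.map⁺ (All.universal (λ B e → c≢d (Listₚ.∷-injectiveˡ e)) (polys n))) (polys n))) elems-unique))

  ==P-true : ∀ {A B} → A ≈ B → (A ==P B) ≡ true
  ==P-true {A} {B} e = ≈[]⇒isZeroP (A -P B) (≈⇒sub≈0 {A} {B} e)

  ==P⇒≈ : ∀ {A B} → (A ==P B) ≡ true → A ≈ B
  ==P⇒≈ {A} {B} e = sub≈0⇒≈ A B (isZeroP⇒≈[] (A -P B) e)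

  -- `polys n` holds exactly one list for each polynomial of degree < `n`, but in general not the
  -- list `B` itself; hence the invariance asked of `G`.
  ∑-polys-δ : ∀ n {B} (G : Pol → ℚ) → (∀ {A A′} → A ≈ A′ → G A ≡ G A′) → B <° n →
              ∑ (polys n) (λ A → 𝟙 (A ==P B) ℚ.* G A) ≡ G B
  ∑-polys-δ n {B} G resp b = trans
    (∑-δ (_==P B) G (trunc-∈ n B) (==P-true (trunc-≈ n b))
      (λ m e → polys-≈⇒≡ n m (trunc-∈ n B) (≈-trans (==P⇒≈ e) (≈-sym (trunc-≈ n b)))) (polys-unique n))
    (resp (trunc-≈ n b))

  ∑-polys-δ1 : ∀ n {B} → B <° n → ∑ (polys n) (λ A → 𝟙 (A ==P B)) ≡ 1ℚ
  ∑-polys-δ1 n {B} b = trans (∑-cong (polys n) (λ A → sym (ℚₚ.*-identityʳ (𝟙 (A ==P B))))) (∑-polys-δ n (λ _ → 1ℚ) (λ _ → refl) b)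

  ==P-sym : ∀ A B → (A ==P B) ≡ (B ==P A)
  ==P-sym A B with A ==P B in e | B ==P A in f
  ... | true | true = refl
  ... | false | false = refl
  ... | true | false = trans (sym (==P-true {B} {A} (≈-sym (==P⇒≈ e)))) f
  ... | false | true = trans (sym e) (==P-true {A} {B} (≈-sym (==P⇒≈ f)))

  ∑-polys-suc : ∀ n (f : Pol → ℚ) → ∑ (polys (suc n)) f ≡ (∑[ c ∈ elems ] ∑[ A ∈ polys n ] f (c ∷ A))
  ∑-polys-suc n f = trans (∑-concatMap (λ c → map (c ∷_) (polys n)) elems f) (∑-cong elems (λ c → ∑-map (c ∷_) (polys n) f))

  length-polys : ∀ n → length (polys n) ≡ q ℕ.^ n
  length-polys zero = refl
  length-polys (suc n) = trans (go elems) (cong₂ ℕ._*_ length-elems (length-polys n))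
    where
      go : ∀ cs → length (concatMap (λ c → map (c ∷_) (polys n)) cs) ≡ length cs ℕ.* length (polys n)
      go [] = refl
      go (c ∷ cs) = trans (Listₚ.length-++ (map (c ∷_) (polys n))) (cong₂ ℕ._+_ (Listₚ.length-map (c ∷_) (polys n)) (go cs))

  -- Each of the q^M polynomials of degree < `M` is a value of `f` at most once.
  count-injective : ∀ {A : Set} (xs : List A) (b : A → Bool) (f : A → Pol) M → AllPairs _≢_ xs →
                    (∀ {x} → x ∈ xs → b x ≡ true → f x <° M) →
                    (∀ {x y} → x ∈ xs → y ∈ xs → b x ≡ true → b y ≡ true → f x ≈ f y → x ≡ y) →
                    ∑ xs (λ x → 𝟙 (b x)) ℚ.≤ ℕ→ℚ (q ℕ.^ M)
  count-injective xs b f M uniq bound inj = begin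
    ∑ xs (λ x → 𝟙 (b x)) ≤⟨ ∑-mono-∈ xs expand ⟩
    (∑[ x ∈ xs ] ∑[ C ∈ polys M ] 𝟙 (b x ∧ (f x ==P C))) ≡⟨ ∑-swap xs (polys M) (λ x C → 𝟙 (b x ∧ (f x ==P C))) ⟩
    (∑[ C ∈ polys M ] ∑[ x ∈ xs ] 𝟙 (b x ∧ (f x ==P C))) ≤⟨ ∑-mono (polys M) (λ C → ∑-𝟙≤1 (λ x → b x ∧ (f x ==P C)) (pairs C xs (λ m → m) uniq)) ⟩
    (∑[ C ∈ polys M ] 1ℚ) ≡⟨ ∑-const-𝟙 (polys M) ⟩
    ℕ→ℚ (length (polys M)) ≡⟨ cong ℕ→ℚ (length-polys M) ⟩
    ℕ→ℚ (q ℕ.^ M) ∎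
    where
      open ℚₚ.≤-Reasoning
      expand : ∀ {x} → x ∈ xs → 𝟙 (b x) ℚ.≤ (∑[ C ∈ polys M ] 𝟙 (b x ∧ (f x ==P C)))
      expand {x} m with b x in eq
      ... | false = ∑-nonneg (polys M) (λ C → ℚₚ.≤-refl)
      ... | true = ℚₚ.≤-reflexive (sym (trans (∑-cong (polys M) (λ C → cong 𝟙 (==P-sym (f x) C))) (∑-polys-δ1 M (bound m eq))))
      pairs : ∀ C ys → (∀ {y} → y ∈ ys → y ∈ xs) → AllPairs _≢_ ys →
              AllPairs (λ x y → (b x ∧ (f x ==P C)) ≡ true → (b y ∧ (f y ==P C)) ≡ true → ⊥) ys
      pairs C [] sub [] = []
      pairs C (y ∷ ys) sub (h ∷ hs) = All.tabulate (λ {z} m e₁ e₂ → All.lookup h m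
          (inj (sub (here refl)) (sub (there m)) (proj₁ (∧-true {b y} e₁)) (proj₁ (∧-true {b z} e₂))
               (≈-trans (==P⇒≈ (proj₂ (∧-true {b y} e₁))) (≈-sym (==P⇒≈ (proj₂ (∧-true {b z} e₂)))))))
        ∷ pairs C ys (λ m → sub (there m)) hs

  ∑-polys-restrict : ∀ {m n} → m ≤ n → (b : Pol → Bool) → (∀ A → A <° n → b A ≡ true → A <° m) → (∀ A → A <° m → b A ≡ true) →
                     (G : Pol → ℚ) → (∀ {A A′} → A ≈ A′ → G A ≡ G A′) →
                     ∑ (polys n) (λ A → 𝟙 (b A) ℚ.* G A) ≡ ∑ (polys m) G
  ∑-polys-restrict {m} {n} m≤n b b⇒ ⇒b G resp = begin
    ∑ (polys n) (λ A → 𝟙 (b A) ℚ.* G A) ≡⟨ ∑-cong-∈ (polys n) expand ⟩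
    (∑[ A ∈ polys n ] ∑[ B ∈ polys m ] (𝟙 (A ==P B) ℚ.* G A)) ≡⟨ ∑-swap (polys n) (polys m) (λ A B → 𝟙 (A ==P B) ℚ.* G A) ⟩
    (∑[ B ∈ polys m ] ∑[ A ∈ polys n ] (𝟙 (A ==P B) ℚ.* G A)) ≡⟨ ∑-cong-∈ (polys m) (λ h → ∑-polys-δ n G resp (<°-mono m≤n (polys-bound m h))) ⟩
    ∑ (polys m) G ∎
    where
      open ≡-Reasoning
      none : ∀ A → ¬ (A <° m) → ∀ {B} → B ∈ polys m → 𝟙 (A ==P B) ≡ 0ℚ
      none A ¬a {B} h with A ==P B in e
      ... | false = refl
      ... | true = ⊥-elim (¬a (<°-resp (≈-sym (==P⇒≈ e)) (polys-bound m h)))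
      expand : ∀ {A} → A ∈ polys n → 𝟙 (b A) ℚ.* G A ≡ (∑[ B ∈ polys m ] (𝟙 (A ==P B) ℚ.* G A))
      expand {A} h = trans (cong (ℚ._* G A) (ind (b A) refl)) (sym (∑-*ʳ (G A) (polys m) (λ B → 𝟙 (A ==P B))))
        where
          ind : ∀ t → b A ≡ t → 𝟙 t ≡ ∑ (polys m) (λ B → 𝟙 (A ==P B))
          ind true e = sym (trans (∑-cong (polys m) (λ B → cong 𝟙 (==P-sym A B))) (∑-polys-δ1 m (b⇒ A (polys-bound n h) e)))
          ind false e = sym (trans (∑-cong-∈ (polys m) (none A (λ a → case trans (sym e) (⇒b A a) of λ ()))) (∑-zero (polys m)))

  nlen-bound : ∀ A → A <° nlen A
  nlen-bound [] = <°-[]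
  nlen-bound (x ∷ A) with nlen A | nlen-bound A
  ... | suc n | b = <°-∷ b
  ... | zero | b with x ≟ 0#
  ...   | yes p = bd λ { zero _ → p ; (suc i) _ → vanish b i z≤n }
  ...   | no _ = <°-∷ b

  nlen-lead : ∀ A {d} → nlen A ≡ suc d → coeff A d ≢ 0#
  nlen-lead (x ∷ A) e z with nlen A in eq
  nlen-lead (x ∷ A) refl z | suc n = nlen-lead A eq z
  nlen-lead (x ∷ A) e z | zero with x ≟ 0#
  nlen-lead (x ∷ A) refl z | zero | no ¬p = ¬p z

  nlen-≤ : ∀ {A n} → A <° n → nlen A ≤ n
  nlen-≤ {A} {n} a with nlen A in eq
  ... | zero = z≤n
  ... | suc d with suc d ℕ.≤? n
  ...   | yes le = le
  ...   | no ¬le = ⊥-elim (nlen-lead A eq (vanish a d (ℕₚ.≤-pred (ℕₚ.≰⇒> ¬le))))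

  Mon-nlen : ∀ {A d} → Mon A d → nlen A ≡ suc d
  Mon-nlen {A} {d} α = ℕₚ.≤-antisym (nlen-≤ (bound α))
    (case suc d ℕ.≤? nlen A of λ { (yes le) → le
                                 ; (no ¬le) → ⊥-elim (0≢1 (trans (sym (vanish (nlen-bound A) d (ℕₚ.≤-pred (ℕₚ.≰⇒> ¬le)))) (lead α))) })

  Mon-deg : ∀ {A d} → Mon A d → deg A ≡ d
  Mon-deg α = cong (ℕ._∸ 1) (Mon-nlen α)

  Mon-∣∣P : ∀ {A d} → Mon A d → ∣ A ∣P ≡ q ℕ.^ d
  Mon-∣∣P {A} α with nlen A | Mon-nlen α
  ... | suc d | refl = refl

  ++[1]-Mon : ∀ cs → Mon (cs ++ [ 1# ]) (length cs)
  ++[1]-Mon [] = Mon-1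
  ++[1]-Mon (c ∷ cs) = mon (lead (++[1]-Mon cs)) (<°-∷ (bound (++[1]-Mon cs)))

  Monic⇒Mon : ∀ {A} → Monic A → ∃ λ d → Mon A d
  Monic⇒Mon (cs , refl) = length cs , ++[1]-Mon cs

  snoc-Mon : ∀ {n cs} → cs ∈ polys n → Mon (cs ++ [ 1# ]) n
  snoc-Mon {n} {cs} m = subst (Mon (cs ++ [ 1# ])) (polys-length n m) (++[1]-Mon cs)

  Mon-snoc : ∀ {n A} → Mon A n → ∃ λ cs → cs ∈ polys n × A ≈ cs ++ [ 1# ]
  Mon-snoc {n} {A} α = trunc n A , trunc-∈ n A , go n A α
    where
      go : ∀ n A → Mon A n → A ≈ trunc n A ++ [ 1# ]
      go zero A α = Mon0⇒≈1 α
      go (suc n) [] α = ⊥-elim (0≢1 (lead α))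
      go (suc n) (x ∷ A) α = mk λ { zero → refl ; (suc i) → at (go n A (mon (lead α) (<°-tail (bound α)))) i }

  PrimeOrSplits : Pol → ℕ → Set
  PrimeOrSplits A n =
    (∃ λ p → poly p ≡ A) ⊎ ∃ λ B → ∃ λ C → ∃ λ b → ∃ λ c → Mon B b × Mon C c × b < n × c < n × B *P C ≈ A

  Prime-or-splits : ∀ A n → Mon A n → 1 ≤ n → PrimeOrSplits A n
  Prime-or-splits A n α 1≤n = search n ℕₚ.≤-refl (λ _ _ 1≤j j<n le → ⊥-elim (ℕₚ.<⇒≱ j<n le))
    where
      -- The last hypothesis excludes monic divisors of positive degree in [k, n); at k = 0 it is
      -- irreducibility.
      search : ∀ k → k ≤ n → (∀ D j → 1 ≤ j → j < n → k ≤ j → Mon D j → ¬ (D ∣ A)) → PrimeOrSplits A n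
      search zero _ none = inj₁ (record { poly = A ; dg = n ; monic = α ; positive = 1≤n ; irreducible = irr } , refl)
        where
          irr : ∀ G → G ∣ A → G <° 1 ⊎ A ∣ G
          irr G G∣A with leading _ G (<°-length G)
          ... | inj₁ z = ⊥-elim (Mon-≉0 α (≈-trans (≈-sym (equality G∣A)) (*-zeroˡ-≈ G (cofactor G∣A) z)))
          ... | inj₂ (zero , _ , _ , g) = inj₁ g
          ... | inj₂ (suc j , _ , ne , g) with normalise ne g
          ...   | c , c⁻¹ , e , μ with suc j ℕ.<? n
          ...     | yes lt = ⊥-elim (none (scal c⁻¹ G) (suc j) (s≤s z≤n) lt z≤n μ (scal-∣ˡ e G∣A))
          -- A divisor of degree at least n has a constant cofactor, hence is associated to `A`.
          ...     | no ¬lt with scal-∣ˡ e G∣A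
          ...       | dv R eq with Mon-cofactor μ {R = R} α eq
          ...         | m , ρ , jm = inj₂ (∣-resp (≈-sym (scal-∣ e)) (∣-scal c
              (∣-resp (≈-sym (≈-trans (≈-sym (PR.*-identityʳ (scal c⁻¹ G))) (≈-trans (*-congʳ (scal c⁻¹ G) (≈-sym (Mon0⇒≈1 ρ₀))) eq))) ∣-refl)))
            where
              m≡0 : m ≡ 0
              m≡0 = ℕₚ.m+n≡0⇒m≡0 m {0} (trans (ℕₚ.+-identityʳ m) (ℕₚ.n≤0⇒n≡0 (ℕₚ.+-cancelˡ-≤ (suc j) m 0
                (subst₂ _≤_ (sym jm) (sym (ℕₚ.+-identityʳ (suc j))) (ℕₚ.≮⇒≥ ¬lt)))))
              ρ₀ : Mon R 0
              ρ₀ = subst (Mon R) m≡0 ρ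
      search (suc j) j<n none with 1 ℕ.≤? j
      ... | no ¬1≤j = search j (ℕₚ.<⇒≤ j<n) (λ D i 1≤i i<n j≤i → none D i 1≤i i<n (ℕₚ.≤-trans (s≤s (ℕₚ.≤-pred (ℕₚ.≰⇒> ¬1≤j))) 1≤i))
      ... | yes 1≤j with any? (λ cs → isZeroP (Div.rem (cs ++ [ 1# ]) j A) 𝔹ₚ.≟ true) (polys j)
      ...   | yes found with find found
      ...     | cs , m , e with snoc-Mon m | rem⇒∣ (snoc-Mon m) e
      ...       | μ | dv R eq with Mon-cofactor μ {R = R} α eq
      ...         | c , ρ , jc = inj₂ (cs ++ [ 1# ] , R , j , c , μ , ρ , j<n ,
              subst (suc c ≤_) jc (ℕₚ.+-monoˡ-≤ c 1≤j) , eq)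
      search (suc j) j<n none | yes 1≤j | no ¬found = search j (ℕₚ.<⇒≤ j<n) none′
        where
          none′ : ∀ D i → 1 ≤ i → i < n → j ≤ i → Mon D i → ¬ (D ∣ A)
          none′ D i 1≤i i<n j≤i δ D∣A with ℕₚ.m≤n⇒m<n∨m≡n j≤i
          ... | inj₁ lt = none D i 1≤i i<n lt δ D∣A
          ... | inj₂ refl with Mon-snoc δ
          ...   | cs , m , e = ¬found (Any.map (λ { {cs′} refl → ∣⇒rem (snoc-Mon m) (∣-respˡ e D∣A) }) m)

  prodAll : List Prm → Pol
  prodAll = prodIf (λ _ → true)

  degAll : List Prm → ℕ
  degAll = degIf (λ _ → true)

  prodAll-++ : ∀ ps rs → prodAll (ps ++ rs) ≈ prodAll ps *P prodAll rs
  prodAll-++ [] rs = ≈-sym (*-identityˡ _)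
  prodAll-++ (p ∷ ps) rs = ≈-trans (*-congʳ (poly p) (prodAll-++ ps rs)) (≈-sym (*-assoc (poly p) (prodAll ps) (prodAll rs)))

  factorise : ∀ k A n → n < k → Mon A n → ∃ λ ps → prodAll ps ≈ A
  factorise (suc k) A zero lt α = [] , ≈-sym (Mon0⇒≈1 α)
  factorise (suc k) A (suc n) (s≤s lt) α with Prime-or-splits A (suc n) α (s≤s z≤n)
  ... | inj₁ (p , refl) = p ∷ [] , PR.*-identityʳ (poly p)
  ... | inj₂ (B , C , b , c , β , γ , b<n , c<n , e) with factorise k B b (ℕₚ.≤-trans b<n lt) β | factorise k C c (ℕₚ.≤-trans c<n lt) γ
  ...   | ps , f | rs , g = ps ++ rs , ≈-trans (prodAll-++ ps rs) (≈-trans (*-cong f g) e)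

  -- If a later factor divided an earlier one, its square would divide the product.
  squarefree-Apart : ∀ ps → (∀ P d → Mon P d → 1 ≤ d → ¬ (P *P P ∣ prodAll ps)) → Apart ps
  squarefree-Apart [] sq = []
  squarefree-Apart (p ∷ ps) sq = All.tabulate apart ∷ squarefree-Apart ps (λ P d μ h s → sq P d μ h (∣-*ˡ (poly p) s))
    where
      apart : ∀ {r} → r ∈ ps → ¬ (poly r ∣ poly p)
      apart {r} m (dv R e) with All.lookup (∣-prodIf (λ _ → true) ps) m refl
      ... | dv S f = sq (poly r) (dg r) (monic r) (positive r)
        (dv (R *P S) (≈-trans (Pᵢ.interchange* (poly r) (poly r) R S) (*-cong e f)))

  squarefree-factorisation : ∀ Q n → Mon Q n → Squarefree Q → ∃ λ ps → prodAll ps ≈ Q × Apart ps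
  squarefree-factorisation Q n μ sq with factorise (suc n) Q n ℕₚ.≤-refl μ
  ... | ps , e = ps , e , squarefree-Apart ps λ P d π 1≤d s →
    sq P (subst (1 ≤_) (sym (Mon-deg π)) 1≤d) (cofactor s , at (≈-trans (equality s) e))

-- Finite products and their expansion over splittings of a list

module _ {A : Set} where
  open import Data.Rational using (_+_; _*_; _-_; -_; _≤_)
  open +-*-Solver using (solve; _:=_; _:+_; _:*_; _:-_; :-_; con)
  ∏ : List A → (A → ℚ) → ℚ
  ∏ [] f = 1ℚ
  ∏ (x ∷ xs) f = f x * ∏ xs f

  infix 5 ∏
  syntax ∏ xs (λ x → e) = ∏[ x ∈ xs ] e

  ∏-cong-All : ∀ {xs} {f g : A → ℚ} → All (λ x → f x ≡ g x) xs → ∏ xs f ≡ ∏ xs g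
  ∏-cong-All [] = refl
  ∏-cong-All (e ∷ es) = cong₂ _*_ e (∏-cong-All es)

  ∏-cong : ∀ xs {f g : A → ℚ} → (∀ x → f x ≡ g x) → ∏ xs f ≡ ∏ xs g
  ∏-cong xs e = ∏-cong-All (All.universal e xs)

  ∏-* : ∀ xs (f g : A → ℚ) → (∏[ x ∈ xs ] (f x * g x)) ≡ ∏ xs f * ∏ xs g
  ∏-* [] f g = refl
  ∏-* (x ∷ xs) f g = trans (cong (f x * g x *_) (∏-* xs f g))
    (solve 4 (λ a b c d → (a :* b) :* (c :* d) := (a :* c) :* (b :* d)) refl (f x) (g x) (∏ xs f) (∏ xs g))

  ∏-nonneg : ∀ xs {f : A → ℚ} → (∀ x → 0ℚ ≤ f x) → 0ℚ ≤ ∏ xs f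
  ∏-nonneg [] h = 0≤1
  ∏-nonneg (x ∷ xs) h = 0≤* (h x) (∏-nonneg xs h)

  ∏-mono : ∀ xs {f g : A → ℚ} → (∀ x → 0ℚ ≤ f x) → (∀ x → f x ≤ g x) → ∏ xs f ≤ ∏ xs g
  ∏-mono [] h le = ℚₚ.≤-refl
  ∏-mono (x ∷ xs) h le = *-mono-≤ (h x) (le x) (∏-nonneg xs h) (∏-mono xs h le)

  ∏-one : ∀ (xs : List A) → ∏ xs (λ _ → 1ℚ) ≡ 1ℚ
  ∏-one [] = refl
  ∏-one (x ∷ xs) = trans (ℚₚ.*-identityˡ _) (∏-one xs)

  ∏-∣∣ : ∀ xs (f : A → ℚ) → ℚ.∣ ∏ xs f ∣ ≡ ∏ xs (λ x → ℚ.∣ f x ∣)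
  ∏-∣∣ [] f = refl
  ∏-∣∣ (x ∷ xs) f = trans (ℚₚ.∣p*q∣≡∣p∣*∣q∣ (f x) (∏ xs f)) (cong (ℚ.∣ f x ∣ *_) (∏-∣∣ xs f))

  -- All ways to distribute the entries over two lists; for the prime factors of Q these are the
  -- factorisations Q = D E.
  splits : List A → List (List A × List A)
  splits [] = ([] , []) ∷ []
  splits (x ∷ xs) = map (λ { (D , E) → x ∷ D , E }) (splits xs) ++ map (λ { (D , E) → D , x ∷ E }) (splits xs)

  ∑-splits : ∀ xs (u v : A → ℚ) → ∑ (splits xs) (λ { (D , E) → ∏ D u * ∏ E v }) ≡ (∏[ x ∈ xs ] (u x + v x))
  ∑-splits [] u v = refl
  ∑-splits (x ∷ xs) u v = begin
    ∑ (splits (x ∷ xs)) G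
      ≡⟨ ∑-++ (map (λ { (D , E) → x ∷ D , E }) (splits xs)) (map (λ { (D , E) → D , x ∷ E }) (splits xs)) G ⟩
    ∑ (map (λ { (D , E) → x ∷ D , E }) (splits xs)) G + ∑ (map (λ { (D , E) → D , x ∷ E }) (splits xs)) G
      ≡⟨ cong₂ _+_ (trans (∑-map _ (splits xs) G) (trans (∑-cong (splits xs) (λ { (D , E) → ℚₚ.*-assoc (u x) (∏ D u) (∏ E v) })) (∑-*ˡ (u x) (splits xs) G)))
                   (trans (∑-map _ (splits xs) G) (trans (∑-cong (splits xs) (λ { (D , E) → swap (∏ D u) (v x) (∏ E v) })) (∑-*ˡ (v x) (splits xs) G))) ⟩
    u x * ∑ (splits xs) G + v x * ∑ (splits xs) G
      ≡⟨ ℚₚ.*-distribʳ-+ (∑ (splits xs) G) (u x) (v x) ⟨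
    (u x + v x) * ∑ (splits xs) G
      ≡⟨ cong ((u x + v x) *_) (∑-splits xs u v) ⟩
    (u x + v x) * ∏ xs (λ x → u x + v x) ∎
    where
      open ≡-Reasoning
      G : List A × List A → ℚ
      G (D , E) = ∏ D u * ∏ E v
      swap : ∀ a b c → a * (b * c) ≡ b * (a * c)
      swap = solve 3 (λ a b c → a :* (b :* c) := b :* (a :* c)) refl

  module _ {R : A → A → Set} where
    record SplitOf (xs D E : List A) : Set where
      field
        pairsˡ : AllPairs R D
        pairsʳ : AllPairs R E
        subˡ : ∀ {x} → x ∈ D → x ∈ xs
        subʳ : ∀ {x} → x ∈ E → x ∈ xs
    open SplitOf public

    splits-sound : ∀ {xs} → AllPairs R xs → All (λ { (D , E) → SplitOf xs D E }) (splits xs)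
    splits-sound [] = record { pairsˡ = [] ; pairsʳ = [] ; subˡ = λ () ; subʳ = λ () } ∷ []
    splits-sound {x ∷ xs} (r ∷ rs) = Allₚ.++⁺
      (Allₚ.map⁺ (All.map (λ { {D , E} s → record
        { pairsˡ = All.tabulate (λ m → All.lookup r (subˡ s m)) ∷ pairsˡ s ; pairsʳ = pairsʳ s
        ; subˡ = λ { (here e) → here e ; (there m) → there (subˡ s m) } ; subʳ = λ m → there (subʳ s m) } }) (splits-sound rs)))
      (Allₚ.map⁺ (All.map (λ { {D , E} s → record
        { pairsˡ = pairsˡ s ; pairsʳ = All.tabulate (λ m → All.lookup r (subʳ s m)) ∷ pairsʳ s
        ; subˡ = λ m → there (subˡ s m) ; subʳ = λ { (here e) → here e ; (there m) → there (subʳ s m) } } }) (splits-sound rs)))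

-- Fourier analysis modulo Q over the rationals

module Duality (𝔽 : FiniteField) where
  open import Data.Rational using (_+_; _*_; _-_; -_; _≤_)
  open +-*-Solver using (solve; _:=_; _:+_; _:*_; _:-_; :-_; con)
  open PolyRing 𝔽
  open Divisibility 𝔽
  open Enumeration 𝔽

  δ : Carrier → Carrier → ℚ
  δ z c = 𝟙 ⌊ c ≟ z ⌋

  -- A stand-in for a nontrivial additive character: all that is used is that it is nonzero
  -- at 0 and sums to zero over the field.
  ψ : Carrier → ℚ
  ψ c = δ 0# c - δ 1# c

  ψ0≡1 : ψ 0# ≡ 1ℚ
  ψ0≡1 with 0# ≟ 0# | 0# ≟ 1#
  ... | yes _ | no _ = refl
  ... | no ne | _ = ⊥-elim (ne refl)
  ... | yes _ | yes e = ⊥-elim (0≢1 e)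

  ≟-true : ∀ {a b} → a ≡ b → ⌊ a ≟ b ⌋ ≡ true
  ≟-true {a} {b} e with a ≟ b
  ... | yes _ = refl
  ... | no ne = ⊥-elim (ne e)

  true-≟ : ∀ {a b} → ⌊ a ≟ b ⌋ ≡ true → a ≡ b
  true-≟ {a} {b} e with a ≟ b
  ... | yes p = p

  -- An affine map with nonzero slope is a bijection of the field, so it takes the value `z` exactly
  -- once.
  ∑-δ-affine : ∀ z c b → b ≢ 0# → ∑ elems (λ a → δ z (c +F a *F b)) ≡ 1ℚ
  ∑-δ-affine z c b ne with inverse b ne
  ... | b⁻¹ , e = ∑-δ1 (λ a → ⌊ (c +F a *F b) ≟ z ⌋) (elems-complete a₀) (≟-true root) unique elems-unique
    where
      open ≡-Reasoning
      a₀ : Carrier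
      a₀ = (z +F -F c) *F b⁻¹
      root : c +F a₀ *F b ≡ z
      root = begin
        c +F ((z +F -F c) *F b⁻¹) *F b ≡⟨ cong (c +F_) (trans (F.*-assoc _ b⁻¹ b) (trans (cong ((z +F -F c) *F_) (trans (F.*-comm b⁻¹ b) e)) (F.*-identityʳ _))) ⟩
        c +F (z +F -F c) ≡⟨ F.+-comm c _ ⟩
        (z +F -F c) +F c ≡⟨ F.+-assoc z (-F c) c ⟩
        z +F (-F c +F c) ≡⟨ cong (z +F_) (F.-‿inverseˡ c) ⟩
        z +F 0# ≡⟨ F.+-identityʳ z ⟩
        z ∎
      unique : ∀ {a} → a ∈ elems → ⌊ (c +F a *F b) ≟ z ⌋ ≡ true → a ≡ a₀
      unique {a} _ h = begin
        a ≡⟨ F.*-identityʳ a ⟨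
        a *F 1# ≡⟨ cong (a *F_) e ⟨
        a *F (b *F b⁻¹) ≡⟨ F.*-assoc a b b⁻¹ ⟨
        (a *F b) *F b⁻¹ ≡⟨ cong (_*F b⁻¹) ab ⟩
        (z +F -F c) *F b⁻¹ ∎
        where
          ab : a *F b ≡ z +F -F c
          ab = begin
            a *F b ≡⟨ F.+-identityʳ _ ⟨
            a *F b +F 0# ≡⟨ cong ((a *F b) +F_) (F.-‿inverseʳ c) ⟨
            a *F b +F (c +F -F c) ≡⟨ F.+-assoc _ c (-F c) ⟨
            (a *F b +F c) +F -F c ≡⟨ cong (_+F -F c) (trans (F.+-comm _ c) (true-≟ h)) ⟩
            z +F -F c ∎

  -- For nonzero `b` both deltas in `ψ` sum to 1 and cancel; for `b` zero the summand is constant.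
  ∑-ψ-affine : ∀ c b → ∑ elems (λ a → ψ (c +F a *F b)) ≡ ℕ→ℚ q * (𝟙 (isZeroC b) * ψ c)
  ∑-ψ-affine c b with b ≟ 0#
  ... | yes refl = begin
    ∑ elems (λ a → ψ (c +F a *F 0#)) ≡⟨ ∑-cong elems (λ a → cong ψ (trans (cong (c +F_) (F.zeroʳ a)) (F.+-identityʳ c))) ⟩
    ∑ elems (λ a → ψ c) ≡⟨ ∑-const elems (ψ c) ⟩
    ℕ→ℚ (length elems) * ψ c ≡⟨ cong₂ _*_ (cong ℕ→ℚ length-elems) (sym (ℚₚ.*-identityˡ (ψ c))) ⟩
    ℕ→ℚ q * (1ℚ * ψ c) ∎
    where open ≡-Reasoning
  ... | no ne = begin
    ∑ elems (λ a → ψ (c +F a *F b))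
      ≡⟨ ∑-+ elems (λ a → δ 0# (c +F a *F b)) (λ a → - δ 1# (c +F a *F b)) ⟩
    ∑ elems (λ a → δ 0# (c +F a *F b)) + ∑ elems (λ a → - δ 1# (c +F a *F b))
      ≡⟨ cong (∑ elems (λ a → δ 0# (c +F a *F b)) +_) (∑-cong elems (λ a → neg-mul (δ 1# (c +F a *F b)))) ⟩
    ∑ elems (λ a → δ 0# (c +F a *F b)) + ∑ elems (λ a → - 1ℚ * δ 1# (c +F a *F b))
      ≡⟨ cong₂ _+_ (∑-δ-affine 0# c b ne) (trans (∑-*ˡ (- 1ℚ) elems (λ a → δ 1# (c +F a *F b))) (cong (- 1ℚ *_) (∑-δ-affine 1# c b ne))) ⟩
    0ℚ
      ≡⟨ trans (cong (ℕ→ℚ q *_) (ℚₚ.*-zeroˡ (ψ c))) (ℚₚ.*-zeroʳ (ℕ→ℚ q)) ⟨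
    ℕ→ℚ q * (0ℚ * ψ c) ∎
    where
      open ≡-Reasoning
      neg-mul : ∀ x → - x ≡ - 1ℚ * x
      neg-mul = solve 1 (λ x → :- x := (:- con 1ℚ) :* x) refl

  module Residue {Q n} (μ : Mon Q n) where
    open Div Q n

    -- the coefficient of T⁻¹ in the expansion of A / Q at infinity
    lam : Pol → Carrier
    lam A = coeff (T (rem A)) n

    lam-mod : ∀ {A K R} → A ≈ (Q *P K) +P R → lam A ≡ lam R
    lam-mod {A} {K} {R} e = at (T-cong (rem-unique μ {K = K +P quo R} eq (<°-rem μ R))) n
      where
        open ≈-Reasoning
        eq : A ≈ (Q *P (K +P quo R)) +P rem R
        eq = begin
          A ≈⟨ e ⟩
          (Q *P K) +P R ≈⟨ +-cong (≈-refl {Q *P K}) (rem-quo R) ⟩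
          (Q *P K) +P ((Q *P quo R) +P rem R) ≈⟨ +-assoc (Q *P K) (Q *P quo R) (rem R) ⟨
          ((Q *P K) +P (Q *P quo R)) +P rem R ≈⟨ +-cong (≈-sym (*-distribˡ Q K (quo R))) ≈-refl ⟩
          (Q *P (K +P quo R)) +P rem R ∎

    -- Without reduction the functional reads the coefficient of T^(n-1); written through the shift
    -- `T`, it is zero when n = 0.
    lam-small : ∀ {A} → A <° n → lam A ≡ coeff (T A) n
    lam-small {A} a = at (T-cong (rem-unique μ {K = []} (≈-sym (+-cong (*-zeroʳ Q) (≈-refl {A}))) a)) n

    lam-resp : ∀ {A B} → A ≈ B → lam A ≡ lam B
    lam-resp {A} {B} e = lam-mod {K = []} (≈-trans e (≈-sym (+-cong (*-zeroʳ Q) (≈-refl {B}))))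

    lam-+ : ∀ A B → lam (A +P B) ≡ lam A +F lam B
    lam-+ A B = trans (at (T-cong (rem-unique μ {K = quo A +P quo B} eq (<°-+ (<°-rem μ A) (<°-rem μ B)))) n) (top n)
      where
        open ≈-Reasoning
        eq : A +P B ≈ (Q *P (quo A +P quo B)) +P (rem A +P rem B)
        eq = begin
          A +P B ≈⟨ +-cong (rem-quo A) (rem-quo B) ⟩
          ((Q *P quo A) +P rem A) +P ((Q *P quo B) +P rem B) ≈⟨ +-interchange (Q *P quo A) (rem A) (Q *P quo B) (rem B) ⟩
          ((Q *P quo A) +P (Q *P quo B)) +P (rem A +P rem B) ≈⟨ +-cong (≈-sym (*-distribˡ Q (quo A) (quo B))) ≈-refl ⟩
          (Q *P (quo A +P quo B)) +P (rem A +P rem B) ∎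
        top : ∀ m → coeff (T (rem A +P rem B)) m ≡ coeff (T (rem A)) m +F coeff (T (rem B)) m
        top zero = sym (F.+-identityˡ 0#)
        top (suc m) = coeff-+ (rem A) (rem B) m

    lam-scal : ∀ c A → lam (scal c A) ≡ c *F lam A
    lam-scal c A = trans (at (T-cong (rem-unique μ {K = scal c (quo A)} eq (<°-scal c (<°-rem μ A)))) n) (top n)
      where
        open ≈-Reasoning
        eq : scal c A ≈ (Q *P scal c (quo A)) +P scal c (rem A)
        eq = begin
          scal c A ≈⟨ scal-cong c (rem-quo A) ⟩
          scal c ((Q *P quo A) +P rem A) ≈⟨ scal-+ c (Q *P quo A) (rem A) ⟩
          scal c (Q *P quo A) +P scal c (rem A) ≈⟨ +-cong (≈-trans (scal-cong c (*-comm Q (quo A))) (≈-trans (≈-sym (scal-*ˡ c (quo A) Q)) (*-comm (scal c (quo A)) Q))) ≈-refl ⟩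
          (Q *P scal c (quo A)) +P scal c (rem A) ∎
        top : ∀ m → coeff (T (scal c (rem A))) m ≡ c *F coeff (T (rem A)) m
        top zero = sym (F.zeroʳ c)
        top (suc m) = coeff-scal c (rem A) m

    -- lam vanishes on A, T A, …, T^(h-1) A
    az : Pol → ℕ → Bool
    az A zero = true
    az A (suc h) = isZeroC (lam A) ∧ az (T A) h

    az-mod : ∀ h {A K R} → A ≈ (Q *P K) +P R → az A h ≡ az R h
    az-mod zero e = refl
    az-mod (suc h) {A} {K} {R} e = cong₂ _∧_ (cong isZeroC (lam-mod {K = K} e)) (az-mod h {K = T K}
      (≈-trans (T-cong e) (≈-trans (mk λ { zero → sym (F.+-identityˡ 0#) ; (suc i) → refl }) (+-cong (≈-sym (T-*ʳ Q K)) (≈-refl {T R})))))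

    <°-T⁻ : ∀ {A} m → T A <° m → A <° m ∸ 1
    <°-T⁻ zero b = bd λ i _ → vanish b (suc i) z≤n
    <°-T⁻ (suc m) b = <°-tail b

    <°-T⁺ : ∀ {A} m → A <° m ∸ 1 → T A <° m
    <°-T⁺ zero b = bd λ { zero _ → refl ; (suc i) _ → vanish b i z≤n }
    <°-T⁺ (suc m) b = <°-∷ b

    -- A vanishing functional removes the top coefficient of `A`; then `T A` has degree < n again,
    -- and the next coefficient moves into the top place. Together with `az-complete` this says that
    -- `az` tests |A / Q| < q^(-h).
    az-sound : ∀ h {A} → A <° n → az A h ≡ true → A <° n ∸ h
    az-sound zero a e = a
    az-sound (suc h) {A} a e with ∧-true {isZeroC (lam A)} e
    ... | e₁ , e₂ = subst (A <°_) (trans (ℕₚ.∸-+-assoc n h 1) (cong (n ∸_) (ℕₚ.+-comm h 1)))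
      (<°-T⁻ (n ∸ h) (az-sound h (<°-pred (<°-∷ a) (trans (sym (lam-small a)) (isZeroC-true e₁))) e₂))

    az-complete : ∀ h {A} → A <° n ∸ h → az A h ≡ true
    az-complete zero a = refl
    az-complete (suc h) {A} a = cong₂ _∧_
      (isZeroC-0 (trans (lam-small (<°-mono (ℕₚ.m∸n≤m n (suc h)) a)) (vanish Ta n (ℕₚ.m∸n≤m n h))))
      (az-complete h Ta)
      where
        Ta : T A <° n ∸ h
        Ta = <°-T⁺ (n ∸ h) (subst (A <°_) (sym (trans (ℕₚ.∸-+-assoc n h 1) (cong (n ∸_) (ℕₚ.+-comm h 1)))) a)

    -- Orthogonality, summing over one coefficient of `H` at a time. As `ψ` is not multiplicative,
    -- what is already fixed is carried along as the shift `c` instead of being factored out.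
    ∑-ψ-lam : ∀ h c A → ∑ (polys h) (λ H → ψ (c +F lam (H *P A))) ≡ ℕ→ℚ (q ℕ.^ h) * (𝟙 (az A h) * ψ c)
    ∑-ψ-lam zero c A = begin
      ψ (c +F lam []) + 0ℚ ≡⟨ ℚₚ.+-identityʳ (ψ (c +F lam [])) ⟩
      ψ (c +F lam []) ≡⟨ cong ψ (trans (cong (c +F_) (at T[]≈[] n)) (F.+-identityʳ c)) ⟩
      ψ c ≡⟨ trans (ℚₚ.*-identityˡ (1ℚ * ψ c)) (ℚₚ.*-identityˡ (ψ c)) ⟨
      1ℚ * (1ℚ * ψ c) ∎
      where open ≡-Reasoning
    ∑-ψ-lam (suc h) c A = begin
      ∑ (polys (suc h)) (λ H → ψ (c +F lam (H *P A)))
        ≡⟨ ∑-polys-suc h (λ H → ψ (c +F lam (H *P A))) ⟩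
      (∑[ x ∈ elems ] ∑[ H ∈ polys h ] ψ (c +F lam ((x ∷ H) *P A)))
        ≡⟨ ∑-cong elems (λ x → trans (∑-cong (polys h) (λ H → cong ψ (step x H))) (∑-ψ-lam h (c +F x *F lam A) (T A))) ⟩
      (∑[ x ∈ elems ] (ℕ→ℚ (q ℕ.^ h) * (𝟙 (az (T A) h) * ψ (c +F x *F lam A))))
        ≡⟨ trans (∑-*ˡ (ℕ→ℚ (q ℕ.^ h)) elems _) (cong (ℕ→ℚ (q ℕ.^ h) *_) (∑-*ˡ (𝟙 (az (T A) h)) elems _)) ⟩
      ℕ→ℚ (q ℕ.^ h) * (𝟙 (az (T A) h) * ∑ elems (λ x → ψ (c +F x *F lam A)))
        ≡⟨ cong (λ s → ℕ→ℚ (q ℕ.^ h) * (𝟙 (az (T A) h) * s)) (∑-ψ-affine c (lam A)) ⟩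
      ℕ→ℚ (q ℕ.^ h) * (𝟙 (az (T A) h) * (ℕ→ℚ q * (𝟙 (isZeroC (lam A)) * ψ c)))
        ≡⟨ solve 5 (λ a b c d e → a :* (b :* (c :* (d :* e))) := (c :* a) :* ((d :* b) :* e)) refl
             (ℕ→ℚ (q ℕ.^ h)) (𝟙 (az (T A) h)) (ℕ→ℚ q) (𝟙 (isZeroC (lam A))) (ψ c) ⟩
      (ℕ→ℚ q * ℕ→ℚ (q ℕ.^ h)) * ((𝟙 (isZeroC (lam A)) * 𝟙 (az (T A) h)) * ψ c)
        ≡⟨ cong₂ (λ s t → s * (t * ψ c)) (ℕ→ℚ-* q (q ℕ.^ h)) (𝟙-∧ (isZeroC (lam A)) (az (T A) h)) ⟨
      ℕ→ℚ (q ℕ.^ suc h) * (𝟙 (az A (suc h)) * ψ c) ∎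
      where
        open ≡-Reasoning
        step : ∀ x H → c +F lam ((x ∷ H) *P A) ≡ (c +F x *F lam A) +F lam (H *P T A)
        step x H = trans (cong (c +F_) (trans (lam-+ (scal x A) (T (H *P A))) (cong₂ _+F_ (lam-scal x A) (lam-resp (≈-sym (T-*ʳ H A))))))
          (sym (F.+-assoc c (x *F lam A) (lam (H *P T A))))

  bool-⇔ : ∀ {a b} → (a ≡ true → b ≡ true) → (b ≡ true → a ≡ true) → a ≡ b
  bool-⇔ {true} {true} f g = refl
  bool-⇔ {true} {false} f g = sym (f refl)
  bool-⇔ {false} {true} f g = g refl
  bool-⇔ {false} {false} f g = refl

  dvdAll : List Prm → Pol → Bool
  dvdAll [] A = true
  dvdAll (p ∷ ps) A = dvd p A ∧ dvdAll ps A

  dvdAll-All : ∀ ps {A} → dvdAll ps A ≡ true → All (λ p → true ≡ true → poly p ∣ A) ps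
  dvdAll-All [] e = []
  dvdAll-All (p ∷ ps) {A} e with ∧-true {dvd p A} e
  ... | e₁ , e₂ = (λ _ → dvd⇒∣ p e₁) ∷ dvdAll-All ps e₂

  dvdAll-sound : ∀ {ps} → Apart ps → ∀ {A} → dvdAll ps A ≡ true → prodAll ps ∣ A
  dvdAll-sound {ps} ap e = prodIf-∣ (λ _ → true) ap (dvdAll-All ps e)

  dvdAll-complete : ∀ ps {A} → prodAll ps ∣ A → dvdAll ps A ≡ true
  dvdAll-complete ps {A} d = go ps (All.map (λ f → ∣-trans (f refl) d) (∣-prodIf (λ _ → true) ps))
    where
      go : ∀ rs → All (λ p → poly p ∣ A) rs → dvdAll rs A ≡ true
      go [] [] = refl
      go (r ∷ rs) (h ∷ hs) = cong₂ _∧_ (∣⇒dvd r h) (go rs hs)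

  dvdAll-∏ : ∀ ps A → 𝟙 (dvdAll ps A) ≡ (∏[ p ∈ ps ] 𝟙 (dvd p A))
  dvdAll-∏ [] A = refl
  dvdAll-∏ (p ∷ ps) A = trans (𝟙-∧ (dvd p A) (dvdAll ps A)) (cong (𝟙 (dvd p A) *_) (dvdAll-∏ ps A))

  Nm : Prm → ℕ
  Nm p = q ℕ.^ dg p

  1≤q^ : ∀ d → 1 ℕ.≤ q ℕ.^ d
  1≤q^ d = ℕₚ.m^n>0 q {{ℕ.>-nonZero (ℕₚ.≤-trans (s≤s z≤n) 2≤q)}} d

  2≤Nm : ∀ p → 2 ℕ.≤ Nm p
  2≤Nm p = ℕₚ.≤-trans 2≤q (subst (ℕ._≤ Nm p) (ℕₚ.^-identityʳ q)
    (ℕₚ.^-monoʳ-≤ q {{ℕ.>-nonZero (ℕₚ.≤-trans (s≤s z≤n) 2≤q)}} (positive p)))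

  Nm-inv : ∀ p → ℕ→ℚ (Nm p) * inv (Nm p) ≡ 1ℚ
  Nm-inv p = inv-inverseʳ (1≤q^ (dg p))

  splits-product : ∀ ps → All (λ { (D , E) → prodAll D *P prodAll E ≈ prodAll ps × degAll D ℕ.+ degAll E ≡ degAll ps }) (splits ps)
  splits-product [] = (*-identityˡ [ 1# ] , refl) ∷ []
  splits-product (p ∷ ps) = Allₚ.++⁺
    (Allₚ.map⁺ (All.map (λ { {D , E} (e , f) →
      ≈-trans (*-assoc (poly p) (prodAll D) (prodAll E)) (*-congʳ (poly p) e) ,
      trans (ℕₚ.+-assoc (dg p) (degAll D) (degAll E)) (cong (dg p ℕ.+_) f) }) (splits-product ps)))
    (Allₚ.map⁺ (All.map (λ { {D , E} (e , f) →
      ≈-trans (≈-trans (≈-sym (*-assoc (prodAll D) (poly p) (prodAll E))) (≈-trans (*-congˡ (prodAll E) (*-comm (prodAll D) (poly p))) (*-assoc (poly p) (prodAll D) (prodAll E)))) (*-congʳ (poly p) e) ,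
      trans (trans (sym (ℕₚ.+-assoc (degAll D) (dg p) (degAll E))) (trans (cong (ℕ._+ degAll E) (ℕₚ.+-comm (degAll D) (dg p))) (ℕₚ.+-assoc (dg p) (degAll D) (degAll E)))) (cong (dg p ℕ.+_) f) }) (splits-product ps)))

  module Expansion (ps : List Prm) (apart : Apart ps) where
    Q : Pol
    Q = prodAll ps

    n : ℕ
    n = degAll ps

    μQ : Mon Q n
    μQ = prodIf-monic (λ _ → true) ps

    open Residue μQ public

    -- Modulo Q, the product E F equals E times the remainder of F by D. Its degree is below deg E,
    -- as `az` demands, only if that remainder is zero.
    az-dvdAll : ∀ {D E} → Apart D → prodAll D *P prodAll E ≈ Q → degAll D ℕ.+ degAll E ≡ n →
                ∀ F → az (prodAll E *P F) (degAll D) ≡ dvdAll D F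
    az-dvdAll {D} {E} apD DE≈Q d+e≡n F = trans (az-mod d {K = quo F} EF) (bool-⇔ to from)
      where
        open Div (prodAll D) (degAll D)
        d e : ℕ
        d = degAll D
        e = degAll E
        μD : Mon (prodAll D) d
        μD = prodIf-monic (λ _ → true) D
        μE : Mon (prodAll E) e
        μE = prodIf-monic (λ _ → true) E
        R : Pol
        R = rem F
        EF : prodAll E *P F ≈ (Q *P quo F) +P (prodAll E *P R)
        EF = ≈-trans (*-congʳ (prodAll E) (rem-quo F)) (≈-trans (*-distribˡ (prodAll E) (prodAll D *P quo F) R)
          (+-cong (≈-trans (≈-sym (*-assoc (prodAll E) (prodAll D) (quo F))) (*-congˡ (quo F) (≈-trans (*-comm (prodAll E) (prodAll D)) DE≈Q))) ≈-refl))
        ER<n : prodAll E *P R <° n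
        ER<n = subst (prodAll E *P R <°_) (trans (ℕₚ.+-comm e d) d+e≡n) (<°-* (bound μE) (<°-rem μD F))
        to : az (prodAll E *P R) d ≡ true → dvdAll D F ≡ true
        to h = dvdAll-complete D (rem⇒∣ μD (≈[]⇒isZeroP R (Mon-cancel-0 μE
          (subst (prodAll E *P R <°_) (trans (cong (_∸ d) (sym d+e≡n)) (ℕₚ.m+n∸m≡n d e)) (az-sound d ER<n h)))))
        from : dvdAll D F ≡ true → az (prodAll E *P R) d ≡ true
        from h = az-complete d (<°-resp (≈-sym (≈-trans (*-congʳ (prodAll E)
          (isZeroP⇒≈[] R (∣⇒rem μD (dvdAll-sound apD h)))) (*-zeroʳ (prodAll E)))) <°-[])

    multiple-indicator : ∀ {D E} → Apart E → prodAll D *P prodAll E ≈ Q → degAll D ℕ.+ degAll E ≡ n →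
                         ∀ {A} → A <° n → 𝟙 (dvdAll E A) ≡ (∑[ C ∈ polys (degAll D) ] 𝟙 (A ==P (prodAll E *P C)))
    multiple-indicator {D} {E} apE DE≈Q d+e≡n {A} a with dvdAll E A in eq
    ... | false = sym (trans (∑-cong (polys (degAll D)) none) (∑-zero (polys (degAll D))))
      where
        none : ∀ C → 𝟙 (A ==P (prodAll E *P C)) ≡ 0ℚ
        none C with A ==P (prodAll E *P C) in e
        ... | false = refl
        ... | true = case trans (sym eq) (dvdAll-complete E (dv C (≈-sym (==P⇒≈ e)))) of λ ()
    ... | true with dvdAll-sound apE eq
    ...   | dv R f = sym (trans (∑-cong (polys (degAll D)) same) (∑-polys-δ1 (degAll D) R<d))
      where
        μE : Mon (prodAll E) (degAll E)
        μE = prodIf-monic (λ _ → true) E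
        R<d : R <° degAll D
        R<d = Mon-cancel {C = R} (degAll D) μE (<°-resp (≈-sym f) (subst (A <°_) (trans (sym d+e≡n) (ℕₚ.+-comm (degAll D) (degAll E))) a))
        cancel : ∀ {C} → A ≈ prodAll E *P C → C ≈ R
        cancel {C} h = sub≈0⇒≈ C R (Mon-cancel-0 {C = C -P R} μE (<°-resp (≈-sym
          (≈-trans (*-distribˡ (prodAll E) C (-P R)) (≈-trans (+-cong (≈-refl {prodAll E *P C}) (≈-sym (Pₚ.-‿distribʳ-* (prodAll E) R)))
          (≈⇒sub≈0 {prodAll E *P C} {prodAll E *P R} (≈-trans (≈-sym h) (≈-sym f)))))) <°-[]))
        same : ∀ C → 𝟙 (A ==P (prodAll E *P C)) ≡ 𝟙 (C ==P R)
        same C = cong 𝟙 (bool-⇔ (λ h → ==P-true (cancel (==P⇒≈ h))) (λ h → ==P-true (≈-trans (≈-sym f) (*-congʳ (prodAll E) (≈-sym (==P⇒≈ h))))))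

    e[_,_,_] : Carrier → Pol → Pol → ℚ
    e[ c , F , A ] = ψ (c +F lam (F *P A))

    e-resp : ∀ c F {A A′} → A ≈ A′ → e[ c , F , A ] ≡ e[ c , F , A′ ]
    e-resp c F e = cong (λ z → ψ (c +F z)) (lam-resp (*-congʳ F e))

    -- The multiples A of E are the fractions A / Q whose denominator divides D; summing over them
    -- detects divisibility by D just as a full set of additive characters modulo D would.
    divisibility-rep : ∀ {D E} → Apart D → Apart E → prodAll D *P prodAll E ≈ Q → degAll D ℕ.+ degAll E ≡ n → ∀ c F →
      ∑ (polys n) (λ A → 𝟙 (dvdAll E A) * e[ c , F , A ]) ≡ ℕ→ℚ (q ℕ.^ degAll D) * (𝟙 (dvdAll D F) * ψ c)
    divisibility-rep {D} {E} apD apE DE≈Q d+e≡n c F = begin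
      ∑ (polys n) (λ A → 𝟙 (dvdAll E A) * e[ c , F , A ])
        ≡⟨ ∑-cong-∈ (polys n) (λ {A} m → trans (cong (_* e[ c , F , A ]) (multiple-indicator {D} {E} apE DE≈Q d+e≡n (polys-bound n m)))
             (sym (∑-*ʳ e[ c , F , A ] (polys d) (λ C → 𝟙 (A ==P (prodAll E *P C)))))) ⟩
      (∑[ A ∈ polys n ] ∑[ C ∈ polys d ] (𝟙 (A ==P (prodAll E *P C)) * e[ c , F , A ]))
        ≡⟨ ∑-swap (polys n) (polys d) (λ A C → 𝟙 (A ==P (prodAll E *P C)) * e[ c , F , A ]) ⟩
      (∑[ C ∈ polys d ] ∑[ A ∈ polys n ] (𝟙 (A ==P (prodAll E *P C)) * e[ c , F , A ]))
        ≡⟨ ∑-cong-∈ (polys d) (λ {C} m → trans (∑-polys-δ n e[ c , F ,_] (e-resp c F)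
             (subst (prodAll E *P C <°_) (trans (ℕₚ.+-comm (degAll E) d) d+e≡n) (<°-* (bound (prodIf-monic (λ _ → true) E)) (polys-bound d m))))
             (cong (λ z → ψ (c +F z)) (lam-resp (rearrange C)))) ⟩
      (∑[ C ∈ polys d ] ψ (c +F lam (C *P (prodAll E *P F))))
        ≡⟨ ∑-ψ-lam d c (prodAll E *P F) ⟩
      ℕ→ℚ (q ℕ.^ d) * (𝟙 (az (prodAll E *P F) d) * ψ c)
        ≡⟨ cong (λ b → ℕ→ℚ (q ℕ.^ d) * (𝟙 b * ψ c)) (az-dvdAll {D} {E} apD DE≈Q d+e≡n F) ⟩
      ℕ→ℚ (q ℕ.^ d) * (𝟙 (dvdAll D F) * ψ c) ∎
      where
        open ≡-Reasoning
        d : ℕ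
        d = degAll D
        rearrange : ∀ C → F *P (prodAll E *P C) ≈ C *P (prodAll E *P F)
        rearrange C = ≈-trans (*-comm F (prodAll E *P C)) (≈-trans (*-congˡ F (*-comm (prodAll E) C)) (*-assoc C (prodAll E) F))

    -- The Fourier coefficients of the coprimality indicator `g`: the local factor is 1 - 1/|p| if p
    -- divides `A`, and -1/|p| if p belongs to the denominator of A / Q. Thus `ĝ []` is φ(Q)/|Q|.
    ĝ : Pol → ℚ
    ĝ A = ∏[ p ∈ ps ] (- inv (Nm p) + 𝟙 (dvd p A))

    g : Pol → ℚ
    g F = ∏[ p ∈ ps ] (- 𝟙 (dvd p F) + 1ℚ)

    ĝ-resp : ∀ {A A′} → A ≈ A′ → ĝ A ≡ ĝ A′
    ĝ-resp e = ∏-cong ps (λ p → cong (λ b → - inv (Nm p) + 𝟙 b) (dvd-resp p e))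

    g-resp : ∀ {A A′} → A ≈ A′ → g A ≡ g A′
    g-resp e = ∏-cong ps (λ p → cong (λ b → - 𝟙 b + 1ℚ) (dvd-resp p e))

    -- A factor |p| · 1/|p| is inserted at every prime, to meet the normalisation of
    -- `divisibility-rep`.
    signed-indicator : ∀ D F → ∏ D (λ p → - 𝟙 (dvd p F)) ≡ ∏ D (λ p → - inv (Nm p)) * (ℕ→ℚ (q ℕ.^ degAll D) * 𝟙 (dvdAll D F))
    signed-indicator [] F = refl
    signed-indicator (p ∷ D) F = begin
      - 𝟙 (dvd p F) * ∏ D (λ p → - 𝟙 (dvd p F))
        ≡⟨ cong (- 𝟙 (dvd p F) *_) (signed-indicator D F) ⟩
      - 𝟙 (dvd p F) * (a * (b * c))
        ≡⟨ cong (λ z → z * (a * (b * c))) (trans (solve 1 (λ x → :- x := :- (con 1ℚ) :* x) refl (𝟙 (dvd p F))) (cong (λ z → - z * 𝟙 (dvd p F)) (sym (Nm-inv p)))) ⟩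
      - (ℕ→ℚ (Nm p) * inv (Nm p)) * 𝟙 (dvd p F) * (a * (b * c))
        ≡⟨ solve 6 (λ x i t a b c → :- (x :* i) :* t :* (a :* (b :* c)) := (:- i :* a) :* ((x :* b) :* (t :* c))) refl
             (ℕ→ℚ (Nm p)) (inv (Nm p)) (𝟙 (dvd p F)) a b c ⟩
      (- inv (Nm p) * a) * ((ℕ→ℚ (Nm p) * b) * (𝟙 (dvd p F) * c))
        ≡⟨ cong₂ (λ s t → (- inv (Nm p) * a) * (s * t))
             (trans (cong ℕ→ℚ (ℕₚ.^-distribˡ-+-* q (dg p) (degAll D))) (ℕ→ℚ-* (Nm p) (q ℕ.^ degAll D))) (𝟙-∧ (dvd p F) (dvdAll D F)) ⟨
      (- inv (Nm p) * a) * (ℕ→ℚ (q ℕ.^ (dg p ℕ.+ degAll D)) * 𝟙 (dvd p F ∧ dvdAll D F)) ∎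
      where
        open ≡-Reasoning
        a b c : ℚ
        a = ∏ D (λ p → - inv (Nm p))
        b = ℕ→ℚ (q ℕ.^ degAll D)
        c = 𝟙 (dvdAll D F)

    -- Inclusion and exclusion over D, with each divisibility condition replaced by its dual sum;
    -- for a fixed A the sum over D is again an Euler product, namely `ĝ`.
    g-rep : ∀ c F → g F * ψ c ≡ ∑ (polys n) (λ A → ĝ A * e[ c , F , A ])
    g-rep c F = begin
      g F * ψ c
        ≡⟨ cong (_* ψ c) (∑-splits ps (λ p → - 𝟙 (dvd p F)) (λ _ → 1ℚ)) ⟨
      ∑ (splits ps) (λ { (D , E) → ∏ D (λ p → - 𝟙 (dvd p F)) * ∏ E (λ _ → 1ℚ) }) * ψ c
        ≡⟨ ∑-*ʳ (ψ c) (splits ps) (λ { (D , E) → ∏ D (λ p → - 𝟙 (dvd p F)) * ∏ E (λ _ → 1ℚ) }) ⟨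
      ∑ (splits ps) (λ { (D , E) → ∏ D (λ p → - 𝟙 (dvd p F)) * ∏ E (λ _ → 1ℚ) * ψ c })
        ≡⟨ ∑-cong-∈ (splits ps) (λ { {D , E} m → term D E (All.lookup (splits-sound apart) m) (All.lookup (splits-product ps) m) }) ⟩
      (∑[ DE ∈ splits ps ] ∑[ A ∈ polys n ] (W A DE * e[ c , F , A ]))
        ≡⟨ ∑-swap (splits ps) (polys n) (λ DE A → W A DE * e[ c , F , A ]) ⟩
      (∑[ A ∈ polys n ] ∑[ DE ∈ splits ps ] (W A DE * e[ c , F , A ]))
        ≡⟨ ∑-cong (polys n) (λ A → trans (∑-*ʳ e[ c , F , A ] (splits ps) (W A))
             (cong (_* e[ c , F , A ]) (∑-splits ps (λ p → - inv (Nm p)) (λ p → 𝟙 (dvd p A))))) ⟩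
      ∑ (polys n) (λ A → ĝ A * e[ c , F , A ]) ∎
      where
        open ≡-Reasoning
        W : Pol → List Prm × List Prm → ℚ
        W A (D , E) = ∏ D (λ p → - inv (Nm p)) * ∏ E (λ p → 𝟙 (dvd p A))
        term : ∀ D E → SplitOf {R = λ p r → ¬ (poly r ∣ poly p)} ps D E → (prodAll D *P prodAll E ≈ Q × degAll D ℕ.+ degAll E ≡ n) →
               ∏ D (λ p → - 𝟙 (dvd p F)) * ∏ E (λ _ → 1ℚ) * ψ c ≡ ∑ (polys n) (λ A → W A (D , E) * e[ c , F , A ])
        term D E s (e , f) = begin
          ∏ D (λ p → - 𝟙 (dvd p F)) * ∏ E (λ _ → 1ℚ) * ψ c
            ≡⟨ cong₂ (λ s t → s * t * ψ c) (signed-indicator D F) (∏-one E) ⟩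
          a * (b * d) * 1ℚ * ψ c
            ≡⟨ solve 4 (λ a b d t → a :* (b :* d) :* con 1ℚ :* t := a :* (b :* (d :* t))) refl a b d (ψ c) ⟩
          a * (b * (d * ψ c))
            ≡⟨ cong (a *_) (divisibility-rep {D} {E} (pairsˡ s) (pairsʳ s) e f c F) ⟨
          a * ∑ (polys n) (λ A → 𝟙 (dvdAll E A) * e[ c , F , A ])
            ≡⟨ ∑-*ˡ a (polys n) (λ A → 𝟙 (dvdAll E A) * e[ c , F , A ]) ⟨
          ∑ (polys n) (λ A → a * (𝟙 (dvdAll E A) * e[ c , F , A ]))
            ≡⟨ ∑-cong (polys n) (λ A → trans (sym (ℚₚ.*-assoc a (𝟙 (dvdAll E A)) e[ c , F , A ])) (cong (λ z → a * z * e[ c , F , A ]) (dvdAll-∏ E A))) ⟩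
          ∑ (polys n) (λ A → W A (D , E) * e[ c , F , A ]) ∎
          where
            a b d : ℚ
            a = ∏ D (λ p → - inv (Nm p))
            b = ℕ→ℚ (q ℕ.^ degAll D)
            d = 𝟙 (dvdAll D F)

    module Window (h : ℕ) where
      qh : ℚ
      qh = ℕ→ℚ (q ℕ.^ h)

      windowed-rep : ∀ c F → (∑[ H ∈ polys h ] g (F +P H)) * ψ c ≡ ∑ (polys n) (λ A → 𝟙 (az A h) * (qh * ĝ A * e[ c , F , A ]))
      windowed-rep c F = begin
        (∑[ H ∈ polys h ] g (F +P H)) * ψ c
          ≡⟨ ∑-*ʳ (ψ c) (polys h) (λ H → g (F +P H)) ⟨
        (∑[ H ∈ polys h ] (g (F +P H) * ψ c))
          ≡⟨ ∑-cong (polys h) (λ H → trans (g-rep c (F +P H)) (∑-cong (polys n) (λ A → cong (λ z → ĝ A * ψ z) (shift H A)))) ⟩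
        (∑[ H ∈ polys h ] ∑[ A ∈ polys n ] (ĝ A * ψ ((c +F lam (F *P A)) +F lam (H *P A))))
          ≡⟨ ∑-swap (polys h) (polys n) (λ H A → ĝ A * ψ ((c +F lam (F *P A)) +F lam (H *P A))) ⟩
        (∑[ A ∈ polys n ] ∑[ H ∈ polys h ] (ĝ A * ψ ((c +F lam (F *P A)) +F lam (H *P A))))
          ≡⟨ ∑-cong (polys n) (λ A → trans (∑-*ˡ (ĝ A) (polys h) (λ H → ψ ((c +F lam (F *P A)) +F lam (H *P A))))
               (trans (cong (ĝ A *_) (∑-ψ-lam h (c +F lam (F *P A)) A)) (rearrange (ĝ A) (𝟙 (az A h)) e[ c , F , A ]))) ⟩
        ∑ (polys n) (λ A → 𝟙 (az A h) * (qh * ĝ A * e[ c , F , A ])) ∎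
        where
          open ≡-Reasoning
          shift : ∀ H A → c +F lam ((F +P H) *P A) ≡ (c +F lam (F *P A)) +F lam (H *P A)
          shift H A = trans (cong (c +F_) (trans (lam-resp (*-distribʳ A F H)) (lam-+ (F *P A) (H *P A)))) (sym (F.+-assoc c (lam (F *P A)) (lam (H *P A))))
          rearrange : ∀ a b d → a * (qh * (b * d)) ≡ b * (qh * a * d)
          rearrange = λ a b d → solve 4 (λ a b d x → a :* (x :* (b :* d)) := b :* (x :* a :* d)) refl a b d qh

      V : List Pol
      V = polys (n ∸ h)

      -- The number of polynomials coprime to Q in the interval around `F`, minus its mean. The
      -- centring makes the coefficient `α` vanish at 0.
      f : Pol → ℚ
      f F = (∑[ H ∈ polys h ] g (F +P H)) - qh * ĝ []

      α : Pol → ℚ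
      α A = qh * (ĝ A - ĝ [] * 𝟙 (A ==P []))

      α-resp : ∀ {A A′} → A ≈ A′ → α A ≡ α A′
      α-resp {A} {A′} e = cong₂ (λ s t → qh * (s - ĝ [] * 𝟙 t)) (ĝ-resp e)
        (bool-⇔ {A ==P []} {A′ ==P []} (λ z → ==P-true {A′} {[]} (≈-trans (≈-sym e) (==P⇒≈ {A} z))) (λ z → ==P-true {A} {[]} (≈-trans e (==P⇒≈ {A′} z))))

      f-rep : ∀ c F → f F * ψ c ≡ ∑ V (λ A → α A * e[ c , F , A ])
      f-rep c F = begin
        f F * ψ c
          ≡⟨ solve 4 (λ s x p t → (s :- x :* p) :* t := s :* t :+ (:- (x :* p)) :* t) refl (∑[ H ∈ polys h ] g (F +P H)) qh (ĝ []) (ψ c) ⟩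
        (∑[ H ∈ polys h ] g (F +P H)) * ψ c + (- (qh * ĝ [])) * ψ c
          ≡⟨ cong₂ _+_ (windowed-rep c F) const-rep ⟩
        ∑ (polys n) (λ A → 𝟙 (az A h) * (qh * ĝ A * e[ c , F , A ])) + ∑ (polys n) (λ A → 𝟙 (A ==P []) * (- (qh * ĝ []) * e[ c , F , A ]))
          ≡⟨ ∑-+ (polys n) (λ A → 𝟙 (az A h) * (qh * ĝ A * e[ c , F , A ])) (λ A → 𝟙 (A ==P []) * (- (qh * ĝ []) * e[ c , F , A ])) ⟨
        ∑ (polys n) (λ A → 𝟙 (az A h) * (qh * ĝ A * e[ c , F , A ]) + 𝟙 (A ==P []) * (- (qh * ĝ []) * e[ c , F , A ]))
          ≡⟨ ∑-cong (polys n) (λ A → trans (cong (λ z → 𝟙 (az A h) * (qh * ĝ A * e[ c , F , A ]) + z * (- (qh * ĝ []) * e[ c , F , A ])) (absorb A))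
               (solve 6 (λ a x b p z t → a :* (x :* b :* t) :+ (a :* z) :* (:- (x :* p) :* t) := a :* (x :* (b :- p :* z) :* t)) refl (𝟙 (az A h)) qh (ĝ A) (ĝ []) (𝟙 (A ==P [])) e[ c , F , A ])) ⟩
        ∑ (polys n) (λ A → 𝟙 (az A h) * (α A * e[ c , F , A ]))
          ≡⟨ ∑-polys-restrict (ℕₚ.m∸n≤m n h) (λ A → az A h) (λ A a e → az-sound h a e) (λ A a → az-complete h a)
               (λ A → α A * e[ c , F , A ]) (λ e → cong₂ _*_ (α-resp e) (e-resp c F e)) ⟩
        ∑ V (λ A → α A * e[ c , F , A ]) ∎
        where
          open ≡-Reasoning
          e-zero : e[ c , F , [] ] ≡ ψ c
          e-zero = cong ψ (trans (cong (c +F_) (trans (lam-resp (*-zeroʳ F)) (at T[]≈[] n))) (F.+-identityʳ c))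
          const-rep : (- (qh * ĝ [])) * ψ c ≡ ∑ (polys n) (λ A → 𝟙 (A ==P []) * (- (qh * ĝ []) * e[ c , F , A ]))
          const-rep = sym (trans (∑-polys-δ n {[]} (λ A → - (qh * ĝ []) * e[ c , F , A ]) (λ e → cong (- (qh * ĝ []) *_) (e-resp c F e)) <°-[])
            (cong (- (qh * ĝ []) *_) e-zero))
          absorb : ∀ A → 𝟙 (A ==P []) ≡ 𝟙 (az A h) * 𝟙 (A ==P [])
          absorb A with A ==P [] in e
          ... | false = sym (ℚₚ.*-zeroʳ (𝟙 (az A h)))
          ... | true = sym (cong (λ b → 𝟙 b * 1ℚ) (az-complete h (<°-resp (≈-sym (==P⇒≈ {A} e)) <°-[])))

      -- Unfolded, the sum of α(A₁) ... α(A_k) over all solutions of A₁ + ... + A_k = -B.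
      conv : ℕ → Pol → ℚ
      conv zero B = 𝟙 (isZeroP B)
      conv (suc k) B = ∑[ A ∈ V ] (α A * conv k (B +P A))

      -- Since `ψ` is not multiplicative, the power is not expanded at once. One factor `f F` is
      -- expanded at a time by `f-rep`, with the shift `lam (F *P B)`, which merges the new
      -- frequency `A` into `B`.
      moment-conv : ∀ k {B} → B <° n → ∑ (polys n) (λ F → f F ^Q k * e[ 0# , F , B ]) ≡ ℕ→ℚ (q ℕ.^ n) * conv k B
      moment-conv zero {B} b = begin
        ∑ (polys n) (λ F → 1ℚ * e[ 0# , F , B ]) ≡⟨ ∑-cong (polys n) (λ F → ℚₚ.*-identityˡ e[ 0# , F , B ]) ⟩
        ∑ (polys n) (λ F → e[ 0# , F , B ]) ≡⟨ ∑-ψ-lam n 0# B ⟩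
        ℕ→ℚ (q ℕ.^ n) * (𝟙 (az B n) * ψ 0#) ≡⟨ cong (ℕ→ℚ (q ℕ.^ n) *_) (trans (cong (𝟙 (az B n) *_) ψ0≡1) (ℚₚ.*-identityʳ (𝟙 (az B n)))) ⟩
        ℕ→ℚ (q ℕ.^ n) * 𝟙 (az B n) ≡⟨ cong (λ t → ℕ→ℚ (q ℕ.^ n) * 𝟙 t) (bool-⇔
          (λ e → ≈[]⇒isZeroP B (<°0⇒≈[] (subst (B <°_) (ℕₚ.n∸n≡0 n) (az-sound n b e))))
          (λ e → az-complete n (<°-resp (≈-sym (isZeroP⇒≈[] B e)) <°-[]))) ⟩
        ℕ→ℚ (q ℕ.^ n) * 𝟙 (isZeroP B) ∎
        where open ≡-Reasoning
      moment-conv (suc k) {B} b = begin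
        ∑ (polys n) (λ F → f F * f F ^Q k * e[ 0# , F , B ])
          ≡⟨ ∑-cong (polys n) (λ F → trans (solve 3 (λ a b c → a :* b :* c := b :* (a :* c)) refl (f F) (f F ^Q k) e[ 0# , F , B ])
               (trans (cong (f F ^Q k *_) (f-rep (0# +F lam (F *P B)) F)) (sym (∑-*ˡ (f F ^Q k) V (λ A → α A * e[ 0# +F lam (F *P B) , F , A ]))))) ⟩
        (∑[ F ∈ polys n ] ∑[ A ∈ V ] (f F ^Q k * (α A * e[ 0# +F lam (F *P B) , F , A ])))
          ≡⟨ ∑-swap (polys n) V (λ F A → f F ^Q k * (α A * e[ 0# +F lam (F *P B) , F , A ])) ⟩
        (∑[ A ∈ V ] ∑[ F ∈ polys n ] (f F ^Q k * (α A * e[ 0# +F lam (F *P B) , F , A ])))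
          ≡⟨ ∑-cong-∈ V (λ {A} m → trans (∑-cong (polys n) (λ F →
                 trans (solve 3 (λ a b c → a :* (b :* c) := b :* (a :* c)) refl (f F ^Q k) (α A) e[ 0# +F lam (F *P B) , F , A ])
                       (cong (λ z → α A * (f F ^Q k * ψ z)) (merge F A))))
               (trans (∑-*ˡ (α A) (polys n) (λ F → f F ^Q k * e[ 0# , F , B +P A ]))
                      (trans (cong (α A *_) (moment-conv k (<°-+ b (<°-mono (ℕₚ.m∸n≤m n h) (polys-bound (n ∸ h) m)))))
                             (solve 3 (λ a b c → a :* (b :* c) := b :* (a :* c)) refl (α A) (ℕ→ℚ (q ℕ.^ n)) (conv k (B +P A)))))) ⟩
        (∑[ A ∈ V ] (ℕ→ℚ (q ℕ.^ n) * (α A * conv k (B +P A))))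
          ≡⟨ ∑-*ˡ (ℕ→ℚ (q ℕ.^ n)) V (λ A → α A * conv k (B +P A)) ⟩
        ℕ→ℚ (q ℕ.^ n) * conv (suc k) B ∎
        where
          open ≡-Reasoning
          merge : ∀ F A → (0# +F lam (F *P B)) +F lam (F *P A) ≡ 0# +F lam (F *P (B +P A))
          merge F A = trans (F.+-assoc 0# (lam (F *P B)) (lam (F *P A))) (cong (0# +F_) (sym (trans (lam-resp (*-distribˡ F B A)) (lam-+ (F *P B) (F *P A)))))

      moment : ∀ k → ∑ (polys n) (λ F → f F ^Q k) ≡ ℕ→ℚ (q ℕ.^ n) * conv k []
      moment k = trans (∑-cong (polys n) (λ F → trans (sym (ℚₚ.*-identityʳ (f F ^Q k))) (cong (f F ^Q k *_) (sym (unit F))))) (moment-conv k <°-[])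
        where
          unit : ∀ F → e[ 0# , F , [] ] ≡ 1ℚ
          unit F = trans (cong ψ (trans (F.+-identityˡ _) (trans (lam-resp (*-zeroʳ F)) (at T[]≈[] n)))) ψ0≡1

    -- Only the frequency 0 survives the sum over all residues; this evaluates φ(Q).
    ∑-g : ∑ (polys n) g ≡ ℕ→ℚ (q ℕ.^ n) * ĝ []
    ∑-g = begin
      ∑ (polys n) g
        ≡⟨ ∑-cong (polys n) (λ F → trans (trans (sym (ℚₚ.*-identityʳ (g F))) (cong (g F *_) (sym ψ0≡1))) (g-rep 0# F)) ⟩
      (∑[ F ∈ polys n ] ∑[ A ∈ polys n ] (ĝ A * e[ 0# , F , A ]))
        ≡⟨ ∑-swap (polys n) (polys n) (λ F A → ĝ A * e[ 0# , F , A ]) ⟩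
      (∑[ A ∈ polys n ] ∑[ F ∈ polys n ] (ĝ A * e[ 0# , F , A ]))
        ≡⟨ ∑-cong (polys n) (λ A → trans (∑-*ˡ (ĝ A) (polys n) (λ F → e[ 0# , F , A ]))
             (trans (cong (ĝ A *_) (trans (∑-ψ-lam n 0# A) (cong (λ z → ℕ→ℚ (q ℕ.^ n) * (𝟙 (az A n) * z)) ψ0≡1)))
                    (solve 3 (λ a b c → a :* (b :* (c :* con 1ℚ)) := c :* (b :* a)) refl (ĝ A) (ℕ→ℚ (q ℕ.^ n)) (𝟙 (az A n))))) ⟩
      (∑[ A ∈ polys n ] (𝟙 (az A n) * (ℕ→ℚ (q ℕ.^ n) * ĝ A)))
        ≡⟨ ∑-polys-restrict z≤n (λ A → az A n) (λ A a e → subst (A <°_) (ℕₚ.n∸n≡0 n) (az-sound n a e))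
             (λ A a → az-complete n (<°-mono z≤n a)) (λ A → ℕ→ℚ (q ℕ.^ n) * ĝ A) (λ e → cong (ℕ→ℚ (q ℕ.^ n) *_) (ĝ-resp e)) ⟩
      ℕ→ℚ (q ℕ.^ n) * ĝ [] + 0ℚ
        ≡⟨ ℚₚ.+-identityʳ (ℕ→ℚ (q ℕ.^ n) * ĝ []) ⟩
      ℕ→ℚ (q ℕ.^ n) * ĝ [] ∎
      where
        open ≡-Reasoning

-- Patterns of two Booleans at each prime, and Euler products over all patterns

Code : Set
Code = Bool × Bool

eqB : Bool → Bool → Bool
eqB true b = b
eqB false b = not b

eqB-sound : ∀ {a b} → eqB a b ≡ true → a ≡ b
eqB-sound {true} {true} _ = refl
eqB-sound {false} {false} _ = refl

eqB-refl : ∀ a → eqB a a ≡ true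
eqB-refl true = refl
eqB-refl false = refl

module _ {P X : Set} where
  open import Data.Rational using (_+_; _*_; _-_; -_; _≤_)
  open +-*-Solver using (solve; _:=_; _:+_; _:*_; _:-_; :-_; con)
  -- All assignments of an admissible code to each prime; summing a product weight over them gives
  -- an Euler product by `∑-keys`.
  keys : (P → List Code) → List P → List (List Code)
  keys opts [] = [] ∷ []
  keys opts (p ∷ ps) = concatMap (λ k → map (k ∷_) (keys opts ps)) (opts p)

  weight : (P → Code → ℚ) → List P → List Code → ℚ
  weight φ (p ∷ ps) (k ∷ κ) = φ p k * weight φ ps κ
  weight φ _ _ = 1ℚ

  ∑-keys : ∀ opts φ ps → ∑ (keys opts ps) (weight φ ps) ≡ (∏[ p ∈ ps ] ∑ (opts p) (φ p))
  ∑-keys opts φ [] = refl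
  ∑-keys opts φ (p ∷ ps) = trans (∑-concatMap (λ k → map (k ∷_) (keys opts ps)) (opts p) (weight φ (p ∷ ps)))
    (trans (∑-cong (opts p) (λ k → trans (∑-map (k ∷_) (keys opts ps) (weight φ (p ∷ ps))) (∑-*ˡ (φ p k) (keys opts ps) (weight φ ps))))
    (trans (∑-*ʳ (∑ (keys opts ps) (weight φ ps)) (opts p) (φ p)) (cong (∑ (opts p) (φ p) *_) (∑-keys opts φ ps))))

  weight-nonneg : ∀ {φ} → (∀ p k → 0ℚ ≤ φ p k) → ∀ ps κ → 0ℚ ≤ weight φ ps κ
  weight-nonneg h [] κ = 0≤1
  weight-nonneg h (p ∷ ps) [] = 0≤1
  weight-nonneg h (p ∷ ps) (k ∷ κ) = 0≤* (h p k) (weight-nonneg h ps κ)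

  module _ (code : X → P → Code) where
    matches : List P → List Code → X → Bool
    matches [] [] x = true
    matches (p ∷ ps) (k ∷ κ) x = (eqB (proj₁ (code x p)) (proj₁ k) ∧ eqB (proj₂ (code x p)) (proj₂ k)) ∧ matches ps κ x
    matches _ _ x = false

    private
      head-eq : ∀ (c k : Code) {b} → (eqB (proj₁ c) (proj₁ k) ∧ eqB (proj₂ c) (proj₂ k)) ∧ b ≡ true → c ≡ k × b ≡ true
      head-eq (c₁ , c₂) (k₁ , k₂) {b} e with eqB c₁ k₁ in e₁ | eqB c₂ k₂ in e₂
      ... | true | true = cong₂ _,_ (eqB-sound e₁) (eqB-sound e₂) , e

    matches-weight : ∀ φ ps κ {x} → matches ps κ x ≡ true → weight φ ps κ ≡ (∏[ p ∈ ps ] φ p (code x p))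
    matches-weight φ [] [] e = refl
    matches-weight φ (p ∷ ps) (k ∷ κ) {x} e with head-eq (code x p) k e
    ... | refl , e′ = cong (φ p k *_) (matches-weight φ ps κ e′)

    matches-same : ∀ ps κ {x y} → matches ps κ x ≡ true → matches ps κ y ≡ true → All (λ p → code x p ≡ code y p) ps
    matches-same [] [] e f = []
    matches-same (p ∷ ps) (k ∷ κ) {x} {y} e f with head-eq (code x p) k e | head-eq (code y p) k f
    ... | c , e′ | d , f′ = trans c (sym d) ∷ matches-same ps κ e′ f′

    matches-exists : ∀ opts ps x → (∀ p → code x p ∈ opts p) → ∃ λ κ → κ ∈ keys opts ps × matches ps κ x ≡ true
    matches-exists opts [] x h = [] , here refl , refl
    matches-exists opts (p ∷ ps) x h with matches-exists opts ps x h
    ... | κ , m , e = code x p ∷ κ ,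
      ∈ₚ.∈-concatMap⁺ (λ k → map (k ∷_) (keys opts ps)) (Any.map (λ { refl → ∈ₚ.∈-map⁺ (_ ∷_) m }) (h p)) ,
      cong₂ _∧_ (cong₂ _∧_ (eqB-refl (proj₁ (code x p))) (eqB-refl (proj₂ (code x p)))) e

-- Separates the empty classes from those with a representative, relative to which the members are
-- counted.
some-or-none : ∀ {A : Set} (xs : List A) (b : A → Bool) → (∃ λ x → x ∈ xs × b x ≡ true) ⊎ (∀ {x} → x ∈ xs → b x ≡ false)
some-or-none [] b = inj₂ λ ()
some-or-none (x ∷ xs) b with b x in eq
... | true = inj₁ (x , here refl , eq)
... | false with some-or-none xs b
...   | inj₁ (y , m , e) = inj₁ (y , there m , e)
...   | inj₂ none = inj₂ λ { (here refl) → eq ; (there m) → none m }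

-- Local weights and bounds for generalised divisor functions

module Weights (𝔽 : FiniteField) where
  open import Data.Rational using (_+_; _*_; _-_; -_; _≤_)
  open +-*-Solver using (solve; _:=_; _:+_; _:*_; _:-_; :-_; con)
  open PolyRing 𝔽
  open Divisibility 𝔽
  open Enumeration 𝔽
  open Duality 𝔽

  Nmℚ : Prm → ℚ
  Nmℚ p = ℕ→ℚ (Nm p)

  -- x p = 1 / φ(p) and y p = |p| / φ(p)
  x y : Prm → ℚ
  x p = inv (Nm p ∸ 1)
  y p = 1ℚ + x p

  x-nonneg : ∀ p → 0ℚ ≤ x p
  x-nonneg p = inv-nonneg (Nm p ∸ 1)

  1≤y : ∀ p → 1ℚ ≤ y p
  1≤y p = a≤a+b 1ℚ (x-nonneg p)

  y-nonneg : ∀ p → 0ℚ ≤ y p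
  y-nonneg p = ℚₚ.≤-trans 0≤1 (1≤y p)

  1≤Nm∸1 : ∀ p → 1 ℕ.≤ Nm p ∸ 1
  1≤Nm∸1 p = ℕₚ.∸-monoˡ-≤ 1 (2≤Nm p)

  Nmℚ-pred : ∀ p → Nmℚ p ≡ ℕ→ℚ (Nm p ∸ 1) + 1ℚ
  Nmℚ-pred p = trans (cong ℕ→ℚ (sym (ℕₚ.m∸n+n≡m (1≤q^ (dg p))))) (ℕ→ℚ-+ (Nm p ∸ 1) 1)

  x-inverse : ∀ p → ℕ→ℚ (Nm p ∸ 1) * x p ≡ 1ℚ
  x-inverse p = inv-inverseʳ (1≤Nm∸1 p)

  Nm-x : ∀ p → Nmℚ p * x p ≡ y p
  Nm-x p = begin
    Nmℚ p * x p ≡⟨ cong (_* x p) (Nmℚ-pred p) ⟩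
    (ℕ→ℚ (Nm p ∸ 1) + 1ℚ) * x p ≡⟨ solve 2 (λ m x → (m :+ con 1ℚ) :* x := m :* x :+ x) refl (ℕ→ℚ (Nm p ∸ 1)) (x p) ⟩
    ℕ→ℚ (Nm p ∸ 1) * x p + x p ≡⟨ cong (_+ x p) (x-inverse p) ⟩
    y p ∎
    where open ≡-Reasoning

  y-inverse : ∀ p → y p * (1ℚ - inv (Nm p)) ≡ 1ℚ
  y-inverse p = begin
    y p * (1ℚ - inv (Nm p)) ≡⟨ cong (_* (1ℚ - inv (Nm p))) (Nm-x p) ⟨
    Nmℚ p * x p * (1ℚ - inv (Nm p)) ≡⟨ solve 3 (λ m x i → m :* x :* (con 1ℚ :- i) := (m :- m :* i) :* x) refl (Nmℚ p) (x p) (inv (Nm p)) ⟩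
    (Nmℚ p - Nmℚ p * inv (Nm p)) * x p ≡⟨ cong₂ (λ a b → (a - b) * x p) (Nmℚ-pred p) (Nm-inv p) ⟩
    (ℕ→ℚ (Nm p ∸ 1) + 1ℚ - 1ℚ) * x p ≡⟨ solve 2 (λ m x → (m :+ con 1ℚ :- con 1ℚ) :* x := m :* x) refl (ℕ→ℚ (Nm p ∸ 1)) (x p) ⟩
    ℕ→ℚ (Nm p ∸ 1) * x p ≡⟨ x-inverse p ⟩
    1ℚ ∎
    where open ≡-Reasoning

  x≤1 : ∀ p → x p ≤ 1ℚ
  x≤1 p = subst₂ _≤_ (ℚₚ.*-identityˡ (x p)) (x-inverse p) (*-monoˡ (x-nonneg p) (1≤ℕ→ℚ (1≤Nm∸1 p)))

  y≤2 : ∀ p → y p ≤ ℕ→ℚ 2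
  y≤2 p = ℚₚ.+-monoʳ-≤ 1ℚ (x≤1 p)

  -- the local weights produced by k successive extensions
  ω : ℕ → Prm → ℚ
  ω zero p = x p
  ω (suc k) p = x p + (1ℚ + y p) * ω k p

  ω-nonneg : ∀ k p → 0ℚ ≤ ω k p
  ω-nonneg zero p = x-nonneg p
  ω-nonneg (suc k) p = 0≤+ (x-nonneg p) (0≤* (0≤+ 0≤1 (y-nonneg p)) (ω-nonneg k p))

  -- In terms of Y = y^(2^(k+1)) the induction step is (Y - 1) (Y - y) ≥ 0.
  ω-growth : ∀ k p → 1ℚ + x p + y p * ω k p ≤ y p ^Q (2 ℕ.^ suc k)
  ω-growth zero p = ℚₚ.≤-reflexive (solve 1 (λ x → con 1ℚ :+ x :+ (con 1ℚ :+ x) :* x := (con 1ℚ :+ x) :* ((con 1ℚ :+ x) :* con 1ℚ)) refl (x p))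
  ω-growth (suc k) p = begin
    1ℚ + x p + y p * (x p + (1ℚ + y p) * ω k p)
      ≡⟨ solve 2 (λ x o → con 1ℚ :+ x :+ (con 1ℚ :+ x) :* (x :+ (con 1ℚ :+ (con 1ℚ :+ x)) :* o)
           := (con 1ℚ :+ (con 1ℚ :+ x)) :* (con 1ℚ :+ x :+ (con 1ℚ :+ x) :* o) :- (con 1ℚ :+ x)) refl (x p) (ω k p) ⟩
    (1ℚ + y p) * (1ℚ + x p + y p * ω k p) - y p
      ≤⟨ ℚₚ.+-monoˡ-≤ (- y p) (*-monoʳ (0≤+ 0≤1 (y-nonneg p)) (ω-growth k p)) ⟩
    (1ℚ + y p) * Y - y p
      ≤⟨ 0≤-⇒≤ (subst (0ℚ ≤_) (solve 2 (λ Y y → (Y :- con 1ℚ) :* (Y :- y) := Y :* Y :- ((con 1ℚ :+ y) :* Y :- y)) refl Y (y p))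
           (0≤* (≤⇒0≤- (ℚₚ.≤-trans (1≤y p) y≤Y)) (≤⇒0≤- y≤Y))) ⟩
    Y * Y
      ≡⟨ trans (cong (y p ^Q_) (cong (2 ℕ.^ suc k ℕ.+_) (ℕₚ.+-identityʳ (2 ℕ.^ suc k)))) (^Q-+ (y p) (2 ℕ.^ suc k) (2 ℕ.^ suc k)) ⟨
    y p ^Q (2 ℕ.^ suc (suc k)) ∎
    where
      open ℚₚ.≤-Reasoning
      Y : ℚ
      Y = y p ^Q (2 ℕ.^ suc k)
      y≤Y : y p ≤ Y
      y≤Y = subst (_≤ Y) (ℚₚ.*-identityʳ (y p)) (^Q-monoʳ {m = 1} (1≤y p) (ℕₚ.m^n>0 2 (suc k)))

  -- c k bounds |p| x ω_k |p| = y (|p| ω_k).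
  c : ℕ → ℕ
  c zero = 2
  c (suc k) = 2 ℕ.+ 3 ℕ.* c k

  -- From |p| x = y ≤ 2, the recursion for `ω` gives the bound 2 + (1 + 2) c_k at the next index.
  Nm-ω≤c : ∀ k p → Nmℚ p * ω k p ≤ ℕ→ℚ (c k)
  Nm-ω≤c zero p = subst (_≤ ℕ→ℚ 2) (sym (Nm-x p)) (y≤2 p)
  Nm-ω≤c (suc k) p = begin
    Nmℚ p * (x p + (1ℚ + y p) * ω k p)
      ≡⟨ solve 4 (λ m x y o → m :* (x :+ (con 1ℚ :+ y) :* o) := m :* x :+ (con 1ℚ :+ y) :* (m :* o)) refl (Nmℚ p) (x p) (y p) (ω k p) ⟩
    Nmℚ p * x p + (1ℚ + y p) * (Nmℚ p * ω k p)
      ≤⟨ ℚₚ.+-mono-≤ (subst (_≤ ℕ→ℚ 2) (sym (Nm-x p)) (y≤2 p))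
           (*-mono-≤ (0≤+ 0≤1 (y-nonneg p)) (ℚₚ.+-monoʳ-≤ 1ℚ (y≤2 p)) (0≤* (ℕ→ℚ-nonneg (Nm p)) (ω-nonneg k p)) (Nm-ω≤c k p)) ⟩
    ℕ→ℚ 2 + ℕ→ℚ 3 * ℕ→ℚ (c k)
      ≡⟨ trans (ℕ→ℚ-+ 2 (3 ℕ.* c k)) (cong (ℕ→ℚ 2 +_) (ℕ→ℚ-* 3 (c k))) ⟨
    ℕ→ℚ (c (suc k)) ∎
    where open ℚₚ.≤-Reasoning

  -- A generalised divisor function: `a` to the number of chosen primes.
  powIf : ℕ → (Prm → Bool) → List Prm → ℕ
  powIf a b [] = 1
  powIf a b (p ∷ ps) = if b p then a ℕ.* powIf a b ps else powIf a b ps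

  countIf : (Prm → Bool) → List Prm → ℕ
  countIf b [] = 0
  countIf b (p ∷ ps) = if b p then suc (countIf b ps) else countIf b ps

  powIf-countIf : ∀ a b ps → powIf a b ps ≡ a ℕ.^ countIf b ps
  powIf-countIf a b [] = refl
  powIf-countIf a b (p ∷ ps) with b p
  ... | true = cong (a ℕ.*_) (powIf-countIf a b ps)
  ... | false = powIf-countIf a b ps

  isSmall : ℕ → Prm → Bool
  isSmall L p = dg p ℕ.<ᵇ L

  countIf-split : ∀ b L ps → countIf b ps ℕ.≤ countIf (isSmall L) ps ℕ.+ countIf (λ p → b p ∧ not (isSmall L p)) ps
  countIf-split b L [] = z≤n
  countIf-split b L (p ∷ ps) with b p | isSmall L p
  ... | true | true = s≤s (countIf-split b L ps)
  ... | true | false = subst (suc (countIf b ps) ℕ.≤_) (sym (ℕₚ.+-suc _ _)) (s≤s (countIf-split b L ps))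
  ... | false | true = ℕₚ.m≤n⇒m≤1+n (countIf-split b L ps)
  ... | false | false = countIf-split b L ps

  countIf-large : ∀ b L ps → countIf (λ p → b p ∧ not (isSmall L p)) ps ℕ.* L ℕ.≤ degIf b ps
  countIf-large b L [] = z≤n
  countIf-large b L (p ∷ ps) with b p | isSmall L p in eq
  ... | true | true = ℕₚ.≤-trans (countIf-large b L ps) (ℕₚ.m≤n+m _ (dg p))
  ... | true | false = ℕₚ.+-mono-≤ (ℕₚ.≮⇒≥ (λ lt → case trans (sym eq) (T⇒true (ℕₚ.<⇒<ᵇ lt)) of λ ())) (countIf-large b L ps)
  ... | false | _ = countIf-large b L ps

  countIf-small : ∀ L {ps} → Apart ps → ℕ→ℚ (countIf (isSmall L) ps) ≤ ℕ→ℚ (q ℕ.^ L)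
  countIf-small L {ps} ap = subst (_≤ ℕ→ℚ (q ℕ.^ L)) (sym (as-sum ps)) (count-injective ps (isSmall L) poly L
      (AllPairs.map (λ ¬d → λ { refl → ¬d ∣-refl }) ap)
      (λ {p} _ e → <°-mono (ℕₚ.<ᵇ⇒< (dg p) L (true⇒T e)) (bound (monic p)))
      (λ m m′ _ _ e → inj m m′ ap e))
    where
      as-sum : ∀ rs → ℕ→ℚ (countIf (isSmall L) rs) ≡ ∑ rs (λ p → 𝟙 (isSmall L p))
      as-sum [] = refl
      as-sum (r ∷ rs) with isSmall L r
      ... | true = trans (ℕ→ℚ-+ 1 (countIf (isSmall L) rs)) (cong (1ℚ +_) (as-sum rs))
      ... | false = trans (as-sum rs) (sym (ℚₚ.+-identityˡ (∑ rs (λ p → 𝟙 (isSmall L p)))))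
      inj : ∀ {p r rs} → p ∈ rs → r ∈ rs → Apart rs → poly p ≈ poly r → p ≡ r
      inj (here refl) (here refl) _ e = refl
      inj (here refl) (there m) (h ∷ _) e = ⊥-elim (All.lookup h m (∣-resp (≈-sym e) ∣-refl))
      inj (there m) (here refl) (h ∷ _) e = ⊥-elim (All.lookup h m (∣-resp e ∣-refl))
      inj (there m) (there m′) (_ ∷ hs) e = inj m m′ hs e

  a≤q^a : ∀ a → a ℕ.≤ q ℕ.^ a
  a≤q^a zero = z≤n
  a≤q^a (suc a) = begin
    suc a ≤⟨ s≤s (a≤q^a a) ⟩
    1 ℕ.+ q ℕ.^ a ≤⟨ ℕₚ.+-monoˡ-≤ (q ℕ.^ a) (1≤q^ a) ⟩
    q ℕ.^ a ℕ.+ q ℕ.^ a ≡⟨ cong (q ℕ.^ a ℕ.+_) (ℕₚ.+-identityʳ (q ℕ.^ a)) ⟨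
    2 ℕ.* q ℕ.^ a ≤⟨ ℕₚ.*-monoˡ-≤ (q ℕ.^ a) 2≤q ⟩
    q ℕ.^ suc a ∎
    where open ℕₚ.≤-Reasoning

  q-nonZero : ℕ.NonZero q
  q-nonZero = ℕ.>-nonZero (ℕₚ.≤-trans (s≤s z≤n) 2≤q)

  q^-mono : ∀ {a b} → a ℕ.≤ b → q ℕ.^ a ℕ.≤ q ℕ.^ b
  q^-mono = ℕₚ.^-monoʳ-≤ q {{q-nonZero}}

  -- Primes of degree ≥ (s+1)a number at most h / ((s+1)a); the remaining ones are boundedly many.
  powIf-bound : ∀ a′ s → let a = suc a′ in ∀ {ps} → Apart ps → ∀ b {h} → degIf b ps ℕ.≤ h →
                powIf a b ps ℕ.≤ a ℕ.^ (q ℕ.^ (suc s ℕ.* a)) ℕ.* q ℕ.^ (h / suc s)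
  powIf-bound a′ s {ps} ap b {h} dh = begin
    powIf a b ps ≡⟨ powIf-countIf a b ps ⟩
    a ℕ.^ countIf b ps ≤⟨ ℕₚ.^-monoʳ-≤ a (ℕₚ.≤-trans (countIf-split b L ps) (ℕₚ.+-mono-≤ small large)) ⟩
    a ℕ.^ (q ℕ.^ L ℕ.+ h / L) ≡⟨ ℕₚ.^-distribˡ-+-* a (q ℕ.^ L) (h / L) ⟩
    a ℕ.^ (q ℕ.^ L) ℕ.* a ℕ.^ (h / L) ≤⟨ ℕₚ.*-monoʳ-≤ (a ℕ.^ (q ℕ.^ L)) (begin
      a ℕ.^ (h / L) ≤⟨ ℕₚ.^-monoˡ-≤ (h / L) (a≤q^a a) ⟩
      (q ℕ.^ a) ℕ.^ (h / L) ≡⟨ ℕₚ.^-*-assoc q a (h / L) ⟩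
      q ℕ.^ (a ℕ.* (h / L)) ≤⟨ q^-mono (begin
        a ℕ.* (h / L) ≡⟨ cong (a ℕ.*_) (m/n/o≡m/[n*o] h (suc s) a) ⟨
        a ℕ.* ((h / suc s) / a) ≡⟨ ℕₚ.*-comm a _ ⟩
        ((h / suc s) / a) ℕ.* a ≤⟨ m/n*n≤m (h / suc s) a ⟩
        h / suc s ∎) ⟩
      q ℕ.^ (h / suc s) ∎) ⟩
    a ℕ.^ (q ℕ.^ L) ℕ.* q ℕ.^ (h / suc s) ∎
    where
      open ℕₚ.≤-Reasoning
      a L : ℕ
      a = suc a′
      L = suc s ℕ.* a
      small : countIf (isSmall L) ps ℕ.≤ q ℕ.^ L
      small = ℕ→ℚ-cancel-≤ (countIf-small L ap)
      large : countIf (λ p → b p ∧ not (isSmall L p)) ps ℕ.≤ h / L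
      large = subst (ℕ._≤ h / L) (m*n/n≡m (countIf (λ p → b p ∧ not (isSmall L p)) ps) L) (/-monoˡ-≤ L (ℕₚ.≤-trans (countIf-large b L ps) dh))

-- Decompositions of a fraction into two fractions of small norm

module Extension (𝔽 : FiniteField) where
  open import Data.Rational using (_+_; _*_; _-_; -_; _≤_)
  open +-*-Solver using (solve; _:=_; _:+_; _:*_; _:-_; :-_; con)
  open PolyRing 𝔽
  open Divisibility 𝔽
  open Enumeration 𝔽
  open Duality 𝔽
  open Weights 𝔽

  ind : Bool → ℕ
  ind true = 1
  ind false = 0

  -- The degree with multiplicities `u p`; it reduces identities between degrees of products to
  -- identities at a single prime.
  sumdeg : (Prm → ℕ) → List Prm → ℕ
  sumdeg u [] = 0
  sumdeg u (p ∷ ps) = u p ℕ.* dg p ℕ.+ sumdeg u ps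

  sumdeg-+ : ∀ u v ps → sumdeg (λ p → u p ℕ.+ v p) ps ≡ sumdeg u ps ℕ.+ sumdeg v ps
  sumdeg-+ u v [] = refl
  sumdeg-+ u v (p ∷ ps) = trans (cong₂ ℕ._+_ (ℕₚ.*-distribʳ-+ (dg p) (u p) (v p)) (sumdeg-+ u v ps))
    (ℕ-interchange (u p ℕ.* dg p) (v p ℕ.* dg p) (sumdeg u ps) (sumdeg v ps))
    where open import Algebra.Properties.CommutativeSemigroup ℕₚ.+-commutativeSemigroup using () renaming (interchange to ℕ-interchange)

  degIf-sumdeg : ∀ b ps → degIf b ps ≡ sumdeg (ind ∘ b) ps
  degIf-sumdeg b [] = refl
  degIf-sumdeg b (p ∷ ps) with b p
  ... | true = cong₂ ℕ._+_ (sym (ℕₚ.+-identityʳ (dg p))) (degIf-sumdeg b ps)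
  ... | false = degIf-sumdeg b ps

  sumdeg-cong : ∀ {u v} → (∀ p → u p ≡ v p) → ∀ ps → sumdeg u ps ≡ sumdeg v ps
  sumdeg-cong e [] = refl
  sumdeg-cong e (p ∷ ps) = cong₂ (λ s t → s ℕ.* dg p ℕ.+ t) (e p) (sumdeg-cong e ps)

  degIf-+ : ∀ b b₁ b₂ → (∀ p → ind (b p) ≡ ind (b₁ p) ℕ.+ ind (b₂ p)) → ∀ ps → degIf b ps ≡ degIf b₁ ps ℕ.+ degIf b₂ ps
  degIf-+ b b₁ b₂ e ps = begin
    degIf b ps ≡⟨ degIf-sumdeg b ps ⟩
    sumdeg (ind ∘ b) ps ≡⟨ sumdeg-cong e ps ⟩
    sumdeg (λ p → ind (b₁ p) ℕ.+ ind (b₂ p)) ps ≡⟨ sumdeg-+ (ind ∘ b₁) (ind ∘ b₂) ps ⟩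
    sumdeg (ind ∘ b₁) ps ℕ.+ sumdeg (ind ∘ b₂) ps ≡⟨ cong₂ ℕ._+_ (degIf-sumdeg b₁ ps) (degIf-sumdeg b₂ ps) ⟨
    degIf b₁ ps ℕ.+ degIf b₂ ps ∎
    where open ≡-Reasoning

  degIf-cong : ∀ {b b′} → (∀ p → b p ≡ b′ p) → ∀ ps → degIf b ps ≡ degIf b′ ps
  degIf-cong e [] = refl
  degIf-cong {b} {b′} e (p ∷ ps) with b p | b′ p | e p
  ... | true | _ | refl = cong (dg p ℕ.+_) (degIf-cong e ps)
  ... | false | _ | refl = degIf-cong e ps

  degIf-cong-All : ∀ {b b′ ps} → All (λ p → b p ≡ b′ p) ps → degIf b ps ≡ degIf b′ ps
  degIf-cong-All [] = refl
  degIf-cong-All {b} {b′} {p ∷ ps} (e ∷ es) with b p | b′ p | e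
  ... | true | _ | refl = cong (dg p ℕ.+_) (degIf-cong-All es)
  ... | false | _ | refl = degIf-cong-All es

  degIf-not : ∀ b ps → degIf b ps ℕ.+ degIf (not ∘ b) ps ≡ degAll ps
  degIf-not b ps = sym (degIf-+ (λ _ → true) b (not ∘ b) (λ p → lem (b p)) ps)
    where
      lem : ∀ t → 1 ≡ ind t ℕ.+ ind (not t)
      lem true = refl
      lem false = refl

  ∏-Nm : ∀ b ps → (∏[ p ∈ ps ] (if b p then Nmℚ p else 1ℚ)) ≡ ℕ→ℚ (q ℕ.^ degIf b ps)
  ∏-Nm b [] = refl
  ∏-Nm b (p ∷ ps) with b p
  ... | true = trans (cong (Nmℚ p *_) (∏-Nm b ps))
    (sym (trans (cong ℕ→ℚ (ℕₚ.^-distribˡ-+-* q (dg p) (degIf b ps))) (ℕ→ℚ-* (Nm p) (q ℕ.^ degIf b ps))))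
  ... | false = trans (ℚₚ.*-identityˡ _) (∏-Nm b ps)

  ∏-powIf : ∀ a b ps → (∏[ p ∈ ps ] (if b p then ℕ→ℚ a else 1ℚ)) ≡ ℕ→ℚ (powIf a b ps)
  ∏-powIf a b [] = refl
  ∏-powIf a b (p ∷ ps) with b p
  ... | true = trans (cong (ℕ→ℚ a *_) (∏-powIf a b ps)) (sym (ℕ→ℚ-* a (powIf a b ps)))
  ... | false = trans (ℚₚ.*-identityˡ _) (∏-powIf a b ps)

  coeff-drop : ∀ e A i → coeff (drop e A) i ≡ coeff A (e ℕ.+ i)
  coeff-drop zero A i = refl
  coeff-drop (suc e) [] i = refl
  coeff-drop (suc e) (x ∷ A) i = coeff-drop e A i

  <°-drop : ∀ e {A m} → A <° m → drop e A <° m ∸ e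
  <°-drop e {A} {m} a = bd λ i le → trans (coeff-drop e A i) (vanish a (e ℕ.+ i) (ℕₚ.≤-trans (ℕₚ.m≤n+m∸n m e) (ℕₚ.+-monoʳ-≤ e le)))

  -- Combined with `few-divisors`, this makes `drop e` injective wherever differences are divisible
  -- by primes of total degree `e`.
  drop-≈ : ∀ e {A B} → drop e A ≈ drop e B → A -P B <° e
  drop-≈ e {A} {B} eq = bd λ i e≤i → begin
    coeff (A -P B) i ≡⟨ coeff-+ A (-P B) i ⟩
    coeff A i +F coeff (-P B) i ≡⟨ cong (coeff A i +F_) (coeff-neg B i) ⟩
    coeff A i +F -F coeff B i ≡⟨ cong (λ z → coeff A i +F -F z) (same i e≤i) ⟨
    coeff A i +F -F coeff A i ≡⟨ F.-‿inverseʳ (coeff A i) ⟩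
    0# ∎
    where
      open ≡-Reasoning
      same : ∀ i → e ℕ.≤ i → coeff A i ≡ coeff B i
      same i e≤i = subst (λ k → coeff A k ≡ coeff B k) (ℕₚ.m+[n∸m]≡n e≤i)
        (trans (sym (coeff-drop e A (i ∸ e))) (trans (at eq (i ∸ e)) (coeff-drop e B (i ∸ e))))

  -- the constant of powIf-bound, for the base 2 c_k + 1 that dominates y (|p| ω_k)
  Mconst : ℕ → ℕ → ℕ
  Mconst k s = suc (2 ℕ.* c k) ℕ.^ (q ℕ.^ (suc s ℕ.* suc (2 ℕ.* c k)))

  module Sum (ps : List Prm) (apart : Apart ps) (h : ℕ) (h≤n : h ℕ.≤ degAll ps) where
    open Expansion ps apart using (n) public
    open Expansion.Window ps apart h using (V; qh) public

    -- A polynomial A stands for the fraction A / Q; the primes not dividing A are those of its reduced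
    -- denominator, and d A is the degree of that denominator.
    d : Pol → ℕ
    d A = degIf (λ p → not (dvd p A)) ps

    d-resp : ∀ {A B} → A ≈ B → d A ≡ d B
    d-resp e = degIf-cong (λ p → cong not (dvd-resp p e)) ps

    -- The primes dividing a nonzero `A` of degree < n - h have total degree < n - h, which leaves
    -- more than h for the denominator.
    h<d : ∀ {A} → A <° n ∸ h → ¬ (A ≈ []) → h ℕ.< d A
    h<d {A} a ne = ℕₚ.+-cancelˡ-< (degIf (λ p → dvd p A) ps) h (d A)
      (subst (degIf (λ p → dvd p A) ps ℕ.+ h ℕ.<_) (sym (degIf-not (λ p → dvd p A) ps)) few)
      where
        few : degIf (λ p → dvd p A) ps ℕ.+ h ℕ.< n
        few with n ∸ h ℕ.≤? degIf (λ p → dvd p A) ps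
        ... | yes le = ⊥-elim (ne (few-divisors (λ p → dvd p A) apart (All.universal (λ p → dvd⇒∣ p {A}) ps) (<°-mono le a)))
        ... | no ¬le = subst (degIf (λ p → dvd p A) ps ℕ.+ h ℕ.<_) (ℕₚ.m∸n+n≡m h≤n) (ℕₚ.+-monoˡ-< h (ℕₚ.≰⇒> ¬le))

    d-zero : ∀ {A} → A ≈ [] → d A ≡ 0
    d-zero {A} e = go ps
      where
        go : ∀ rs → degIf (λ p → not (dvd p A)) rs ≡ 0
        go [] = refl
        go (r ∷ rs) rewrite ∣⇒dvd r {A} (∣-0 e) = go rs

    -- A multiplicative function of the denominator of A / Q; for k = 0 it is 1/φ of the
    -- denominator.
    w : ℕ → Pol → ℚ
    w k A = ∏[ p ∈ ps ] (if dvd p A then 1ℚ else ω k p)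

    w-resp : ∀ k {A B} → A ≈ B → w k A ≡ w k B
    w-resp k e = ∏-cong ps (λ p → cong (λ b → if b then 1ℚ else ω k p) (dvd-resp p e))

    if-nonneg : ∀ b {s t} → 0ℚ ≤ s → 0ℚ ≤ t → 0ℚ ≤ (if b then s else t)
    if-nonneg true hs ht = hs
    if-nonneg false hs ht = ht

    w-nonneg : ∀ k A → 0ℚ ≤ w k A
    w-nonneg k A = ∏-nonneg ps (λ p → if-nonneg (dvd p A) 0≤1 (ω-nonneg k p))

    Z : ℚ
    Z = ∏[ p ∈ ps ] y p

    M₀ : ℕ → ℕ → ℕ
    M₀ s k = Mconst k s ℕ.* q ℕ.^ (h / suc s)

    K : ℕ → ℕ → ℚ
    K s k = Z ^Q (2 ℕ.^ suc k) + ℕ→ℚ (suc h ℕ.* M₀ s k)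

    module Triple (θ : Pol) where
      z : Prm → Bool
      z p = dvd p θ

      -- The decomposition is θ = (θ + A) - A; the code records which of the two numerators p
      -- divides.
      code : Pol → Prm → Code
      code A p = dvd p A , dvd p (θ +P A)

      -- A prime dividing two of θ, A, θ + A divides the third, which leaves five of the eight
      -- patterns.
      data Shape : Bool → Bool → Bool → Set where
        ttt : Shape true true true
        tff : Shape true false false
        ftf : Shape false true false
        fft : Shape false false true
        fff : Shape false false false

      shape : ∀ A p → Shape (z p) (dvd p A) (dvd p (θ +P A))
      shape A p with dvd p θ in e₁ | dvd p A in e₂ | dvd p (θ +P A) in e₃
      ... | true | true | true = ttt
      ... | true | false | false = tff
      ... | false | true | false = ftf
      ... | false | false | true = fft
      ... | false | false | false = fff
      ... | true | true | false = case trans (sym (∣⇒dvd p {θ +P A} (∣-+ (dvd⇒∣ p {θ} e₁) (dvd⇒∣ p {A} e₂)))) e₃ of λ ()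
      ... | true | false | true = case trans (sym (∣⇒dvd p {A} (∣-+-cancelʳ (∣-resp (+-comm θ A) (dvd⇒∣ p {θ +P A} e₃)) (dvd⇒∣ p {θ} e₁)))) e₂ of λ ()
      ... | false | true | true = case trans (sym (∣⇒dvd p {θ} (∣-+-cancelʳ (dvd⇒∣ p {θ +P A} e₃) (dvd⇒∣ p {A} e₂)))) e₁ of λ ()

      ff : Code → Bool
      ff (a , b) = not a ∧ not b

      -- G: the primes common to the denominators of A / Q and (θ + A) / Q; among these, those of
      -- the denominator of θ / Q form S and the others B.
      bB bS bG : Pol → Prm → Bool
      bB A p = z p ∧ not (dvd p A)
      bS A p = not (z p) ∧ ff (code A p)
      bG A p = ff (code A p)

      -- By `d-triple`, `t` is the excess of the degrees of the two denominators over that of θ / Q: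
      -- a prime of B counts twice, a prime of S once.
      gcd-deg t : Pol → ℕ
      gcd-deg A = degIf (bG A) ps
      t A = degIf (bB A) ps ℕ.+ gcd-deg A

      gcd-split : ∀ A → gcd-deg A ≡ degIf (bB A) ps ℕ.+ degIf (bS A) ps
      gcd-split A = degIf-+ (bG A) (bB A) (bS A) (λ p → lem (shape A p)) ps
        where
          lem : ∀ {z a b} → Shape z a b → ind (not a ∧ not b) ≡ ind (z ∧ not a) ℕ.+ ind (not z ∧ (not a ∧ not b))
          lem ttt = refl
          lem tff = refl
          lem ftf = refl
          lem fft = refl
          lem fff = refl

      d-triple : ∀ A → d A ℕ.+ d (θ +P A) ≡ d θ ℕ.+ t A
      d-triple A = begin
        d A ℕ.+ d (θ +P A) ≡⟨ cong₂ ℕ._+_ (degIf-sumdeg (λ p → not (dvd p A)) ps) (degIf-sumdeg (λ p → not (dvd p (θ +P A))) ps) ⟩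
        sumdeg iA ps ℕ.+ sumdeg iC ps ≡⟨ sumdeg-+ iA iC ps ⟨
        sumdeg (λ p → iA p ℕ.+ iC p) ps ≡⟨ sumdeg-cong (λ p → lem (shape A p)) ps ⟩
        sumdeg (λ p → iθ p ℕ.+ (ind (bB A p) ℕ.+ ind (bG A p))) ps ≡⟨ sumdeg-+ iθ (λ p → ind (bB A p) ℕ.+ ind (bG A p)) ps ⟩
        sumdeg iθ ps ℕ.+ sumdeg (λ p → ind (bB A p) ℕ.+ ind (bG A p)) ps ≡⟨ cong (sumdeg iθ ps ℕ.+_) (sumdeg-+ (ind ∘ bB A) (ind ∘ bG A) ps) ⟩
        sumdeg iθ ps ℕ.+ (sumdeg (ind ∘ bB A) ps ℕ.+ sumdeg (ind ∘ bG A) ps)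
          ≡⟨ cong₂ ℕ._+_ (degIf-sumdeg (λ p → not (z p)) ps) (cong₂ ℕ._+_ (degIf-sumdeg (bB A) ps) (degIf-sumdeg (bG A) ps)) ⟨
        d θ ℕ.+ t A ∎
        where
          open ≡-Reasoning
          iA iC iθ : Prm → ℕ
          iA p = ind (not (dvd p A))
          iC p = ind (not (dvd p (θ +P A)))
          iθ p = ind (not (z p))
          lem : ∀ {z a b} → Shape z a b → ind (not a) ℕ.+ ind (not b) ≡ ind (not z) ℕ.+ (ind (z ∧ not a) ℕ.+ ind (not a ∧ not b))
          lem ttt = refl
          lem tff = refl
          lem ftf = refl
          lem fft = refl
          lem fff = refl

      -- Outside G, p divides both `A` and `B`, or both θ + A and θ + B.
      difference : ∀ {A B} p → code A p ≡ code B p → ff (code A p) ≡ false → poly p ∣ A -P B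
      difference {A} {B} p e f with dvd p A in a | dvd p (θ +P A) in b
      ... | true | _ = ∣-sub (dvd⇒∣ p {A} a) (dvd⇒∣ p {B} (sym (cong proj₁ e)))
      ... | false | true = ∣-resp (≈-trans (+-cong (≈-refl {θ +P A}) (≈-sym (-‿+-comm θ B))) (≈-trans (+-interchange θ A (-P θ) (-P B))
              (+-cong (neg-inverseʳ θ) ≈-refl))) (∣-sub (dvd⇒∣ p {θ +P A} b) (dvd⇒∣ p {θ +P B} (sym (cong proj₂ e))))
        where open import Algebra.Properties.AbelianGroup PR.+-abelianGroup using () renaming (⁻¹-∙-comm to -‿+-comm)

      module _ (k : ℕ) where
        wt : Prm → Code → ℚ
        wt p (a , b) = (if a then 1ℚ else x p) * (if b then 1ℚ else ω k p)

        wt-nonneg : ∀ p κ → 0ℚ ≤ wt p κ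
        wt-nonneg p (a , b) = 0≤* (if-nonneg a 0≤1 (x-nonneg p)) (if-nonneg b 0≤1 (ω-nonneg k p))

        w*w : ∀ A → w 0 A * w k (θ +P A) ≡ (∏[ p ∈ ps ] wt p (code A p))
        w*w A = sym (∏-* ps (λ p → if dvd p A then 1ℚ else x p) (λ p → if dvd p (θ +P A) then 1ℚ else ω k p))

        w*w-nonneg : ∀ A → 0ℚ ≤ w 0 A * w k (θ +P A)
        w*w-nonneg A = 0≤* (w-nonneg 0 A) (w-nonneg k (θ +P A))

        opts : Prm → List Code
        opts p = if z p then (true , true) ∷ (false , false) ∷ [] else (true , false) ∷ (false , true) ∷ (false , false) ∷ []

        code-∈ : ∀ A p → code A p ∈ opts p
        code-∈ A p = go (shape A p)
          where
            go : ∀ {z a b} → Shape z a b → (a , b) ∈ (if z then (true , true) ∷ (false , false) ∷ [] else (true , false) ∷ (false , true) ∷ (false , false) ∷ [])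
            go ttt = here refl
            go tff = there (here refl)
            go ftf = here refl
            go fft = there (here refl)
            go fff = there (there (here refl))

        isBig : Pol → Bool
        isBig A = h ℕ.≤ᵇ gcd-deg A

        -- The extra |p| at the primes of G multiplies up to q^g, with g the degree of the gcd; this
        -- is the number of members of a class times the gain q^h.
        wtG : Prm → Code → ℚ
        wtG p κ = wt p κ * (if ff κ then Nmℚ p else 1ℚ)

        wtG-nonneg : ∀ p κ → 0ℚ ≤ wtG p κ
        wtG-nonneg p κ = 0≤* (wt-nonneg p κ) (if-nonneg (ff κ) (ℕ→ℚ-nonneg (Nm p)) 0≤1)

        xω-Nm : ∀ p → x p * ω k p * Nmℚ p ≡ y p * ω k p
        xω-Nm p = trans (solve 3 (λ x o m → x :* o :* m := m :* x :* o) refl (x p) (ω k p) (Nmℚ p)) (cong (_* ω k p) (Nm-x p))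

        -- The origin of the recursion for `ω`: a prime of the denominator of θ / Q lies in the
        -- denominator of one part alone, or in both with an extra factor |p|.
        ω-suc : ∀ p → wt p (true , false) * 1ℚ + (wt p (false , true) * 1ℚ + (wt p (false , false) * Nmℚ p + 0ℚ)) ≡ ω (suc k) p
        ω-suc p = trans (cong (λ s → 1ℚ * ω k p * 1ℚ + (x p * 1ℚ * 1ℚ + (s + 0ℚ))) (xω-Nm p))
          (solve 3 (λ o x y → con 1ℚ :* o :* con 1ℚ :+ (x :* con 1ℚ :* con 1ℚ :+ (y :* o :+ con 0ℚ)) := x :+ (con 1ℚ :+ y) :* o) refl (ω k p) (x p) (y p))

        -- Two members differ by a multiple of all primes outside G, of total degree n - g. A member
        -- is therefore determined by its coefficients from n - g on, and there are g - h of these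
        -- below the bound n - h.
        big-class : ∀ κ → (∑[ A ∈ V ] (𝟙 (matches code ps κ A) * (𝟙 (isBig A) * (w 0 A * w k (θ +P A) * qh)))) ≤ weight {X = Pol} wtG ps κ
        big-class κ with some-or-none V (λ A → matches code ps κ A ∧ isBig A)
        ... | inj₂ none = subst (_≤ weight {X = Pol} wtG ps κ) (sym (trans (∑-cong-∈ V (λ {A} m → trans (sym (ℚₚ.*-assoc (𝟙 (matches code ps κ A)) (𝟙 (isBig A)) (w 0 A * w k (θ +P A) * qh)))
                (trans (cong (_* (w 0 A * w k (θ +P A) * qh)) (trans (sym (𝟙-∧ (matches code ps κ A) (isBig A))) (cong 𝟙 (none m)))) (ℚₚ.*-zeroˡ (w 0 A * w k (θ +P A) * qh))))) (∑-zero V)))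
                (weight-nonneg {X = Pol} wtG-nonneg ps κ)
        ... | inj₁ (A₁ , m₁ , e₁) = begin
          (∑[ A ∈ V ] (𝟙 (matches code ps κ A) * (𝟙 (isBig A) * (w 0 A * w k (θ +P A) * qh))))
            ≡⟨ ∑-cong V same-weight ⟩
          (∑[ A ∈ V ] (𝟙 (b A) * (W * qh)))
            ≡⟨ ∑-*ʳ (W * qh) V (λ A → 𝟙 (b A)) ⟩
          ∑ V (λ A → 𝟙 (b A)) * (W * qh)
            ≤⟨ *-monoˡ (0≤* W≥0 (ℕ→ℚ-nonneg (q ℕ.^ h))) (count-injective V b (drop e) (n ∸ h ∸ e) (polys-unique (n ∸ h))
                 (λ m _ → <°-drop e (polys-bound (n ∸ h) m)) inj) ⟩
          ℕ→ℚ (q ℕ.^ (n ∸ h ∸ e)) * (W * qh)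
            ≡⟨ solve 3 (λ a b c → a :* (b :* c) := b :* (a :* c)) refl (ℕ→ℚ (q ℕ.^ (n ∸ h ∸ e))) W qh ⟩
          W * (ℕ→ℚ (q ℕ.^ (n ∸ h ∸ e)) * qh)
            ≡⟨ cong (W *_) (trans (sym (ℕ→ℚ-* (q ℕ.^ (n ∸ h ∸ e)) (q ℕ.^ h))) (cong ℕ→ℚ (trans (sym (ℕₚ.^-distribˡ-+-* q (n ∸ h ∸ e) h)) (cong (q ℕ.^_) exponent)))) ⟩
          W * ℕ→ℚ (q ℕ.^ gcd-deg A₁)
            ≡⟨ cong₂ _*_ (matches-weight code wt ps κ match₁) (sym (∏-Nm (bG A₁) ps)) ⟩
          (∏[ p ∈ ps ] wt p (code A₁ p)) * (∏[ p ∈ ps ] (if bG A₁ p then Nmℚ p else 1ℚ))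
            ≡⟨ ∏-* ps (λ p → wt p (code A₁ p)) (λ p → if bG A₁ p then Nmℚ p else 1ℚ) ⟨
          (∏[ p ∈ ps ] wtG p (code A₁ p))
            ≡⟨ matches-weight code wtG ps κ match₁ ⟨
          weight {X = Pol} wtG ps κ ∎
          where
            open ℚₚ.≤-Reasoning
            b : Pol → Bool
            b A = matches code ps κ A ∧ isBig A
            W : ℚ
            W = weight {X = Pol} wt ps κ
            W≥0 : 0ℚ ≤ W
            W≥0 = weight-nonneg {X = Pol} wt-nonneg ps κ
            match₁ : matches code ps κ A₁ ≡ true
            match₁ = proj₁ (∧-true {matches code ps κ A₁} e₁)
            e : ℕ
            e = degIf (not ∘ bG A₁) ps
            ge : gcd-deg A₁ ℕ.+ e ≡ n
            ge = degIf-not (bG A₁) ps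
            h≤g : h ℕ.≤ gcd-deg A₁
            h≤g = ≤ᵇ-true⇒≤ (proj₂ (∧-true {matches code ps κ A₁} e₁))
            exponent : n ∸ h ∸ e ℕ.+ h ≡ gcd-deg A₁
            exponent = trans (cong (ℕ._+ h) (trans (ℕₚ.∸-+-assoc n h e) (trans (cong (n ∸_) (ℕₚ.+-comm h e)) (trans (sym (ℕₚ.∸-+-assoc n e h))
              (cong (_∸ h) (trans (cong (_∸ e) (sym ge)) (ℕₚ.m+n∸n≡m (gcd-deg A₁) e))))))) (ℕₚ.m∸n+n≡m h≤g)
            same-weight : ∀ A → 𝟙 (matches code ps κ A) * (𝟙 (isBig A) * (w 0 A * w k (θ +P A) * qh)) ≡ 𝟙 (b A) * (W * qh)
            same-weight A with matches code ps κ A in eq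
            ... | false = trans (ℚₚ.*-zeroˡ (𝟙 (isBig A) * (w 0 A * w k (θ +P A) * qh))) (sym (ℚₚ.*-zeroˡ (W * qh)))
            ... | true = trans (ℚₚ.*-identityˡ (𝟙 (isBig A) * (w 0 A * w k (θ +P A) * qh)))
              (cong (λ s → 𝟙 (isBig A) * (s * qh)) (trans (w*w A) (sym (matches-weight code wt ps κ eq))))
            inj : ∀ {A B} → A ∈ V → B ∈ V → b A ≡ true → b B ≡ true → drop e A ≈ drop e B → A ≡ B
            inj {A} {B} mA mB bA bB′ eq = polys-≈⇒≡ (n ∸ h) mA mB (sub≈0⇒≈ A B (few-divisors (not ∘ bG A₁) apart
              (All.zipWith (λ { {p} (c₁ , c₂) nb → difference p (trans (sym c₁) c₂) (trans (cong ff (sym c₁)) (not-true nb)) })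
                (matches-same code ps κ match₁ (proj₁ (∧-true {matches code ps κ A} bA)) , matches-same code ps κ match₁ (proj₁ (∧-true {matches code ps κ B} bB′))))
              (drop-≈ e eq)))
              where
                not-true : ∀ {t} → not t ≡ true → t ≡ false
                not-true {false} _ = refl

        -- The classes add up to an Euler product. A prime dividing θ contributes 1 + y ω_k, which
        -- `ω-growth` bounds by a power of y; the other primes reproduce ω_(k+1).
        big-sum : (∑[ A ∈ V ] (𝟙 (isBig A) * (w 0 A * w k (θ +P A) * qh))) ≤ Z ^Q (2 ℕ.^ suc k) * w (suc k) θ
        big-sum = begin
          (∑[ A ∈ V ] (𝟙 (isBig A) * (w 0 A * w k (θ +P A) * qh)))
            ≤⟨ ∑-group V (keys {X = Pol} opts ps) (λ A κ → matches code ps κ A) (λ A → 𝟙 (isBig A) * (w 0 A * w k (θ +P A) * qh))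
                 (λ A → 0≤* (𝟙-nonneg (isBig A)) (0≤* (w*w-nonneg A) (ℕ→ℚ-nonneg (q ℕ.^ h)))) (λ {A} _ → matches-exists code opts ps A (code-∈ A)) ⟩
          (∑[ κ ∈ keys {X = Pol} opts ps ] ∑[ A ∈ V ] (𝟙 (matches code ps κ A) * (𝟙 (isBig A) * (w 0 A * w k (θ +P A) * qh))))
            ≤⟨ ∑-mono (keys {X = Pol} opts ps) big-class ⟩
          ∑ (keys {X = Pol} opts ps) (weight {X = Pol} wtG ps)
            ≡⟨ ∑-keys {X = Pol} opts wtG ps ⟩
          (∏[ p ∈ ps ] ∑ (opts p) (wtG p))
            ≤⟨ ∏-mono ps (λ p → ∑-nonneg (opts p) (wtG-nonneg p)) local ⟩
          (∏[ p ∈ ps ] (y p ^Q (2 ℕ.^ suc k) * (if z p then 1ℚ else ω (suc k) p)))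
            ≡⟨ ∏-* ps (λ p → y p ^Q (2 ℕ.^ suc k)) (λ p → if z p then 1ℚ else ω (suc k) p) ⟩
          (∏[ p ∈ ps ] (y p ^Q (2 ℕ.^ suc k))) * w (suc k) θ
            ≡⟨ cong (_* w (suc k) θ) (∏-^ ps) ⟩
          Z ^Q (2 ℕ.^ suc k) * w (suc k) θ ∎
          where
            open ℚₚ.≤-Reasoning
            ∏-^ : ∀ rs → (∏[ p ∈ rs ] (y p ^Q (2 ℕ.^ suc k))) ≡ (∏[ p ∈ rs ] y p) ^Q (2 ℕ.^ suc k)
            ∏-^ [] = sym (1^Q (2 ℕ.^ suc k))
            ∏-^ (p ∷ rs) = trans (cong (y p ^Q (2 ℕ.^ suc k) *_) (∏-^ rs)) (sym (^Q-*-distrib (y p) (∏[ p ∈ rs ] y p) (2 ℕ.^ suc k)))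
            local : ∀ p → ∑ (opts p) (wtG p) ≤ y p ^Q (2 ℕ.^ suc k) * (if z p then 1ℚ else ω (suc k) p)
            local p with z p
            ... | true = begin
              wtG p (true , true) + (wtG p (false , false) + 0ℚ)
                ≡⟨ cong (λ s → 1ℚ * 1ℚ * 1ℚ + (s + 0ℚ)) (xω-Nm p) ⟩
              1ℚ * 1ℚ * 1ℚ + (y p * ω k p + 0ℚ)
                ≡⟨ solve 1 (λ s → con 1ℚ :* con 1ℚ :* con 1ℚ :+ (s :+ con 0ℚ) := con 1ℚ :+ s) refl (y p * ω k p) ⟩
              1ℚ + y p * ω k p
                ≤⟨ ℚₚ.+-monoˡ-≤ (y p * ω k p) (a≤a+b 1ℚ (x-nonneg p)) ⟩
              1ℚ + x p + y p * ω k p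
                ≤⟨ ω-growth k p ⟩
              y p ^Q (2 ℕ.^ suc k)
                ≡⟨ ℚₚ.*-identityʳ (y p ^Q (2 ℕ.^ suc k)) ⟨
              y p ^Q (2 ℕ.^ suc k) * 1ℚ ∎
            ... | false = begin
              wtG p (true , false) + (wtG p (false , true) + (wtG p (false , false) + 0ℚ)) ≡⟨ ω-suc p ⟩
              ω (suc k) p ≡⟨ ℚₚ.*-identityˡ (ω (suc k) p) ⟨
              1ℚ * ω (suc k) p ≤⟨ *-monoˡ (ω-nonneg (suc k) p) (1≤^Q (2 ℕ.^ suc k) (1≤y p)) ⟩
              y p ^Q (2 ℕ.^ suc k) * ω (suc k) p ∎

        module Small (s : ℕ) where
          -- Forgets the pattern at the primes dividing θ, so that a class fixes S but not B.
          code′ : Pol → Prm → Code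
          code′ A p = if z p then (true , true) else code A p

          opts′ : Prm → List Code
          opts′ p = if z p then (true , true) ∷ [] else (true , false) ∷ (false , true) ∷ (false , false) ∷ []

          code′-∈ : ∀ A p → code′ A p ∈ opts′ p
          code′-∈ A p = go (shape A p)
            where
              go : ∀ {z a b} → Shape z a b → (if z then (true , true) else (a , b)) ∈ (if z then (true , true) ∷ [] else (true , false) ∷ (false , true) ∷ (false , false) ∷ [])
              go ttt = here refl
              go tff = here refl
              go ftf = here refl
              go fft = there (here refl)
              go fff = there (there (here refl))

          bS′ : Prm → Code → Bool
          bS′ p κ = not (z p) ∧ ff κ

          bS-code′ : ∀ A p → bS A p ≡ bS′ p (code′ A p)
          bS-code′ A p with z p
          ... | true = refl
          ... | false = refl

          wtS wtS′ : Prm → Code → ℚ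
          wtS p κ = if z p then 1ℚ else wt p κ
          wtS′ p κ = if z p then 1ℚ else wtG p κ

          wtS-nonneg : ∀ p κ → 0ℚ ≤ wtS p κ
          wtS-nonneg p κ = if-nonneg (z p) 0≤1 (wt-nonneg p κ)

          wtS′-nonneg : ∀ p κ → 0ℚ ≤ wtS′ p κ
          wtS′-nonneg p κ = if-nonneg (z p) 0≤1 (wtG-nonneg p κ)

          wtS′-factor : ∀ A p → wtS′ p (code′ A p) ≡ wtS p (code′ A p) * (if bS A p then Nmℚ p else 1ℚ)
          wtS′-factor A p with z p
          ... | true = refl
          ... | false = refl

          -- The part of the weight carried by B, kept apart because B varies within a class.
          β : Pol → ℚ
          β A = ∏[ p ∈ ps ] (if bB A p then x p * ω k p else 1ℚ)

          w*w-factor : ∀ A → w 0 A * w k (θ +P A) ≡ (∏[ p ∈ ps ] wtS p (code′ A p)) * β A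
          w*w-factor A = trans (w*w A) (trans (∏-cong ps (λ p → go p (shape A p))) (∏-* ps (λ p → wtS p (code′ A p)) (λ p → if bB A p then x p * ω k p else 1ℚ)))
            where
              go : ∀ p {z a b} → Shape z a b → wt p (a , b) ≡
                   (if z then 1ℚ else wt p (if z then (true , true) else (a , b))) * (if z ∧ not a then x p * ω k p else 1ℚ)
              go p ttt = refl
              go p tff = sym (ℚₚ.*-identityˡ (x p * ω k p))
              go p ftf = sym (ℚₚ.*-identityʳ (wt p (true , false)))
              go p fft = sym (ℚₚ.*-identityʳ (wt p (false , true)))
              go p fff = sym (ℚₚ.*-identityʳ (wt p (false , false)))

          a : ℕ
          a = suc (2 ℕ.* c k)

          -- Two factors |p|, because the excess counts a prime of B twice. The product is y (|p|
          -- ω_k) ≤ 2 c_k; the base is one larger because `powIf-bound` takes a successor.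
          local-bound : ∀ p → x p * ω k p * (Nmℚ p * Nmℚ p) ≤ ℕ→ℚ a
          local-bound p = begin
            x p * ω k p * (Nmℚ p * Nmℚ p)
              ≡⟨ solve 3 (λ x o m → x :* o :* (m :* m) := m :* x :* (m :* o)) refl (x p) (ω k p) (Nmℚ p) ⟩
            Nmℚ p * x p * (Nmℚ p * ω k p)
              ≡⟨ cong (_* (Nmℚ p * ω k p)) (Nm-x p) ⟩
            y p * (Nmℚ p * ω k p)
              ≤⟨ *-mono-≤ (y-nonneg p) (y≤2 p) (0≤* (ℕ→ℚ-nonneg (Nm p)) (ω-nonneg k p)) (Nm-ω≤c k p) ⟩
            ℕ→ℚ 2 * ℕ→ℚ (c k)
              ≡⟨ ℕ→ℚ-* 2 (c k) ⟨
            ℕ→ℚ (2 ℕ.* c k)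
              ≤⟨ ℕ→ℚ-mono (ℕₚ.n≤1+n (2 ℕ.* c k)) ⟩
            ℕ→ℚ a ∎
            where open ℚₚ.≤-Reasoning

          β-bound : ∀ A → degIf (bB A) ps ℕ.≤ h → β A * ℕ→ℚ (q ℕ.^ (degIf (bB A) ps ℕ.+ degIf (bB A) ps)) ≤ ℕ→ℚ (M₀ s k)
          β-bound A le = begin
            β A * ℕ→ℚ (q ℕ.^ (j ℕ.+ j))
              ≡⟨ cong (β A *_) (trans (cong ℕ→ℚ (ℕₚ.^-distribˡ-+-* q j j)) (trans (ℕ→ℚ-* (q ℕ.^ j) (q ℕ.^ j)) (cong₂ _*_ (sym (∏-Nm (bB A) ps)) (sym (∏-Nm (bB A) ps))))) ⟩
            β A * (∏ ps Nm? * ∏ ps Nm?)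
              ≡⟨ trans (cong (β A *_) (sym (∏-* ps Nm? Nm?))) (sym (∏-* ps (λ p → if bB A p then x p * ω k p else 1ℚ) (λ p → Nm? p * Nm? p))) ⟩
            (∏[ p ∈ ps ] ((if bB A p then x p * ω k p else 1ℚ) * (Nm? p * Nm? p)))
              ≤⟨ ∏-mono ps (λ p → 0≤* (if-nonneg (bB A p) (0≤* (x-nonneg p) (ω-nonneg k p)) 0≤1) (0≤* (Nm?≥0 p) (Nm?≥0 p))) local ⟩
            (∏[ p ∈ ps ] (if bB A p then ℕ→ℚ a else 1ℚ))
              ≡⟨ ∏-powIf a (bB A) ps ⟩
            ℕ→ℚ (powIf a (bB A) ps)
              ≤⟨ ℕ→ℚ-mono (powIf-bound (2 ℕ.* c k) s apart (bB A) le) ⟩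
            ℕ→ℚ (M₀ s k) ∎
            where
              open ℚₚ.≤-Reasoning
              j : ℕ
              j = degIf (bB A) ps
              Nm? : Prm → ℚ
              Nm? p = if bB A p then Nmℚ p else 1ℚ
              Nm?≥0 : ∀ p → 0ℚ ≤ Nm? p
              Nm?≥0 p = if-nonneg (bB A p) (ℕ→ℚ-nonneg (Nm p)) 0≤1
              local : ∀ p → (if bB A p then x p * ω k p else 1ℚ) * (Nm? p * Nm? p) ≤ (if bB A p then ℕ→ℚ a else 1ℚ)
              local p with bB A p
              ... | true = local-bound p
              ... | false = ℚₚ.≤-refl

          -- The value 0 for a gcd of degree at least h is a default that keeps the key at most h.
          jkey : Pol → ℕ
          jkey A = if isBig A then 0 else degIf (bB A) ps

          F : Pol → ℚ
          F A = w 0 A * w k (θ +P A) * ℕ→ℚ (q ℕ.^ (t A ⊓ h))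

          F-nonneg : ∀ A → 0ℚ ≤ F A
          F-nonneg A = 0≤* (w*w-nonneg A) (ℕ→ℚ-nonneg (q ℕ.^ (t A ⊓ h)))

          inClass : ℕ → List Code → Pol → Bool
          inClass j κ A = matches code′ ps κ A ∧ ((jkey A ℕ.≡ᵇ j) ∧ not (isBig A))

          not-true : ∀ {t} → not t ≡ true → t ≡ false
          not-true {false} _ = refl

          ≡ᵇ-true : ∀ {m n} → (m ℕ.≡ᵇ n) ≡ true → m ≡ n
          ≡ᵇ-true {m} {n} e = ℕₚ.≡ᵇ⇒≡ m n (true⇒T e)

          true-≡ᵇ : ∀ m → (m ℕ.≡ᵇ m) ≡ true
          true-≡ᵇ zero = refl
          true-≡ᵇ (suc m) = true-≡ᵇ m

          record InClass (j : ℕ) (κ : List Code) (A : Pol) : Set where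
            field
              match : matches code′ ps κ A ≡ true
              small : isBig A ≡ false
              degB : degIf (bB A) ps ≡ j
              gcd<h : gcd-deg A ℕ.< h
          open InClass

          inClass-sound : ∀ {j κ A} → inClass j κ A ≡ true → InClass j κ A
          inClass-sound {j} {κ} {A} e with ∧-true {matches code′ ps κ A} e
          ... | e₁ , e₂ with ∧-true {jkey A ℕ.≡ᵇ j} e₂
          ...   | e₃ , e₄ = record
            { match = e₁
            ; small = not-true e₄
            ; degB = trans (sym (cong (λ b → if b then 0 else degIf (bB A) ps) (not-true e₄))) (≡ᵇ-true {jkey A} {j} e₃)
            ; gcd<h = ≤ᵇ-false⇒> (not-true e₄) }

          module OneClass (j : ℕ) (κ : List Code) {A₁ : Pol} (m₁ : A₁ ∈ V) (c₁ : InClass j κ A₁) where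
            s₁ e g : ℕ
            s₁ = degIf (bS A₁) ps
            g = gcd-deg A₁
            e = degIf (not ∘ bG A₁) ps

            ge : g ℕ.+ e ≡ n
            ge = degIf-not (bG A₁) ps

            g≡j+s₁ : g ≡ j ℕ.+ s₁
            g≡j+s₁ = trans (gcd-split A₁) (cong (ℕ._+ s₁) (degB c₁))

            same-code : ∀ {A} → InClass j κ A → All (λ p → code′ A₁ p ≡ code′ A p) ps
            same-code c = matches-same code′ ps κ (match c₁) (match c)

            -- The excess is constant on a class: the degree of B is fixed by j, and S by the
            -- pattern at the primes not dividing θ.
            t≡j+g : ∀ {A} → InClass j κ A → t A ≡ j ℕ.+ g
            t≡j+g {A} c = cong₂ ℕ._+_ (degB c) (trans (gcd-split A) (trans (cong₂ ℕ._+_ (degB c) (sym sameS)) (sym g≡j+s₁)))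
              where
                sameS : s₁ ≡ degIf (bS A) ps
                sameS = degIf-cong-All (All.map (λ {p} eq → trans (bS-code′ A₁ p) (trans (cong (bS′ p) eq) (sym (bS-code′ A p)))) (same-code c))

            Π : Pol → Pol
            Π B = prodIf (bB B) ps

            Π-monic : ∀ {B} → InClass j κ B → Mon (Π B) j
            Π-monic {B} c = subst (Mon (Π B)) (degB c) (prodIf-monic (bB B) ps)

            -- C B is a determinant-like quantity: it is divisible by every prime outside G and has degree
            -- < j + n - h, so at most t - h of its coefficients are free, and it determines B.
            C : Pol → Pol
            C B = Π B *P (A₁ -P B)

            C-bound : ∀ {B} → B ∈ V → InClass j κ B → C B <° j ℕ.+ (n ∸ h)
            C-bound m c = <°-* (bound (Π-monic c)) (<°-sub (polys-bound (n ∸ h) m₁) (polys-bound (n ∸ h) m))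

            -- If p does not divide θ, the codes agree at p and p divides A₁ - B. If it does, p
            -- divides A₁, being outside G; then p divides `B` as well, or it is a factor of `Π B`.
            ∣-C : ∀ {B} → InClass j κ B → All (λ p → not (bG A₁ p) ≡ true → poly p ∣ C B) ps
            ∣-C {B} c = All.zipWith (λ { {p} (eq , Πdiv) nb → go p eq Πdiv (not-true nb) }) (same-code c , ∣-prodIf (bB B) ps)
              where
                go : ∀ p → code′ A₁ p ≡ code′ B p → (bB B p ≡ true → poly p ∣ Π B) → ff (code A₁ p) ≡ false → poly p ∣ C B
                go p eq Πdiv nb with z p in ez
                ... | false = ∣-*ˡ (Π B) (difference {A₁} {B} p eq nb)
                ... | true with dvd p B in eB
                ...   | false = ∣-*ʳ (A₁ -P B) (Πdiv refl)
                ...   | true = ∣-*ˡ (Π B) (∣-sub (dvd⇒∣ p {A₁} (dvdA₁ (subst (λ t → Shape t (dvd p A₁) (dvd p (θ +P A₁))) ez (shape A₁ p)) nb)) (dvd⇒∣ p {B} eB))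
                  where
                    dvdA₁ : ∀ {a b} → Shape true a b → not a ∧ not b ≡ false → a ≡ true
                    dvdA₁ ttt _ = refl

            -- Equality gives A₁ (Π B - Π B′) = B Π B - B′ Π B′. A prime of `bB A₁` divides both
            -- terms on the right but not A₁, hence divides Π B - Π B′. These primes have total
            -- degree j, while a difference of two monic polynomials of degree j has smaller degree.
            -- So Π B = Π B′, and cancelling it leaves B = B′.
            C-injective : ∀ {B B′} → InClass j κ B → InClass j κ B′ → C B ≈ C B′ → B ≈ B′
            C-injective {B} {B′} c c′ eq = ≈-sym (sub≈0⇒≈ B′ B (Mon-cancel-0 {C = B′ -P B} (Π-monic c) (<°-resp (≈-sym zero′) <°-[])))
              where
                open ≈-Reasoning
                moved : (A₁ *P Π B) +P (B′ *P Π B′) ≈ (A₁ *P Π B′) +P (B *P Π B)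
                moved = begin
                  (A₁ *P Π B) +P (B′ *P Π B′) ≈⟨ +-cong (unfold B) ≈-refl ⟩
                  (C B +P (B *P Π B)) +P (B′ *P Π B′) ≈⟨ +-cong (+-cong eq ≈-refl) ≈-refl ⟩
                  (C B′ +P (B *P Π B)) +P (B′ *P Π B′) ≈⟨ +-assoc (C B′) (B *P Π B) (B′ *P Π B′) ⟩
                  C B′ +P ((B *P Π B) +P (B′ *P Π B′)) ≈⟨ +-cong (≈-refl {C B′}) (+-comm (B *P Π B) (B′ *P Π B′)) ⟩
                  C B′ +P ((B′ *P Π B′) +P (B *P Π B)) ≈⟨ +-assoc (C B′) (B′ *P Π B′) (B *P Π B) ⟨
                  (C B′ +P (B′ *P Π B′)) +P (B *P Π B) ≈⟨ +-cong (≈-sym (unfold B′)) ≈-refl ⟩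
                  (A₁ *P Π B′) +P (B *P Π B) ∎
                  where
                    unfold : ∀ D → A₁ *P Π D ≈ C D +P (D *P Π D)
                    unfold D = begin
                      A₁ *P Π D ≈⟨ *-congˡ (Π D) (≈-sym (sub-cancel A₁ D)) ⟩
                      ((A₁ -P D) +P D) *P Π D ≈⟨ *-distribʳ (Π D) (A₁ -P D) D ⟩
                      ((A₁ -P D) *P Π D) +P (D *P Π D) ≈⟨ +-cong (*-comm (A₁ -P D) (Π D)) ≈-refl ⟩
                      C D +P (D *P Π D) ∎
                ∣-BΠ : ∀ {D} p → z p ≡ true → (bB D p ≡ true → poly p ∣ Π D) → poly p ∣ D *P Π D
                ∣-BΠ {D} p ez Πdiv with dvd p D in eD
                ... | true = ∣-*ʳ (Π D) (dvd⇒∣ p {D} eD)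
                ... | false = ∣-*ˡ D (Πdiv (cong (_∧ true) ez))
                ∣-ΔΠ : All (λ p → bB A₁ p ≡ true → poly p ∣ Π B -P Π B′) ps
                ∣-ΔΠ = All.zipWith (λ { {p} (f , f′) b₁ → go p f f′ (proj₁ (∧-true {z p} b₁)) (not-true (proj₂ (∧-true {z p} b₁))) }) (∣-prodIf (bB B) ps , ∣-prodIf (bB B′) ps)
                  where
                    go : ∀ p → (bB B p ≡ true → poly p ∣ Π B) → (bB B′ p ≡ true → poly p ∣ Π B′) → z p ≡ true → dvd p A₁ ≡ false → poly p ∣ Π B -P Π B′
                    go p f f′ ez na = euclid p A₁ (Π B -P Π B′) (∣-resp (≈-sym expand)
                        (∣-resp moved′ (∣-sub (∣-BΠ {B} p ez f) (∣-BΠ {B′} p ez f′))))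
                        (λ d → case trans (sym na) (∣⇒dvd p {A₁} d) of λ ())
                      where
                        expand : A₁ *P (Π B -P Π B′) ≈ (A₁ *P Π B) -P (A₁ *P Π B′)
                        expand = ≈-trans (*-distribˡ A₁ (Π B) (-P Π B′)) (+-cong (≈-refl {A₁ *P Π B}) (≈-sym (Pₚ.-‿distribʳ-* A₁ (Π B′))))
                        moved′ : (B *P Π B) -P (B′ *P Π B′) ≈ (A₁ *P Π B) -P (A₁ *P Π B′)
                        moved′ = ≈-sym (begin
                          (A₁ *P Π B) -P (A₁ *P Π B′)
                            ≈⟨ +-cong (+⇒sub {A₁ *P Π B} {B′ *P Π B′} moved) ≈-refl ⟩
                          (((A₁ *P Π B′) +P (B *P Π B)) -P (B′ *P Π B′)) -P (A₁ *P Π B′)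
                            ≈⟨ Pᵢ.swap-last (A₁ *P Π B′) (B *P Π B) (-P (B′ *P Π B′)) (-P (A₁ *P Π B′)) ⟩
                          ((B *P Π B) -P (B′ *P Π B′)) +P ((A₁ *P Π B′) -P (A₁ *P Π B′))
                            ≈⟨ +-cong (≈-refl {(B *P Π B) -P (B′ *P Π B′)}) (neg-inverseʳ (A₁ *P Π B′)) ⟩
                          ((B *P Π B) -P (B′ *P Π B′)) +P []
                            ≈⟨ +-identityʳ ((B *P Π B) -P (B′ *P Π B′)) ⟩
                          (B *P Π B) -P (B′ *P Π B′) ∎)
                same-Π : Π B ≈ Π B′
                same-Π = sub≈0⇒≈ (Π B) (Π B′) (few-divisors (bB A₁) apart ∣-ΔΠ (subst (Π B -P Π B′ <°_) (sym (degB c₁))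
                  (<°-pred (<°-sub (bound (Π-monic c)) (bound (Π-monic c′))) top)))
                  where
                    top : coeff (Π B -P Π B′) j ≡ 0#
                    top = trans (coeff-+ (Π B) (-P Π B′) j) (trans (cong₂ _+F_ (lead (Π-monic c)) (trans (coeff-neg (Π B′) j) (cong (λ t → -F t) (lead (Π-monic c′))))) (F.-‿inverseʳ 1#))
                zero′ : Π B *P (B′ -P B) ≈ []
                zero′ = begin
                  Π B *P (B′ -P B) ≈⟨ *-congʳ (Π B) diff ⟩
                  Π B *P ((A₁ -P B) -P (A₁ -P B′)) ≈⟨ *-distribˡ (Π B) (A₁ -P B) (-P (A₁ -P B′)) ⟩
                  C B +P (Π B *P (-P (A₁ -P B′))) ≈⟨ +-cong eq (≈-sym (Pₚ.-‿distribʳ-* (Π B) (A₁ -P B′))) ⟩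
                  C B′ -P (Π B *P (A₁ -P B′)) ≈⟨ +-cong (≈-refl {C B′}) (neg-cong (*-congˡ (A₁ -P B′) same-Π)) ⟩
                  C B′ -P C B′ ≈⟨ neg-inverseʳ (C B′) ⟩
                  [] ∎
                  where
                    diff : B′ -P B ≈ (A₁ -P B) -P (A₁ -P B′)
                    diff = ≈-sym (begin
                      (A₁ -P B) -P (A₁ -P B′) ≈⟨ +-cong (≈-refl {A₁ -P B}) (≈-trans (≈-sym (-‿+-comm A₁ (-P B′))) (+-cong (≈-refl { -P A₁}) (Pₚ.-‿involutive B′))) ⟩
                      (A₁ -P B) +P ((-P A₁) +P B′) ≈⟨ +-interchange A₁ (-P B) (-P A₁) B′ ⟩
                      (A₁ -P A₁) +P ((-P B) +P B′) ≈⟨ +-cong (neg-inverseʳ A₁) (+-comm (-P B) B′) ⟩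
                      B′ -P B ∎)
                      where open import Algebra.Properties.AbelianGroup PR.+-abelianGroup using () renaming (⁻¹-∙-comm to -‿+-comm)

            class-count : ∑ V (λ A → 𝟙 (inClass j κ A)) ≤ ℕ→ℚ (q ℕ.^ ((j ℕ.+ g) ∸ h))
            class-count = subst (λ m → ∑ V (λ A → 𝟙 (inClass j κ A)) ≤ ℕ→ℚ (q ℕ.^ m)) exponent
              (count-injective V (inClass j κ) (drop e ∘ C) (j ℕ.+ (n ∸ h) ∸ e) (polys-unique (n ∸ h))
                (λ m b → <°-drop e (C-bound m (inClass-sound b)))
                (λ {B} {B′} m m′ b b′ eq → polys-≈⇒≡ (n ∸ h) m m′ (C-injective (inClass-sound b) (inClass-sound b′)
                  (sub≈0⇒≈ (C B) (C B′) (few-divisors (not ∘ bG A₁) apart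
                    (All.zipWith (λ { (f , f′) nb → ∣-sub (f nb) (f′ nb) }) (∣-C (inClass-sound b) , ∣-C (inClass-sound b′)))
                    (drop-≈ e eq))))))
              where
                exponent : j ℕ.+ (n ∸ h) ∸ e ≡ (j ℕ.+ g) ∸ h
                exponent = begin
                  j ℕ.+ (n ∸ h) ∸ e ≡⟨ cong (_∸ e) (ℕₚ.+-∸-assoc j h≤n) ⟨
                  j ℕ.+ n ∸ h ∸ e ≡⟨ trans (ℕₚ.∸-+-assoc (j ℕ.+ n) h e) (trans (cong (j ℕ.+ n ∸_) (ℕₚ.+-comm h e)) (sym (ℕₚ.∸-+-assoc (j ℕ.+ n) e h))) ⟩
                  j ℕ.+ n ∸ e ∸ h ≡⟨ cong (_∸ h) (trans (cong (_∸ e) (trans (cong (j ℕ.+_) (sym ge)) (sym (ℕₚ.+-assoc j g e)))) (ℕₚ.m+n∸n≡m (j ℕ.+ g) e)) ⟩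
                  (j ℕ.+ g) ∸ h ∎
                  where open ≡-Reasoning

            Φ : ℚ
            Φ = weight {X = Pol} wtS ps κ

            Φ≥0 : 0ℚ ≤ Φ
            Φ≥0 = weight-nonneg {X = Pol} wtS-nonneg ps κ

            qj : ℕ
            qj = q ℕ.^ (j ℕ.+ j)

            F-bound : ∀ {A} → InClass j κ A → F A ≤ Φ * (ℕ→ℚ (M₀ s k) * inv qj) * ℕ→ℚ (q ℕ.^ ((j ℕ.+ g) ⊓ h))
            F-bound {A} c = subst (λ m → F A ≤ Φ * (ℕ→ℚ (M₀ s k) * inv qj) * ℕ→ℚ (q ℕ.^ (m ⊓ h))) (t≡j+g c)
              (*-monoˡ (ℕ→ℚ-nonneg (q ℕ.^ (t A ⊓ h))) (begin
                w 0 A * w k (θ +P A) ≡⟨ w*w-factor A ⟩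
                (∏[ p ∈ ps ] wtS p (code′ A p)) * β A ≡⟨ cong (_* β A) (matches-weight code′ wtS ps κ (match c)) ⟨
                Φ * β A ≤⟨ *-monoʳ Φ≥0 β≤ ⟩
                Φ * (ℕ→ℚ (M₀ s k) * inv qj) ∎))
              where
                open ℚₚ.≤-Reasoning
                j≤h : degIf (bB A) ps ℕ.≤ h
                j≤h = ℕₚ.≤-trans (ℕₚ.m≤m+n (degIf (bB A) ps) (degIf (bS A) ps)) (subst (ℕ._≤ h) (gcd-split A) (ℕₚ.<⇒≤ (gcd<h c)))
                β≤ : β A ≤ ℕ→ℚ (M₀ s k) * inv qj
                β≤ = begin
                  β A ≡⟨ ℚₚ.*-identityʳ (β A) ⟨
                  β A * 1ℚ ≡⟨ cong (β A *_) (inv-inverseʳ (1≤q^ (j ℕ.+ j))) ⟨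
                  β A * (ℕ→ℚ qj * inv qj) ≡⟨ ℚₚ.*-assoc (β A) (ℕ→ℚ qj) (inv qj) ⟨
                  β A * ℕ→ℚ qj * inv qj ≤⟨ *-monoˡ (inv-nonneg qj) (subst (λ i → β A * ℕ→ℚ (q ℕ.^ (i ℕ.+ i)) ≤ ℕ→ℚ (M₀ s k)) (degB c) (β-bound A j≤h)) ⟩
                  ℕ→ℚ (M₀ s k) * inv qj ∎

            class-sum : (∑[ A ∈ V ] (𝟙 (inClass j κ A) * F A)) ≤ ℕ→ℚ (M₀ s k) * weight {X = Pol} wtS′ ps κ
            class-sum = begin
              (∑[ A ∈ V ] (𝟙 (inClass j κ A) * F A))
                ≤⟨ ∑-mono V bounded ⟩
              (∑[ A ∈ V ] (𝟙 (inClass j κ A) * (Φ * (ℕ→ℚ (M₀ s k) * inv qj) * qmin)))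
                ≡⟨ ∑-*ʳ (Φ * (ℕ→ℚ (M₀ s k) * inv qj) * qmin) V (λ A → 𝟙 (inClass j κ A)) ⟩
              ∑ V (λ A → 𝟙 (inClass j κ A)) * (Φ * (ℕ→ℚ (M₀ s k) * inv qj) * qmin)
                ≤⟨ *-monoˡ (0≤* (0≤* Φ≥0 (0≤* (ℕ→ℚ-nonneg (M₀ s k)) (inv-nonneg qj))) (ℕ→ℚ-nonneg (q ℕ.^ ((j ℕ.+ g) ⊓ h)))) class-count ⟩
              ℕ→ℚ (q ℕ.^ ((j ℕ.+ g) ∸ h)) * (Φ * (ℕ→ℚ (M₀ s k) * inv qj) * qmin)
                ≡⟨ solve 5 (λ a f m i b → a :* (f :* (m :* i) :* b) := m :* (f :* (b :* a :* i))) refl (ℕ→ℚ (q ℕ.^ ((j ℕ.+ g) ∸ h))) Φ (ℕ→ℚ (M₀ s k)) (inv qj) qmin ⟩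
              ℕ→ℚ (M₀ s k) * (Φ * (qmin * ℕ→ℚ (q ℕ.^ ((j ℕ.+ g) ∸ h)) * inv qj))
                ≡⟨ cong (λ r → ℕ→ℚ (M₀ s k) * (Φ * r)) powers ⟩
              ℕ→ℚ (M₀ s k) * (Φ * ℕ→ℚ (q ℕ.^ s₁))
                ≡⟨ cong (ℕ→ℚ (M₀ s k) *_) (begin-equality
                     Φ * ℕ→ℚ (q ℕ.^ s₁) ≡⟨ cong₂ _*_ (matches-weight code′ wtS ps κ (match c₁)) (sym (∏-Nm (bS A₁) ps)) ⟩
                     (∏[ p ∈ ps ] wtS p (code′ A₁ p)) * (∏[ p ∈ ps ] (if bS A₁ p then Nmℚ p else 1ℚ)) ≡⟨ ∏-* ps (λ p → wtS p (code′ A₁ p)) (λ p → if bS A₁ p then Nmℚ p else 1ℚ) ⟨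
                     (∏[ p ∈ ps ] (wtS p (code′ A₁ p) * (if bS A₁ p then Nmℚ p else 1ℚ))) ≡⟨ ∏-cong ps (wtS′-factor A₁) ⟨
                     (∏[ p ∈ ps ] wtS′ p (code′ A₁ p)) ≡⟨ matches-weight code′ wtS′ ps κ (match c₁) ⟨
                     weight {X = Pol} wtS′ ps κ ∎) ⟩
              ℕ→ℚ (M₀ s k) * weight {X = Pol} wtS′ ps κ ∎
              where
                open ℚₚ.≤-Reasoning
                qmin : ℚ
                qmin = ℕ→ℚ (q ℕ.^ ((j ℕ.+ g) ⊓ h))
                bounded : ∀ A → 𝟙 (inClass j κ A) * F A ≤ 𝟙 (inClass j κ A) * (Φ * (ℕ→ℚ (M₀ s k) * inv qj) * qmin)
                bounded A = 𝟙-mono (inClass j κ A) (λ eq → F-bound (inClass-sound {j} {κ} {A} eq))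
                -- With t = j + g, min(t, h) and the truncated t - h add up to t = 2j + s₁ whichever
                -- of t and h is larger; the bound for `β` pays for 2j.
                powers : qmin * ℕ→ℚ (q ℕ.^ ((j ℕ.+ g) ∸ h)) * inv qj ≡ ℕ→ℚ (q ℕ.^ s₁)
                powers = begin-equality
                  qmin * ℕ→ℚ (q ℕ.^ ((j ℕ.+ g) ∸ h)) * inv qj
                    ≡⟨ cong (_* inv qj) (trans (sym (ℕ→ℚ-* (q ℕ.^ ((j ℕ.+ g) ⊓ h)) (q ℕ.^ ((j ℕ.+ g) ∸ h)))) (cong ℕ→ℚ (trans (sym (ℕₚ.^-distribˡ-+-* q ((j ℕ.+ g) ⊓ h) ((j ℕ.+ g) ∸ h)))
                         (trans (cong (q ℕ.^_) (trans (trans (cong (ℕ._+ ((j ℕ.+ g) ∸ h)) (ℕₚ.⊓-comm (j ℕ.+ g) h)) (ℕₚ.m⊓n+n∸m≡n h (j ℕ.+ g))) (trans (cong (j ℕ.+_) g≡j+s₁) (sym (ℕₚ.+-assoc j j s₁)))))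
                                (ℕₚ.^-distribˡ-+-* q (j ℕ.+ j) s₁))))) ⟩
                  ℕ→ℚ (qj ℕ.* q ℕ.^ s₁) * inv qj
                    ≡⟨ cong (_* inv qj) (ℕ→ℚ-* qj (q ℕ.^ s₁)) ⟩
                  ℕ→ℚ qj * ℕ→ℚ (q ℕ.^ s₁) * inv qj
                    ≡⟨ solve 3 (λ a b i → a :* b :* i := a :* i :* b) refl (ℕ→ℚ qj) (ℕ→ℚ (q ℕ.^ s₁)) (inv qj) ⟩
                  ℕ→ℚ qj * inv qj * ℕ→ℚ (q ℕ.^ s₁)
                    ≡⟨ trans (cong (_* ℕ→ℚ (q ℕ.^ s₁)) (inv-inverseʳ (1≤q^ (j ℕ.+ j)))) (ℚₚ.*-identityˡ (ℕ→ℚ (q ℕ.^ s₁))) ⟩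
                  ℕ→ℚ (q ℕ.^ s₁) ∎

          small-class : ∀ j κ → (∑[ A ∈ V ] (𝟙 (matches (code′) ps κ A) * (𝟙 (jkey A ℕ.≡ᵇ j) * (𝟙 (not (isBig A)) * F A))))
                        ≤ ℕ→ℚ (M₀ s k) * weight {X = Pol} (wtS′) ps κ
          small-class j κ = subst (_≤ ℕ→ℚ (M₀ s k) * weight {X = Pol} (wtS′) ps κ) (∑-cong V merge) bound′
            where
              b : Pol → Bool
              b = inClass j κ
              merge : ∀ A → 𝟙 (b A) * F A ≡ 𝟙 (matches (code′) ps κ A) * (𝟙 (jkey A ℕ.≡ᵇ j) * (𝟙 (not (isBig A)) * F A))
              merge A = trans (cong (_* F A) (trans (𝟙-∧ b₁ (b₂ ∧ b₃)) (cong (𝟙 b₁ *_) (𝟙-∧ b₂ b₃))))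
                (solve 4 (λ a b c d → a :* (b :* c) :* d := a :* (b :* (c :* d))) refl (𝟙 b₁) (𝟙 b₂) (𝟙 b₃) (F A))
                where
                  b₁ b₂ b₃ : Bool
                  b₁ = matches (code′) ps κ A
                  b₂ = jkey A ℕ.≡ᵇ j
                  b₃ = not (isBig A)
              bound′ : (∑[ A ∈ V ] (𝟙 (b A) * F A)) ≤ ℕ→ℚ (M₀ s k) * weight {X = Pol} (wtS′) ps κ
              bound′ = go (some-or-none V b)
                where
                  go : (∃ λ A → A ∈ V × b A ≡ true) ⊎ (∀ {A} → A ∈ V → b A ≡ false) →
                       (∑[ A ∈ V ] (𝟙 (b A) * F A)) ≤ ℕ→ℚ (M₀ s k) * weight {X = Pol} wtS′ ps κ
                  go (inj₁ (A₁ , m₁ , e₁)) = OneClass.class-sum j κ m₁ (inClass-sound {j} {κ} {A₁} e₁)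
                  go (inj₂ none) = subst (_≤ ℕ→ℚ (M₀ s k) * weight {X = Pol} wtS′ ps κ)
                    (sym (trans (∑-cong-∈ V (λ {A} m → trans (cong (λ u → 𝟙 u * F A) (none m)) (ℚₚ.*-zeroˡ (F A)))) (∑-zero V)))
                    (0≤* (ℕ→ℚ-nonneg (M₀ s k)) (weight-nonneg {X = Pol} wtS′-nonneg ps κ))

          -- There are h + 1 values of j. For each, the Euler product has the factor 1 at primes
          -- dividing θ, so no power of `Z` arises; it equals `w (suc k) θ`.
          small-sum : (∑[ A ∈ V ] (𝟙 (not (isBig A)) * F A)) ≤ ℕ→ℚ (suc h ℕ.* M₀ s k) * w (suc k) θ
          small-sum = begin
            (∑[ A ∈ V ] (𝟙 (not (isBig A)) * F A))
              ≤⟨ ∑-group V (upTo (suc h)) (λ A j → jkey A ℕ.≡ᵇ j) (λ A → 𝟙 (not (isBig A)) * F A) nn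
                   (λ {A} _ → jkey A , ∈ₚ.∈-upTo⁺ (s≤s (jkey≤h A)) , true-≡ᵇ (jkey A)) ⟩
            (∑[ j ∈ upTo (suc h) ] ∑[ A ∈ V ] (𝟙 (jkey A ℕ.≡ᵇ j) * (𝟙 (not (isBig A)) * F A)))
              ≤⟨ ∑-mono (upTo (suc h)) (λ j → ∑-group V keys′ (λ A κ → matches code′ ps κ A) (λ A → 𝟙 (jkey A ℕ.≡ᵇ j) * (𝟙 (not (isBig A)) * F A))
                   (λ A → 0≤* (𝟙-nonneg (jkey A ℕ.≡ᵇ j)) (nn A)) (λ {A} _ → matches-exists code′ opts′ ps A (code′-∈ A))) ⟩
            (∑[ j ∈ upTo (suc h) ] ∑[ κ ∈ keys′ ] ∑[ A ∈ V ] (𝟙 (matches code′ ps κ A) * (𝟙 (jkey A ℕ.≡ᵇ j) * (𝟙 (not (isBig A)) * F A))))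
              ≤⟨ ∑-mono (upTo (suc h)) (λ j → ∑-mono keys′ (small-class j)) ⟩
            (∑[ j ∈ upTo (suc h) ] ∑[ κ ∈ keys′ ] (ℕ→ℚ (M₀ s k) * weight {X = Pol} wtS′ ps κ))
              ≡⟨ ∑-cong (upTo (suc h)) (λ _ → trans (∑-*ˡ (ℕ→ℚ (M₀ s k)) keys′ (weight {X = Pol} wtS′ ps)) (cong (ℕ→ℚ (M₀ s k) *_) (trans (∑-keys {X = Pol} opts′ wtS′ ps) (∏-cong ps local)))) ⟩
            (∑[ j ∈ upTo (suc h) ] (ℕ→ℚ (M₀ s k) * w (suc k) θ))
              ≡⟨ trans (∑-const (upTo (suc h)) (ℕ→ℚ (M₀ s k) * w (suc k) θ)) (cong (λ l → ℕ→ℚ l * (ℕ→ℚ (M₀ s k) * w (suc k) θ)) (Listₚ.length-upTo (suc h))) ⟩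
            ℕ→ℚ (suc h) * (ℕ→ℚ (M₀ s k) * w (suc k) θ)
              ≡⟨ trans (sym (ℚₚ.*-assoc (ℕ→ℚ (suc h)) (ℕ→ℚ (M₀ s k)) (w (suc k) θ))) (cong (_* w (suc k) θ) (sym (ℕ→ℚ-* (suc h) (M₀ s k)))) ⟩
            ℕ→ℚ (suc h ℕ.* M₀ s k) * w (suc k) θ ∎
            where
              open ℚₚ.≤-Reasoning
              keys′ : List (List Code)
              keys′ = keys {X = Pol} opts′ ps
              nn : ∀ A → 0ℚ ≤ 𝟙 (not (isBig A)) * F A
              nn A = 0≤* (𝟙-nonneg (not (isBig A))) (F-nonneg A)
              jkey≤h : ∀ A → jkey A ℕ.≤ h
              jkey≤h A with isBig A in eq
              ... | true = z≤n
              ... | false = ℕₚ.≤-trans (subst (degIf (bB A) ps ℕ.≤_) (sym (gcd-split A)) (ℕₚ.m≤m+n (degIf (bB A) ps) (degIf (bS A) ps)))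
                (ℕₚ.<⇒≤ (≤ᵇ-false⇒> eq))
              local : ∀ p → ∑ (opts′ p) (wtS′ p) ≡ (if dvd p θ then 1ℚ else ω (suc k) p)
              local p with dvd p θ
              ... | true = refl
              ... | false = ω-suc p

          -- In K, the power of Z comes from the pairs whose denominators have a gcd of degree ≥ h,
          -- the other term from the remaining pairs.
          extension : (∑[ A ∈ V ] (w 0 A * w k (θ +P A) * ℕ→ℚ (q ℕ.^ (t A ⊓ h)))) ≤ K s k * w (suc k) θ
          extension = begin
            ∑ V F
              ≤⟨ ∑-mono V split ⟩
            (∑[ A ∈ V ] (𝟙 (isBig A) * (w 0 A * w k (θ +P A) * qh) + 𝟙 (not (isBig A)) * F A))
              ≡⟨ ∑-+ V (λ A → 𝟙 (isBig A) * (w 0 A * w k (θ +P A) * qh)) (λ A → 𝟙 (not (isBig A)) * F A) ⟩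
            (∑[ A ∈ V ] (𝟙 (isBig A) * (w 0 A * w k (θ +P A) * qh))) + (∑[ A ∈ V ] (𝟙 (not (isBig A)) * F A))
              ≤⟨ ℚₚ.+-mono-≤ big-sum small-sum ⟩
            Z ^Q (2 ℕ.^ suc k) * w (suc k) θ + ℕ→ℚ (suc h ℕ.* M₀ s k) * w (suc k) θ
              ≡⟨ ℚₚ.*-distribʳ-+ (w (suc k) θ) (Z ^Q (2 ℕ.^ suc k)) (ℕ→ℚ (suc h ℕ.* M₀ s k)) ⟨
            K s k * w (suc k) θ ∎
            where
              open ℚₚ.≤-Reasoning
              split : ∀ A → F A ≤ 𝟙 (isBig A) * (w 0 A * w k (θ +P A) * qh) + 𝟙 (not (isBig A)) * F A
              split A = 𝟙-split (isBig A) (*-monoʳ (w*w-nonneg A) (ℕ→ℚ-mono (q^-mono (ℕₚ.m⊓n≤n (t A) h))))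

-- Ordering the variables, and the arithmetic of the excesses

module Symmetrisation where
  open import Data.Rational using (_+_; _*_; _-_; -_; _≤_)
  open +-*-Solver using (solve; _:=_; _:+_; _:*_; _:-_; :-_; con)
  pairs : ∀ {A : Set} → List A → List (A × A)
  pairs xs = concatMap (λ a → map (a ,_) xs) xs

  ∑-pairs : ∀ {A : Set} (xs : List A) (f : A × A → ℚ) → ∑ (pairs xs) f ≡ (∑[ a ∈ xs ] ∑[ b ∈ xs ] f (a , b))
  ∑-pairs xs f = trans (∑-concatMap (λ a → map (a ,_) xs) xs f) (∑-cong xs (λ a → ∑-map (a ,_) xs f))

  -- One of the two orders always holds, and by symmetry both contribute the same sum.
  symmetrise : ∀ {A : Set} (xs : List A) (u : A → ℕ) (f : A → A → ℚ) → (∀ a b → 0ℚ ≤ f a b) → (∀ a b → f a b ≡ f b a) →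
               (∑[ a ∈ xs ] ∑[ b ∈ xs ] f a b) ≤ ℕ→ℚ 2 * (∑[ a ∈ xs ] ∑[ b ∈ xs ] (𝟙 (u a ℕ.≤ᵇ u b) * f a b))
  symmetrise xs u f f≥0 f-sym = begin
    (∑[ a ∈ xs ] ∑[ b ∈ xs ] f a b)
      ≤⟨ ∑-mono xs (λ a → ∑-mono xs (λ b → either a b)) ⟩
    (∑[ a ∈ xs ] ∑[ b ∈ xs ] (r a b * f a b + r b a * f b a))
      ≡⟨ trans (∑-cong xs (λ a → ∑-+ xs (λ b → r a b * f a b) (λ b → r b a * f b a))) (∑-+ xs (λ a → ∑ xs (λ b → r a b * f a b)) (λ a → ∑ xs (λ b → r b a * f b a))) ⟩
    S + (∑[ a ∈ xs ] ∑[ b ∈ xs ] (r b a * f b a))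
      ≡⟨ cong (S +_) (∑-swap xs xs (λ a b → r b a * f b a)) ⟩
    S + S
      ≡⟨ solve 1 (λ s → s :+ s := con (ℕ→ℚ 2) :* s) refl S ⟩
    ℕ→ℚ 2 * S ∎
    where
      open ℚₚ.≤-Reasoning
      r : _ → _ → ℚ
      r a b = 𝟙 (u a ℕ.≤ᵇ u b)
      S : ℚ
      S = ∑[ a ∈ xs ] ∑[ b ∈ xs ] (r a b * f a b)
      either : ∀ a b → f a b ≤ r a b * f a b + r b a * f b a
      either a b with ℕₚ.≤-total (u a) (u b)
      ... | inj₁ le = subst (λ t → f a b ≤ 𝟙 t * f a b + r b a * f b a) (sym (≤⇒≤ᵇ-true le))
        (subst (_≤ 1ℚ * f a b + r b a * f b a) (ℚₚ.*-identityˡ (f a b)) (a≤a+b (1ℚ * f a b) (0≤* (𝟙-nonneg (u b ℕ.≤ᵇ u a)) (f≥0 b a))))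
      ... | inj₂ le = subst (λ t → f a b ≤ r a b * f a b + 𝟙 t * f b a) (sym (≤⇒≤ᵇ-true le))
        (subst (_≤ r a b * f a b + 1ℚ * f b a) (trans (ℚₚ.*-identityˡ (f b a)) (f-sym b a)) (b≤a+b (1ℚ * f b a) (0≤* (𝟙-nonneg (u a ℕ.≤ᵇ u b)) (f≥0 a b))))

open ℕ-Solver using () renaming (solve to ℕsolve; _:+_ to _⊕_; _:=_ to _⊜_)

-- The three defects t₁, t₂, t₃ along the chain of partial sums of a solution of A₁ + … + A₅ = 0,
-- whose denominators have degrees dᵢ and whose partial sums have denominators of degrees d₁, D₂, D₃, d₅.
three-steps : ∀ {h d₁ d₂ d₃ d₄ d₅ D₂ D₃ t₁ t₂ t₃} →
  d₂ ℕ.+ D₂ ≡ d₁ ℕ.+ t₁ → d₃ ℕ.+ D₃ ≡ D₂ ℕ.+ t₂ → d₄ ℕ.+ d₅ ≡ D₃ ℕ.+ t₃ →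
  d₁ ℕ.≤ d₂ → d₃ ℕ.≤ d₄ → d₁ ℕ.+ d₂ ℕ.≤ d₃ ℕ.+ d₄ →
  D₂ ℕ.≤ d₁ ℕ.+ d₂ → d₃ ℕ.≤ D₂ ℕ.+ D₃ → D₃ ℕ.≤ D₂ ℕ.+ d₃ →
  (D₂ ≡ 0 ⊎ h ℕ.< D₂) → (D₃ ≡ 0 ⊎ h ℕ.< D₃) → h ℕ.< d₃ → h ℕ.< d₄ → h ℕ.< d₅ →
  h ℕ.+ h ℕ.≤ (t₁ ⊓ h) ℕ.+ ((t₂ ⊓ h) ℕ.+ (t₃ ⊓ h))
three-steps {h} {d₁} {d₂} {d₃} {d₄} {d₅} {D₂} {D₃} {t₁} {t₂} {t₃} e₁ e₂ e₃ d₁≤d₂ d₃≤d₄ dd D₂≤ d₃≤ D₃≤ zD₂ zD₃ h<d₃ h<d₄ h<d₅ = go zD₂ zD₃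
  where
    open ℕₚ.≤-Reasoning
    full : ∀ {t} → h ℕ.≤ t → h ℕ.≤ t ⊓ h
    full le = ℕₚ.⊓-glb le ℕₚ.≤-refl
    D₂≤t₁ : D₂ ℕ.≤ t₁
    D₂≤t₁ = ℕₚ.+-cancelˡ-≤ d₂ D₂ t₁ (subst (ℕ._≤ d₂ ℕ.+ t₁) (sym e₁) (ℕₚ.+-monoˡ-≤ t₁ d₁≤d₂))
    go : (D₂ ≡ 0 ⊎ h ℕ.< D₂) → (D₃ ≡ 0 ⊎ h ℕ.< D₃) → h ℕ.+ h ℕ.≤ (t₁ ⊓ h) ℕ.+ ((t₂ ⊓ h) ℕ.+ (t₃ ⊓ h))
    -- The first two variables cancel: t₂ = d₃ + D₃, and D₃ ≤ d₃ ≤ d₄ gives t₃ ≥ d₅.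
    go (inj₁ refl) _ = ℕₚ.≤-trans (ℕₚ.+-mono-≤ (full h≤t₂) (full h≤t₃)) (ℕₚ.m≤n+m _ (t₁ ⊓ h))
      where
        h≤t₂ : h ℕ.≤ t₂
        h≤t₂ = subst (h ℕ.≤_) e₂ (ℕₚ.≤-trans (ℕₚ.<⇒≤ h<d₃) (ℕₚ.m≤m+n d₃ D₃))
        h≤t₃ : h ℕ.≤ t₃
        h≤t₃ = ℕₚ.≤-trans (ℕₚ.<⇒≤ h<d₅) (ℕₚ.+-cancelˡ-≤ d₄ d₅ t₃ (subst (ℕ._≤ d₄ ℕ.+ t₃) (sym e₃) (ℕₚ.+-monoˡ-≤ t₃ (ℕₚ.≤-trans D₃≤ d₃≤d₄))))
    -- The last two variables cancel: t₁ ≥ D₂ ≥ d₃, and t₃ = d₄ + d₅.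
    go (inj₂ _) (inj₁ refl) = ℕₚ.+-mono-≤ (full h≤t₁) (ℕₚ.≤-trans (full h≤t₃) (ℕₚ.m≤n+m (t₃ ⊓ h) (t₂ ⊓ h)))
      where
        h≤t₁ : h ℕ.≤ t₁
        h≤t₁ = ℕₚ.≤-trans (ℕₚ.<⇒≤ h<d₃) (ℕₚ.≤-trans (subst (d₃ ℕ.≤_) (ℕₚ.+-identityʳ D₂) d₃≤) D₂≤t₁)
        h≤t₃ : h ℕ.≤ t₃
        h≤t₃ = subst (h ℕ.≤_) e₃ (ℕₚ.≤-trans (ℕₚ.<⇒≤ h<d₄) (ℕₚ.m≤m+n d₄ d₅))
    -- Here t₁ ≥ D₂ > h, while adding the last two relations and using D₂ ≤ d₁ + d₂ ≤ d₃ + d₄ gives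
    -- t₂ + t₃ ≥ d₅ > h.
    go (inj₂ h<D₂) (inj₂ _) = ℕₚ.+-mono-≤ (full (ℕₚ.≤-trans (ℕₚ.<⇒≤ h<D₂) D₂≤t₁)) (two (ℕₚ.≤-trans (ℕₚ.<⇒≤ h<d₅) d₅≤))
      where
        d₅≤ : d₅ ℕ.≤ t₂ ℕ.+ t₃
        d₅≤ = ℕₚ.+-cancelˡ-≤ (D₂ ℕ.+ D₃) d₅ (t₂ ℕ.+ t₃) (begin
          D₂ ℕ.+ D₃ ℕ.+ d₅ ≤⟨ ℕₚ.+-monoˡ-≤ d₅ (ℕₚ.+-monoˡ-≤ D₃ (ℕₚ.≤-trans D₂≤ dd)) ⟩
          d₃ ℕ.+ d₄ ℕ.+ D₃ ℕ.+ d₅ ≡⟨ ℕsolve 4 (λ a b c d → a ⊕ b ⊕ c ⊕ d ⊜ (a ⊕ c) ⊕ (b ⊕ d)) refl d₃ d₄ D₃ d₅ ⟩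
          (d₃ ℕ.+ D₃) ℕ.+ (d₄ ℕ.+ d₅) ≡⟨ cong₂ ℕ._+_ e₂ e₃ ⟩
          (D₂ ℕ.+ t₂) ℕ.+ (D₃ ℕ.+ t₃) ≡⟨ ℕsolve 4 (λ a b c d → (a ⊕ b) ⊕ (c ⊕ d) ⊜ (a ⊕ c) ⊕ (b ⊕ d)) refl D₂ t₂ D₃ t₃ ⟩
          (D₂ ℕ.+ D₃) ℕ.+ (t₂ ℕ.+ t₃) ∎)
        two : h ℕ.≤ t₂ ℕ.+ t₃ → h ℕ.≤ (t₂ ⊓ h) ℕ.+ (t₃ ⊓ h)
        two le with ℕₚ.≤-total t₂ h | ℕₚ.≤-total t₃ h
        ... | inj₁ a | inj₁ b = subst₂ (λ s t → h ℕ.≤ s ℕ.+ t) (sym (ℕₚ.m≤n⇒m⊓n≡m a)) (sym (ℕₚ.m≤n⇒m⊓n≡m b)) le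
        ... | inj₂ a | _ = ℕₚ.≤-trans (full a) (ℕₚ.m≤m+n _ _)
        ... | inj₁ _ | inj₂ b = ℕₚ.≤-trans (full b) (ℕₚ.m≤n+m _ _)

-- Four successive splittings, starting from the zero fraction

module FifthMoment (𝔽 : FiniteField) where
  open import Data.Rational using (_+_; _*_; _-_; -_; _≤_)
  open +-*-Solver using (solve; _:=_; _:+_; _:*_; _:-_; :-_; con)
  open PolyRing 𝔽
  open Divisibility 𝔽
  open Enumeration 𝔽
  open Duality 𝔽
  open Weights 𝔽
  open Extension 𝔽
  open Symmetrisation

  dvd-neg : ∀ p A → dvd p (-P A) ≡ dvd p A
  dvd-neg p A = bool-⇔ (λ e → ∣⇒dvd p {A} (∣-resp (Pₚ.-‿involutive A) (∣-neg (dvd⇒∣ p { -P A} e))))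
    (λ e → ∣⇒dvd p { -P A} (∣-neg (dvd⇒∣ p {A} e)))

  isZeroP-resp : ∀ {A B} → A ≈ B → isZeroP A ≡ isZeroP B
  isZeroP-resp {A} {B} e = bool-⇔ (λ z → ≈[]⇒isZeroP B (≈-trans (≈-sym e) (isZeroP⇒≈[] A z)))
    (λ z → ≈[]⇒isZeroP A (≈-trans e (isZeroP⇒≈[] B z)))

  isZeroP-+ : ∀ A B → isZeroP (B +P A) ≡ (A ==P (-P B))
  isZeroP-+ A B = isZeroP-resp (≈-trans (+-comm B A) (+-cong (≈-refl {A}) (≈-sym (Pₚ.-‿involutive B))))

  isZeroP-==[] : ∀ A → (A ==P []) ≡ isZeroP A
  isZeroP-==[] A = isZeroP-resp (+-identityʳ A)

  isZeroP-neg : ∀ A → isZeroP (-P A) ≡ isZeroP A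
  isZeroP-neg A = bool-⇔ (λ z → ≈[]⇒isZeroP A (≈-trans (≈-sym (Pₚ.-‿involutive A)) (neg-cong (isZeroP⇒≈[] (-P A) z))))
    (λ z → ≈[]⇒isZeroP (-P A) (neg-cong (isZeroP⇒≈[] A z)))

  module _ (ps : List Prm) (apart : Apart ps) (h : ℕ) (h≤n : h ℕ.≤ degAll ps) (s : ℕ) where
    open Sum ps apart h h≤n
    open Expansion ps apart using (ĝ)
    open Expansion.Window ps apart h using (α; α-resp; conv)

    t : Pol → Pol → ℕ
    t θ A = Triple.t θ A

    gain : Pol → Pol → ℚ
    gain θ A = ℕ→ℚ (q ℕ.^ (t θ A ⊓ h))

    gain≥0 : ∀ θ A → 0ℚ ≤ gain θ A
    gain≥0 θ A = ℕ→ℚ-nonneg (q ℕ.^ (t θ A ⊓ h))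

    -- The sum over all chains of k splittings starting at θ, weighted by the gains; `U-bound`
    -- iterates `extension`.
    U : ℕ → Pol → ℚ
    U zero θ = w 0 θ
    U (suc k) θ = ∑[ A ∈ V ] (w 0 A * gain θ A * U k (θ +P A))

    ∏K : ℕ → ℚ
    ∏K zero = 1ℚ
    ∏K (suc k) = K s k * ∏K k

    1≤Z : 1ℚ ≤ Z
    1≤Z = subst (_≤ Z) (∏-one ps) (∏-mono ps (λ _ → 0≤1) 1≤y)

    K≥0 : ∀ k → 0ℚ ≤ K s k
    K≥0 k = 0≤+ (^Q-nonneg (2 ℕ.^ suc k) (ℚₚ.≤-trans 0≤1 1≤Z)) (ℕ→ℚ-nonneg (suc h ℕ.* M₀ s k))

    ∏K≥0 : ∀ k → 0ℚ ≤ ∏K k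
    ∏K≥0 zero = 0≤1
    ∏K≥0 (suc k) = 0≤* (K≥0 k) (∏K≥0 k)

    U-bound : ∀ k θ → U k θ ≤ ∏K k * w k θ
    U-bound zero θ = ℚₚ.≤-reflexive (sym (ℚₚ.*-identityˡ (w 0 θ)))
    U-bound (suc k) θ = begin
      (∑[ A ∈ V ] (w 0 A * gain θ A * U k (θ +P A)))
        ≤⟨ ∑-mono V (λ A → *-monoʳ (0≤* (w-nonneg 0 A) (gain≥0 θ A)) (U-bound k (θ +P A))) ⟩
      (∑[ A ∈ V ] (w 0 A * gain θ A * (∏K k * w k (θ +P A))))
        ≡⟨ ∑-cong V (λ A → solve 4 (λ a b c d → a :* b :* (c :* d) := c :* (a :* d :* b)) refl (w 0 A) (gain θ A) (∏K k) (w k (θ +P A))) ⟩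
      (∑[ A ∈ V ] (∏K k * (w 0 A * w k (θ +P A) * gain θ A)))
        ≡⟨ ∑-*ˡ (∏K k) V (λ A → w 0 A * w k (θ +P A) * gain θ A) ⟩
      ∏K k * (∑[ A ∈ V ] (w 0 A * w k (θ +P A) * gain θ A))
        ≤⟨ *-monoʳ (∏K≥0 k) (Triple.Small.extension θ k s) ⟩
      ∏K k * (K s k * w (suc k) θ)
        ≡⟨ solve 3 (λ a b c → a :* (b :* c) := b :* a :* c) refl (∏K k) (K s k) (w (suc k) θ) ⟩
      ∏K (suc k) * w (suc k) θ ∎
      where open ℚₚ.≤-Reasoning

    w-[] : ∀ k → w k [] ≡ 1ℚ
    w-[] k = ∏-one ps

    w-neg : ∀ k A → w k (-P A) ≡ w k A
    w-neg k A = ∏-cong ps (λ p → cong (λ b → if b then 1ℚ else ω k p) (dvd-neg p A))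

    w̄ : Pol → ℚ
    w̄ A = 𝟙 (not (isZeroP A)) * w 0 A

    w̄-resp : ∀ {A B} → A ≈ B → w̄ A ≡ w̄ B
    w̄-resp e = cong₂ (λ b v → 𝟙 (not b) * v) (isZeroP-resp e) (w-resp 0 e)

    w̄-neg : ∀ A → w̄ (-P A) ≡ w̄ A
    w̄-neg A = cong₂ (λ b v → 𝟙 (not b) * v) (isZeroP-neg A) (w-neg 0 A)

    w̄≥0 : ∀ A → 0ℚ ≤ w̄ A
    w̄≥0 A = 0≤* (𝟙-nonneg (not (isZeroP A))) (w-nonneg 0 A)

    P : ℚ
    P = ĝ []

    inv≤1 : ∀ p → 0ℚ ≤ - inv (Nm p) + 1ℚ
    inv≤1 p = subst (0ℚ ≤_) (ℚₚ.+-comm 1ℚ (- inv (Nm p))) (≤⇒0≤- (subst₂ _≤_ (ℚₚ.*-identityˡ (inv (Nm p))) (Nm-inv p)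
      (*-monoˡ (inv-nonneg (Nm p)) (1≤ℕ→ℚ (1≤q^ (dg p))))))

    P≥0 : 0ℚ ≤ P
    P≥0 = ∏-nonneg ps inv≤1

    Z*P : Z * P ≡ 1ℚ
    Z*P = trans (sym (∏-* ps y (λ p → - inv (Nm p) + 1ℚ))) (trans (∏-cong ps (λ p → trans (cong (y p *_) (ℚₚ.+-comm (- inv (Nm p)) 1ℚ)) (y-inverse p))) (∏-one ps))

    -- Locally 1/|p| = (1 - 1/|p|) / φ(p), because φ(p) = |p| - 1.
    ∣ĝ∣ : ∀ A → ℚ.∣ ĝ A ∣ ≡ P * w 0 A
    ∣ĝ∣ A = trans (∏-∣∣ ps (λ p → - inv (Nm p) + 𝟙 (dvd p A)))
      (trans (∏-cong ps (λ p → local p (dvd p A))) (∏-* ps (λ p → - inv (Nm p) + 1ℚ) (λ p → if dvd p A then 1ℚ else x p)))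
      where
        local : ∀ p b → ℚ.∣ - inv (Nm p) + 𝟙 b ∣ ≡ (- inv (Nm p) + 1ℚ) * (if b then 1ℚ else x p)
        local p true = trans (ℚₚ.0≤p⇒∣p∣≡p (inv≤1 p)) (sym (ℚₚ.*-identityʳ (- inv (Nm p) + 1ℚ)))
        local p false = begin
          ℚ.∣ - i + 0ℚ ∣ ≡⟨ trans (cong ℚ.∣_∣ (ℚₚ.+-identityʳ (- i))) (trans (ℚₚ.∣-p∣≡∣p∣ i) (ℚₚ.0≤p⇒∣p∣≡p (inv-nonneg (Nm p)))) ⟩
          i ≡⟨ ℚₚ.*-identityʳ i ⟨
          i * 1ℚ ≡⟨ cong (i *_) (trans (sym (y-inverse p)) (cong (_* (1ℚ - i)) (sym (Nm-x p)))) ⟩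
          i * (Nmℚ p * x p * (1ℚ - i)) ≡⟨ solve 3 (λ i m x → i :* (m :* x :* (con 1ℚ :- i)) := (m :* i) :* ((:- i :+ con 1ℚ) :* x)) refl i (Nmℚ p) (x p) ⟩
          Nmℚ p * i * ((- i + 1ℚ) * x p) ≡⟨ trans (cong (_* ((- i + 1ℚ) * x p)) (Nm-inv p)) (ℚₚ.*-identityˡ ((- i + 1ℚ) * x p)) ⟩
          (- i + 1ℚ) * x p ∎
          where
            open ≡-Reasoning
            i : ℚ
            i = inv (Nm p)

    ∣α∣ : ∀ A → ℚ.∣ α A ∣ ≤ qh * P * w̄ A
    ∣α∣ A = subst (λ u → ℚ.∣ qh * (ĝ A - P * 𝟙 u) ∣ ≤ qh * P * w̄ A) (sym (isZeroP-==[] A)) (go (isZeroP A) refl)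
      where
        go : ∀ b → isZeroP A ≡ b → ℚ.∣ qh * (ĝ A - P * 𝟙 b) ∣ ≤ qh * P * (𝟙 (not b) * w 0 A)
        go true e = ℚₚ.≤-reflexive (begin
          ℚ.∣ qh * (ĝ A - P * 1ℚ) ∣ ≡⟨ cong (λ v → ℚ.∣ qh * (v - P * 1ℚ) ∣) (Expansion.ĝ-resp ps apart {A} {[]} (isZeroP⇒≈[] A e)) ⟩
          ℚ.∣ qh * (P - P * 1ℚ) ∣ ≡⟨ cong ℚ.∣_∣ (solve 2 (λ a p → a :* (p :- p :* con 1ℚ) := con 0ℚ) refl qh P) ⟩
          0ℚ ≡⟨ trans (cong (qh * P *_) (ℚₚ.*-zeroˡ (w 0 A))) (ℚₚ.*-zeroʳ (qh * P)) ⟨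
          qh * P * (0ℚ * w 0 A) ∎)
          where open ≡-Reasoning
        go false e = ℚₚ.≤-reflexive (begin
          ℚ.∣ qh * (ĝ A - P * 0ℚ) ∣ ≡⟨ cong (λ v → ℚ.∣ qh * v ∣) (solve 2 (λ g p → g :- p :* con 0ℚ := g) refl (ĝ A) P) ⟩
          ℚ.∣ qh * ĝ A ∣ ≡⟨ ℚₚ.∣p*q∣≡∣p∣*∣q∣ qh (ĝ A) ⟩
          ℚ.∣ qh ∣ * ℚ.∣ ĝ A ∣ ≡⟨ cong₂ _*_ (ℚₚ.0≤p⇒∣p∣≡p (ℕ→ℚ-nonneg (q ℕ.^ h))) (∣ĝ∣ A) ⟩
          qh * (P * w 0 A) ≡⟨ solve 3 (λ a p v → a :* (p :* v) := a :* p :* (con 1ℚ :* v)) refl qh P (w 0 A) ⟩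
          qh * P * (1ℚ * w 0 A) ∎)
          where open ≡-Reasoning

    -- One variable fewer than in `conv`: the last one is minus the partial sum, and `w̄` is even.
    S : ℕ → Pol → ℚ
    S zero B = w̄ B
    S (suc k) B = ∑[ A ∈ V ] (w̄ A * S k (B +P A))

    conv-bound : ∀ k {B} → B <° n ∸ h → ℚ.∣ conv (suc k) B ∣ ≤ (qh * P) ^Q suc k * S k B
    conv-bound zero {B} b = begin
      ℚ.∣ ∑[ A ∈ V ] (α A * 𝟙 (isZeroP (B +P A))) ∣
        ≡⟨ cong ℚ.∣_∣ (trans (∑-cong V (λ A → trans (ℚₚ.*-comm (α A) (𝟙 (isZeroP (B +P A)))) (cong (λ u → 𝟙 u * α A) (isZeroP-+ A B)))) (∑-polys-δ (n ∸ h) α α-resp (<°-neg b))) ⟩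
      ℚ.∣ α (-P B) ∣ ≤⟨ ∣α∣ (-P B) ⟩
      qh * P * w̄ (-P B) ≡⟨ cong₂ _*_ (sym (ℚₚ.*-identityʳ (qh * P))) (w̄-neg B) ⟩
      (qh * P) ^Q 1 * w̄ B ∎
      where open ℚₚ.≤-Reasoning
    conv-bound (suc k) {B} b = begin
      ℚ.∣ ∑[ A ∈ V ] (α A * conv (suc k) (B +P A)) ∣
        ≤⟨ ∑-∣∣ V (λ A → α A * conv (suc k) (B +P A)) ⟩
      (∑[ A ∈ V ] ℚ.∣ α A * conv (suc k) (B +P A) ∣)
        ≤⟨ ∑-mono-∈ V (λ {A} m → ℚₚ.≤-trans (ℚₚ.≤-reflexive (ℚₚ.∣p*q∣≡∣p∣*∣q∣ (α A) (conv (suc k) (B +P A))))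
             (*-mono-≤ (ℚₚ.0≤∣p∣ (α A)) (∣α∣ A) (ℚₚ.0≤∣p∣ (conv (suc k) (B +P A))) (conv-bound k (<°-+ b (polys-bound (n ∸ h) m))))) ⟩
      (∑[ A ∈ V ] (qh * P * w̄ A * ((qh * P) ^Q suc k * S k (B +P A))))
        ≡⟨ ∑-cong V (λ A → solve 4 (λ a v b t → a :* v :* (b :* t) := a :* b :* (v :* t)) refl (qh * P) (w̄ A) ((qh * P) ^Q suc k) (S k (B +P A))) ⟩
      (∑[ A ∈ V ] ((qh * P) ^Q suc (suc k) * (w̄ A * S k (B +P A))))
        ≡⟨ ∑-*ˡ ((qh * P) ^Q suc (suc k)) V (λ A → w̄ A * S k (B +P A)) ⟩
      (qh * P) ^Q suc (suc k) * S (suc k) B ∎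
      where open ℚₚ.≤-Reasoning

    -- `d-triple` for the decomposition of θ + A by means of -A, with the excess dropped.
    tri : ∀ θ A → d (θ +P A) ℕ.≤ d θ ℕ.+ d A
    tri θ A = subst (d (θ +P A) ℕ.≤_) (trans (cong₂ ℕ._+_ (degIf-cong (λ p → cong not (dvd-neg p A)) ps) (d-resp (add-cancel θ A))) (ℕₚ.+-comm (d A) (d θ)))
      (subst (d (θ +P A) ℕ.≤_) (sym (Triple.d-triple (θ +P A) (-P A))) (ℕₚ.m≤m+n (d (θ +P A)) (t (θ +P A) (-P A))))

    tri′ : ∀ θ A → d A ℕ.≤ d θ ℕ.+ d (θ +P A)
    tri′ θ A = subst (d A ℕ.≤_) (trans (sym (Triple.d-triple A θ)) (cong (d θ ℕ.+_) (d-resp (+-comm A θ)))) (ℕₚ.m≤m+n (d A) (t A θ))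

    zero-or-large : ∀ {A} → A <° n ∸ h → d A ≡ 0 ⊎ h ℕ.< d A
    zero-or-large {A} a with ≈[]? A
    ... | yes e = inj₁ (d-zero e)
    ... | no ne = inj₂ (h<d a ne)

    -- At the first splitting, of 0, the excess is 2 d A, so the gain reaches its cap.
    t-[] : ∀ {A} → h ℕ.< d A → t [] A ⊓ h ≡ h
    t-[] {A} lt = ℕₚ.m≥n⇒m⊓n≡n (ℕₚ.≤-trans (ℕₚ.<⇒≤ lt) (subst (d A ℕ.≤_) (trans (Triple.d-triple [] A) (cong (ℕ._+ t [] A) (d-zero ≈-refl))) (ℕₚ.m≤m+n (d A) (d A))))

    nz : Pol → Bool
    nz A = not (isZeroP A)

    nz⇒≉ : ∀ {A} → nz A ≡ true → ¬ (A ≈ [])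
    nz⇒≉ {A} e z = case trans (sym e) (cong not (≈[]⇒isZeroP A z)) of λ ()

    module Chain (a b c e : Pol) where
      θ₂ θ₃ θ₄ : Pol
      θ₂ = a +P b
      θ₃ = θ₂ +P c
      θ₄ = θ₃ +P e

      G : ℚ
      G = w̄ a * (w̄ b * (w̄ c * (w̄ e * w̄ θ₄)))

      H : ℚ
      H = w 0 a * gain [] a * (w 0 b * gain a b * (w 0 c * gain θ₂ c * (w 0 e * gain θ₃ e * w 0 θ₄)))

      -- `ordered` is the normalisation that `three-steps` requires; `ordering` provides it at the
      -- cost of a factor 8.
      ordered nonzero : Bool
      ordered = (d a ℕ.≤ᵇ d b) ∧ ((d c ℕ.≤ᵇ d e) ∧ (d a ℕ.+ d b ℕ.≤ᵇ d c ℕ.+ d e))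
      nonzero = nz a ∧ (nz b ∧ (nz c ∧ (nz e ∧ nz θ₄)))

      G≥0 : 0ℚ ≤ G
      G≥0 = 0≤* (w̄≥0 a) (0≤* (w̄≥0 b) (0≤* (w̄≥0 c) (0≤* (w̄≥0 e) (w̄≥0 θ₄))))

      W : ℚ
      W = w 0 a * (w 0 b * (w 0 c * (w 0 e * w 0 θ₄)))

      W≥0 : 0ℚ ≤ W
      W≥0 = 0≤* (w-nonneg 0 a) (0≤* (w-nonneg 0 b) (0≤* (w-nonneg 0 c) (0≤* (w-nonneg 0 e) (w-nonneg 0 θ₄))))

      m : ℕ
      m = (t [] a ⊓ h) ℕ.+ ((t a b ⊓ h) ℕ.+ ((t θ₂ c ⊓ h) ℕ.+ (t θ₃ e ⊓ h)))

      H-factor : H ≡ W * ℕ→ℚ (q ℕ.^ m)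
      H-factor = trans (solve 9 (λ a g b g′ c g″ e g‴ f → a :* g :* (b :* g′ :* (c :* g″ :* (e :* g‴ :* f))) := a :* (b :* (c :* (e :* f))) :* (g :* (g′ :* (g″ :* g‴)))) refl
          (w 0 a) (gain [] a) (w 0 b) (gain a b) (w 0 c) (gain θ₂ c) (w 0 e) (gain θ₃ e) (w 0 θ₄))
        (cong (W *_) (sym (trans (pow (t [] a ⊓ h) ((t a b ⊓ h) ℕ.+ ((t θ₂ c ⊓ h) ℕ.+ (t θ₃ e ⊓ h)))) (cong (gain [] a *_)
          (trans (pow (t a b ⊓ h) ((t θ₂ c ⊓ h) ℕ.+ (t θ₃ e ⊓ h))) (cong (gain a b *_) (pow (t θ₂ c ⊓ h) (t θ₃ e ⊓ h))))))))
        where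
          pow : ∀ i j → ℕ→ℚ (q ℕ.^ (i ℕ.+ j)) ≡ ℕ→ℚ (q ℕ.^ i) * ℕ→ℚ (q ℕ.^ j)
          pow i j = trans (cong ℕ→ℚ (ℕₚ.^-distribˡ-+-* q i j)) (ℕ→ℚ-* (q ℕ.^ i) (q ℕ.^ j))

      H≥0 : 0ℚ ≤ H
      H≥0 = subst (0ℚ ≤_) (sym H-factor) (0≤* W≥0 (ℕ→ℚ-nonneg (q ℕ.^ m)))

      G-factor : G ≡ 𝟙 nonzero * W
      G-factor = trans (solve 10 (λ i a j b k c l e o f → (i :* a) :* ((j :* b) :* ((k :* c) :* ((l :* e) :* (o :* f)))) := (i :* (j :* (k :* (l :* o)))) :* (a :* (b :* (c :* (e :* f))))) refl
          (𝟙 (nz a)) (w 0 a) (𝟙 (nz b)) (w 0 b) (𝟙 (nz c)) (w 0 c) (𝟙 (nz e)) (w 0 e) (𝟙 (nz θ₄)) (w 0 θ₄))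
        (cong (_* W) (sym (trans (𝟙-∧ (nz a) _) (cong (𝟙 (nz a) *_) (trans (𝟙-∧ (nz b) _) (cong (𝟙 (nz b) *_)
          (trans (𝟙-∧ (nz c) _) (cong (𝟙 (nz c) *_) (𝟙-∧ (nz e) (nz θ₄))))))))))

      module _ (va : a <° n ∸ h) (vb : b <° n ∸ h) (vc : c <° n ∸ h) (ve : e <° n ∸ h) where
        total-gain : ordered ≡ true → nonzero ≡ true → h ℕ.+ (h ℕ.+ h) ℕ.≤ m
        total-gain o z =
          let oab , o′ = ∧-true {d a ℕ.≤ᵇ d b} o
              oce , oo = ∧-true {d c ℕ.≤ᵇ d e} o′
              za , z₁ = ∧-true {nz a} z
              _ , z₂ = ∧-true {nz b} z₁
              zc , z₃ = ∧-true {nz c} z₂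
              ze , zf = ∧-true {nz e} z₃
              v₂ = <°-+ va vb
              v₃ = <°-+ v₂ vc
          in ℕₚ.+-mono-≤ (ℕₚ.≤-reflexive (sym (t-[] {a} (h<d va (nz⇒≉ za)))))
               (three-steps {h} {d a} {d b} {d c} {d e} {d θ₄} {d θ₂} {d θ₃} {t a b} {t θ₂ c} {t θ₃ e}
                 (Triple.d-triple a b) (Triple.d-triple θ₂ c) (Triple.d-triple θ₃ e)
                 (≤ᵇ-true⇒≤ oab) (≤ᵇ-true⇒≤ oce) (≤ᵇ-true⇒≤ oo)
                 (tri a b) (tri′ θ₂ c) (tri θ₂ c)
                 (zero-or-large v₂) (zero-or-large v₃)
                 (h<d vc (nz⇒≉ zc)) (h<d ve (nz⇒≉ ze)) (h<d (<°-+ v₃ ve) (nz⇒≉ zf)))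

        G≤H : 𝟙 ordered * (G * ℕ→ℚ (q ℕ.^ (h ℕ.+ (h ℕ.+ h)))) ≤ H
        G≤H = 𝟙-≤ ordered H≥0 λ o → subst (_≤ H) (trans (sym (ℚₚ.*-assoc (𝟙 nonzero) W q3h)) (cong (_* q3h) (sym G-factor)))
          (𝟙-≤ nonzero H≥0 λ z → subst (W * q3h ≤_) (sym H-factor) (*-monoʳ W≥0 (ℕ→ℚ-mono (q^-mono (total-gain o z)))))
          where
            q3h : ℚ
            q3h = ℕ→ℚ (q ℕ.^ (h ℕ.+ (h ℕ.+ h)))

    open Chain using (G; H; G≥0; ordered; G≤H)

    G-swap₁₂ : ∀ a b c e → G a b c e ≡ G b a c e
    G-swap₁₂ a b c e = trans (cong (λ v → w̄ a * (w̄ b * (w̄ c * (w̄ e * v)))) (w̄-resp (+-cong (+-cong (+-comm a b) (≈-refl {c})) (≈-refl {e}))))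
      (solve 3 (λ a b r → a :* (b :* r) := b :* (a :* r)) refl (w̄ a) (w̄ b) (w̄ c * (w̄ e * w̄ (((b +P a) +P c) +P e))))

    G-swap₃₄ : ∀ a b c e → G a b c e ≡ G a b e c
    G-swap₃₄ a b c e = cong (λ v → w̄ a * (w̄ b * v)) (trans (cong (λ v → w̄ c * (w̄ e * v))
        (w̄-resp (≈-trans (+-assoc (a +P b) c e) (≈-trans (+-cong (≈-refl {a +P b}) (+-comm c e)) (≈-sym (+-assoc (a +P b) e c))))))
      (solve 3 (λ a b r → a :* (b :* r) := b :* (a :* r)) refl (w̄ c) (w̄ e) (w̄ (((a +P b) +P e) +P c))))

    G-swap-pairs : ∀ a b c e → G a b c e ≡ G c e a b
    G-swap-pairs a b c e = trans (cong (λ v → w̄ a * (w̄ b * (w̄ c * (w̄ e * v))))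
        (w̄-resp (≈-trans (+-assoc (a +P b) c e) (≈-trans (+-comm (a +P b) (c +P e)) (≈-sym (+-assoc (c +P e) a b))))))
      (solve 5 (λ a b c e r → a :* (b :* (c :* (e :* r))) := c :* (e :* (a :* (b :* r)))) refl (w̄ a) (w̄ b) (w̄ c) (w̄ e) (w̄ (((c +P e) +P a) +P b)))

    ∑⁴ : (Pol → Pol → Pol → Pol → ℚ) → ℚ
    ∑⁴ f = ∑[ a ∈ V ] ∑[ b ∈ V ] ∑[ c ∈ V ] ∑[ e ∈ V ] f a b c e

    nested-sum : (v : Pol → Pol → ℚ) (u : Pol → ℚ) →
      (∑[ a ∈ V ] (v [] a * (∑[ b ∈ V ] (v a b * (∑[ c ∈ V ] (v (a +P b) c * (∑[ e ∈ V ] (v ((a +P b) +P c) e * u (((a +P b) +P c) +P e)))))))))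
      ≡ ∑⁴ (λ a b c e → v [] a * (v a b * (v (a +P b) c * (v ((a +P b) +P c) e * u (((a +P b) +P c) +P e)))))
    nested-sum v u = ∑-cong V λ a → into (v [] a) λ b → trans (cong (v [] a *_) (into (v a b) λ c → refl))
      (into (v [] a) λ c → trans (cong (λ r → v [] a * (v a b * r)) (into (v (a +P b) c) λ e → refl))
        (trans (cong (v [] a *_) (into (v a b) λ e → refl)) (into (v [] a) λ e → refl)))
      where
        into : ∀ r {f g : Pol → ℚ} → (∀ A → r * f A ≡ g A) → r * ∑ V f ≡ ∑ V g
        into r {f} e = trans (sym (∑-*ˡ r V f)) (∑-cong V e)

    S-expand : S 4 [] ≡ ∑⁴ G
    S-expand = nested-sum (λ _ A → w̄ A) w̄

    U-expand : U 4 [] ≡ ∑⁴ H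
    U-expand = nested-sum (λ θ A → w 0 A * gain θ A) (w 0)

    two : ℚ
    two = ℕ→ℚ 2

    -- Three symmetrisations with a factor 2 each: of the pairs (a, b) and (c, e), then of a and b,
    -- then of c and e. The last two leave the comparison of d a + d b with d c + d e unchanged.
    ordering : ∑⁴ G ≤ two * (two * (two * ∑⁴ (λ a b c e → 𝟙 (ordered a b c e) * G a b c e)))
    ordering = begin
      ∑⁴ G
        ≡⟨ trans (∑-cong V (λ a → ∑-cong V (λ b → sym (∑-pairs V (λ ce → G a b (proj₁ ce) (proj₂ ce))))))
             (sym (∑-pairs V (λ ab → ∑ (pairs V) (λ ce → G (proj₁ ab) (proj₂ ab) (proj₁ ce) (proj₂ ce))))) ⟩
      (∑[ u ∈ pairs V ] ∑[ v ∈ pairs V ] Gp u v)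
        ≤⟨ symmetrise (pairs V) D Gp (λ u v → G≥0 (proj₁ u) (proj₂ u) (proj₁ v) (proj₂ v)) (λ u v → G-swap-pairs (proj₁ u) (proj₂ u) (proj₁ v) (proj₂ v)) ⟩
      two * (∑[ u ∈ pairs V ] ∑[ v ∈ pairs V ] (𝟙 (D u ℕ.≤ᵇ D v) * Gp u v))
        ≡⟨ cong (two *_) (trans (∑-pairs V (λ u → ∑ (pairs V) (λ v → 𝟙 (D u ℕ.≤ᵇ D v) * Gp u v)))
             (∑-cong V (λ a → ∑-cong V (λ b → ∑-pairs V (λ v → 𝟙 (D (a , b) ℕ.≤ᵇ D v) * Gp (a , b) v))))) ⟩
      two * ∑⁴ G₁
        ≤⟨ *-monoʳ 0≤two (symmetrise V d (λ a b → ∑[ c ∈ V ] ∑[ e ∈ V ] G₁ a b c e)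
             (λ a b → ∑-nonneg V (λ c → ∑-nonneg V (λ e → G₁≥0 a b c e)))
             (λ a b → ∑-cong V (λ c → ∑-cong V (λ e → cong₂ (λ i g → 𝟙 (i ℕ.≤ᵇ d c ℕ.+ d e) * g) (ℕₚ.+-comm (d a) (d b)) (G-swap₁₂ a b c e))))) ⟩
      two * (two * (∑[ a ∈ V ] ∑[ b ∈ V ] (𝟙 (d a ℕ.≤ᵇ d b) * (∑[ c ∈ V ] ∑[ e ∈ V ] G₁ a b c e))))
        ≤⟨ *-monoʳ 0≤two (*-monoʳ 0≤two (∑-mono V (λ a → ∑-mono V (λ b → *-monoʳ (𝟙-nonneg (d a ℕ.≤ᵇ d b))
             (symmetrise V d (G₁ a b) (G₁≥0 a b)
               (λ c e → cong₂ (λ i g → 𝟙 (d a ℕ.+ d b ℕ.≤ᵇ i) * g) (ℕₚ.+-comm (d c) (d e)) (G-swap₃₄ a b c e))))))) ⟩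
      two * (two * (∑[ a ∈ V ] ∑[ b ∈ V ] (𝟙 (d a ℕ.≤ᵇ d b) * (two * (∑[ c ∈ V ] ∑[ e ∈ V ] (𝟙 (d c ℕ.≤ᵇ d e) * G₁ a b c e))))))
        ≡⟨ cong (λ r → two * (two * r)) collect ⟩
      two * (two * (two * ∑⁴ (λ a b c e → 𝟙 (ordered a b c e) * G a b c e))) ∎
      where
        open ℚₚ.≤-Reasoning
        D : Pol × Pol → ℕ
        D (a , b) = d a ℕ.+ d b
        Gp : Pol × Pol → Pol × Pol → ℚ
        Gp u v = G (proj₁ u) (proj₂ u) (proj₁ v) (proj₂ v)
        G₁ : Pol → Pol → Pol → Pol → ℚ
        G₁ a b c e = 𝟙 (d a ℕ.+ d b ℕ.≤ᵇ d c ℕ.+ d e) * G a b c e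
        G₁≥0 : ∀ a b c e → 0ℚ ≤ G₁ a b c e
        G₁≥0 a b c e = 0≤* (𝟙-nonneg (d a ℕ.+ d b ℕ.≤ᵇ d c ℕ.+ d e)) (G≥0 a b c e)
        0≤two : 0ℚ ≤ two
        0≤two = ℕ→ℚ-nonneg 2
        merge : ∀ a b c e → 𝟙 (d a ℕ.≤ᵇ d b) * (𝟙 (d c ℕ.≤ᵇ d e) * G₁ a b c e) ≡ 𝟙 (ordered a b c e) * G a b c e
        merge a b c e = trans (solve 4 (λ i j k g → i :* (j :* (k :* g)) := (i :* (j :* k)) :* g) refl
            (𝟙 (d a ℕ.≤ᵇ d b)) (𝟙 (d c ℕ.≤ᵇ d e)) (𝟙 (d a ℕ.+ d b ℕ.≤ᵇ d c ℕ.+ d e)) (G a b c e))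
          (cong (_* G a b c e) (sym (trans (𝟙-∧ (d a ℕ.≤ᵇ d b) _) (cong (𝟙 (d a ℕ.≤ᵇ d b) *_) (𝟙-∧ (d c ℕ.≤ᵇ d e) (d a ℕ.+ d b ℕ.≤ᵇ d c ℕ.+ d e))))))
        collect : (∑[ a ∈ V ] ∑[ b ∈ V ] (𝟙 (d a ℕ.≤ᵇ d b) * (two * (∑[ c ∈ V ] ∑[ e ∈ V ] (𝟙 (d c ℕ.≤ᵇ d e) * G₁ a b c e)))))
                  ≡ two * ∑⁴ (λ a b c e → 𝟙 (ordered a b c e) * G a b c e)
        collect = trans (∑-cong V (λ a → trans (∑-cong V (λ b → inner a b)) (∑-*ˡ two V (λ b → ∑[ c ∈ V ] ∑[ e ∈ V ] (𝟙 (ordered a b c e) * G a b c e)))))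
          (∑-*ˡ two V (λ a → ∑[ b ∈ V ] ∑[ c ∈ V ] ∑[ e ∈ V ] (𝟙 (ordered a b c e) * G a b c e)))
          where
            inner : ∀ a b → 𝟙 (d a ℕ.≤ᵇ d b) * (two * (∑[ c ∈ V ] ∑[ e ∈ V ] (𝟙 (d c ℕ.≤ᵇ d e) * G₁ a b c e)))
                    ≡ two * (∑[ c ∈ V ] ∑[ e ∈ V ] (𝟙 (ordered a b c e) * G a b c e))
            inner a b = trans (solve 3 (λ i t r → i :* (t :* r) := t :* (i :* r)) refl (𝟙 (d a ℕ.≤ᵇ d b)) two (∑[ c ∈ V ] ∑[ e ∈ V ] (𝟙 (d c ℕ.≤ᵇ d e) * G₁ a b c e)))
              (cong (two *_) (trans (sym (∑-*ˡ (𝟙 (d a ℕ.≤ᵇ d b)) V (λ c → ∑[ e ∈ V ] (𝟙 (d c ℕ.≤ᵇ d e) * G₁ a b c e))))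
                (∑-cong V (λ c → trans (sym (∑-*ˡ (𝟙 (d a ℕ.≤ᵇ d b)) V (λ e → 𝟙 (d c ℕ.≤ᵇ d e) * G₁ a b c e))) (∑-cong V (λ e → merge a b c e))))))

    q3h : ℚ
    q3h = ℕ→ℚ (q ℕ.^ (h ℕ.+ (h ℕ.+ h)))

    -- The factor q^(3h) is exchanged for the gains of the chain. The chain starts at 0, where the
    -- denominator is 1 and so is the weight.
    S-bound : S 4 [] * q3h ≤ ℕ→ℚ 8 * ∏K 4
    S-bound = begin
      S 4 [] * q3h
        ≤⟨ *-monoˡ (ℕ→ℚ-nonneg (q ℕ.^ (h ℕ.+ (h ℕ.+ h)))) (subst (_≤ two * (two * (two * ∑⁴ OG))) (sym S-expand) ordering) ⟩
      two * (two * (two * ∑⁴ OG)) * q3h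
        ≡⟨ solve 2 (λ s r → con two :* (con two :* (con two :* s)) :* r := con (ℕ→ℚ 8) :* (s :* r)) refl (∑⁴ OG) q3h ⟩
      ℕ→ℚ 8 * (∑⁴ OG * q3h)
        ≤⟨ *-monoʳ (ℕ→ℚ-nonneg 8) chains ⟩
      ℕ→ℚ 8 * U 4 []
        ≤⟨ *-monoʳ (ℕ→ℚ-nonneg 8) (U-bound 4 []) ⟩
      ℕ→ℚ 8 * (∏K 4 * w 4 [])
        ≡⟨ cong (ℕ→ℚ 8 *_) (trans (cong (∏K 4 *_) (w-[] 4)) (ℚₚ.*-identityʳ (∏K 4))) ⟩
      ℕ→ℚ 8 * ∏K 4 ∎
      where
        open ℚₚ.≤-Reasoning
        OG : Pol → Pol → Pol → Pol → ℚ
        OG a b c e = 𝟙 (ordered a b c e) * G a b c e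
        pull : ∀ {X : Set} (xs : List X) {f : X → ℚ} {g : X → ℚ} → (∀ {v} → v ∈ xs → f v * q3h ≤ g v) → ∑ xs f * q3h ≤ ∑ xs g
        pull xs {f} {g} le = subst (_≤ ∑ xs g) (∑-*ʳ q3h xs f) (∑-mono-∈ xs le)
        chains : ∑⁴ OG * q3h ≤ U 4 []
        chains = subst (∑⁴ OG * q3h ≤_) (sym U-expand)
          (pull V (λ {a} ma → pull V (λ {b} mb → pull V (λ {c} mc → pull V (λ {e} me →
            ℚₚ.≤-trans (ℚₚ.≤-reflexive (ℚₚ.*-assoc (𝟙 (ordered a b c e)) (G a b c e) q3h))
              (G≤H a b c e (polys-bound (n ∸ h) ma) (polys-bound (n ∸ h) mb) (polys-bound (n ∸ h) mc) (polys-bound (n ∸ h) me)))))))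

-- From the enumerative definitions to primes and Fourier coefficients

module Bridge (𝔽 : FiniteField) where
  open import Data.Rational using (_+_; _*_; _-_; -_; _≤_)
  open +-*-Solver using (solve; _:=_; _:+_; _:*_; _:-_; :-_; con)
  open PolyRing 𝔽
  open Divisibility 𝔽
  open Enumeration 𝔽
  open Duality 𝔽
  open Weights 𝔽
  open import Data.Bool.ListAction using (any)

  any-sound : ∀ {A : Set} (b : A → Bool) xs → any b xs ≡ true → ∃ λ x → x ∈ xs × b x ≡ true
  any-sound b (x ∷ xs) e with b x in eq
  ... | true = x , here refl , eq
  ... | false with any-sound b xs e
  ...   | y , m , f = y , there m , f

  any-complete : ∀ {A : Set} (b : A → Bool) {xs x} → x ∈ xs → b x ≡ true → any b xs ≡ true
  any-complete b {x ∷ xs} (here refl) e = cong (_∨ any b xs) e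
  any-complete b {x ∷ xs} (there m) e = trans (cong (b x ∨_) (any-complete b m e)) (𝔹ₚ.∨-zeroʳ (b x))

  divᵇ-sound : ∀ {P A} → divᵇ P A ≡ true → P ∣ A
  divᵇ-sound {P} {A} e with any-sound (λ R → (P *P R) ==P A) (polys (length A)) e
  ... | R , _ , f = dv R (==P⇒≈ f)

  divᵇ-complete : ∀ {P d A} → Mon P d → P ∣ A → divᵇ P A ≡ true
  divᵇ-complete {P} {d} {A} μ (dv R e) = any-complete (λ R → (P *P R) ==P A) (trunc-∈ (length A) R)
    (==P-true (≈-trans (*-congʳ P (trunc-≈ (length A) (Mon-cancel {C = R} (length A) μ
      (<°-resp (≈-sym e) (<°-mono (ℕₚ.m≤n+m (length A) d) (<°-length A)))))) e))

  none : List Prm → Pol → Bool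
  none [] A = true
  none (p ∷ ps) A = not (dvd p A) ∧ none ps A

  none-∏ : ∀ ps A → 𝟙 (none ps A) ≡ (∏[ p ∈ ps ] (- 𝟙 (dvd p A) + 1ℚ))
  none-∏ [] A = refl
  none-∏ (p ∷ ps) A = trans (𝟙-∧ (not (dvd p A)) (none ps A)) (cong₂ _*_ (trans (𝟙-not (dvd p A)) (ℚₚ.+-comm 1ℚ (- 𝟙 (dvd p A)))) (none-∏ ps A))

  none-false : ∀ ps A → none ps A ≡ false → ∃ λ p → p ∈ ps × dvd p A ≡ true
  none-false (p ∷ ps) A e with dvd p A in eq
  ... | true = p , here refl , eq
  ... | false with none-false ps A e
  ...   | r , m , f = r , there m , f

  -- The product of the Bézout identities for the single primes is one for their product.
  none-bezout : ∀ ps A → none ps A ≡ true → ∃ λ u → ∃ λ v → (u *P A) +P (v *P prodAll ps) ≈ [ 1# ]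
  none-bezout [] A e = [] , [ 1# ] , *-identityˡ [ 1# ]
  none-bezout (p ∷ ps) A e with ∧-true {not (dvd p A)} e
  ... | e₁ , e₂ with coprime-bezout p A (λ d → case trans (sym e₁) (cong not (∣⇒dvd p {A} d)) of λ ()) | none-bezout ps A e₂
  ...   | u , v , f | u′ , v′ , f′ = ((u *P A) +P (v *P poly p)) *P u′ +P u *P (v′ *P prodAll ps) , v *P v′ , (begin
      (((u *P A) +P (v *P poly p)) *P u′ +P u *P (v′ *P prodAll ps)) *P A +P (v *P v′) *P (poly p *P prodAll ps)
        ≈⟨ Pᵢ.bezout-product u A v (poly p) u′ v′ (prodAll ps) ⟩
      ((u *P A) +P (v *P poly p)) *P ((u′ *P A) +P (v′ *P prodAll ps))
        ≈⟨ *-cong f f′ ⟩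
      [ 1# ] *P [ 1# ]
        ≈⟨ *-identityˡ [ 1# ] ⟩
      [ 1# ] ∎)
      where open ≈-Reasoning

  unit-nlen : ∀ {P} → P ∣ [ 1# ] → nlen P ℕ.≤ 1
  unit-nlen {P} d with leading _ P (<°-length P)
  ... | inj₁ z = nlen-≤ (<°-resp (≈-sym z) <°-[])
  ... | inj₂ (e , _ , ne , b) with normalise ne b
  ...   | c , c⁻¹ , f , μ = ℕₚ.≤-trans (nlen-≤ b) (Mon-∣-deg μ (scal-∣ˡ f d) (bound Mon-1) (λ z → 0≢1 (sym (at z 0))))

  module _ {Q : Pol} {ps : List Prm} (factors : prodAll ps ≈ Q) where
    n′ : ℕ
    n′ = degAll ps

    μ : Mon Q n′
    μ = Mon-resp factors (prodIf-monic (λ _ → true) ps)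

    n<length : n′ ℕ.< length Q
    n<length with n′ ℕ.<? length Q
    ... | yes lt = lt
    ... | no ¬lt = ⊥-elim (0≢1 (trans (sym (vanish (<°-length Q) n′ (ℕₚ.≮⇒≥ ¬lt))) (lead μ)))

    -- A prime factor of `Q` dividing `A` is a common divisor within the range of the search; if
    -- there is none, a Bézout identity makes every common divisor a unit.
    coprimeᵇ-none : ∀ A → coprimeᵇ A Q ≡ none ps A
    coprimeᵇ-none A = bool-⇔ to from
      where
        test : Pol → Bool
        test P = (2 ℕ.≤ᵇ nlen P) ∧ divᵇ P A ∧ divᵇ P Q
        to : coprimeᵇ A Q ≡ true → none ps A ≡ true
        to e = go (none ps A) refl
          where
            go : ∀ t → none ps A ≡ t → t ≡ true
            go true _ = refl
            go false f with none-false ps A f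
            ... | p , m , g = ⊥-elim (case trans (sym e) (cong not (any-complete test (trunc-∈ (length Q) (poly p))
                    (cong₂ _∧_ (≤⇒≤ᵇ-true (subst (2 ℕ.≤_) (sym (Mon-nlen μ′)) (s≤s (positive p))))
                      (cong₂ _∧_ (divᵇ-complete μ′ (∣-respˡ (≈-sym p≈) (dvd⇒∣ p {A} g))) (divᵇ-complete μ′ (∣-respˡ (≈-sym p≈) p∣Q)))))) of λ ())
              where
                p∣Q : poly p ∣ Q
                p∣Q = ∣-resp factors (All.lookup (∣-prodIf (λ _ → true) ps) m refl)
                p≈ : trunc (length Q) (poly p) ≈ poly p
                p≈ = trunc-≈ (length Q) (<°-mono (ℕₚ.≤-trans (Mon-∣-deg (monic p) p∣Q (bound μ) (λ z → 0≢1 (trans (sym (at z n′)) (lead μ)))) n<length) (bound (monic p)))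
                μ′ : Mon (trunc (length Q) (poly p)) (dg p)
                μ′ = Mon-resp (≈-sym p≈) (monic p)
        from : none ps A ≡ true → coprimeᵇ A Q ≡ true
        from e = go (any test (polys (length Q))) refl
          where
            go : ∀ t → any test (polys (length Q)) ≡ t → not t ≡ true
            go false _ = refl
            go true f with any-sound test (polys (length Q)) f
            ... | P , _ , g with ∧-true {2 ℕ.≤ᵇ nlen P} g
            ...   | g₁ , g₂ with ∧-true {divᵇ P A} g₂ | none-bezout ps A e
            ...     | g₃ , g₄ | u , v , h = ⊥-elim (ℕₚ.<⇒≱ (≤ᵇ-true⇒≤ {2} {nlen P} g₁) (unit-nlen (∣-resp h
                        (∣-+ (∣-*ˡ u (divᵇ-sound {P} {A} g₃)) (∣-*ˡ v (∣-resp (≈-sym factors) (divᵇ-sound {P} {Q} g₄)))))))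

    deg-Q : deg Q ≡ n′
    deg-Q = Mon-deg μ

    ∣Q∣ : ∣ Q ∣P ≡ q ℕ.^ n′
    ∣Q∣ = Mon-∣∣P μ

    module _ (apart : Apart ps) where
      open Expansion ps apart hiding (Q)

      coprimeᵇ-g : ∀ A → 𝟙 (coprimeᵇ A Q) ≡ g A
      coprimeᵇ-g A = trans (cong 𝟙 (coprimeᵇ-none A)) (none-∏ ps A)

      φ-ĝ : ℕ→ℚ (φ Q) ≡ ℕ→ℚ (q ℕ.^ n) * ĝ []
      φ-ĝ = trans (∑-count (λ A → coprimeᵇ A Q) (polys (deg Q))) (trans (cong (λ m → ∑ (polys m) (λ A → 𝟙 (coprimeᵇ A Q))) deg-Q)
        (trans (∑-cong (polys n) coprimeᵇ-g) ∑-g))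

      norm-< : ∀ A h → (∣ A ∣P ℕ.<ᵇ q ℕ.^ h) ≡ true → A <° h
      norm-< A h e with nlen A | nlen-bound A
      ... | zero | b = <°-mono z≤n b
      ... | suc d | b with suc d ℕ.≤? h
      ...   | yes le = <°-mono le b
      ...   | no ¬le = ⊥-elim (ℕₚ.<⇒≱ (ℕₚ.<ᵇ⇒< (q ℕ.^ d) (q ℕ.^ h) (true⇒T e)) (q^-mono (ℕₚ.≤-pred (ℕₚ.≰⇒> ¬le))))

      <-norm : ∀ A h → A <° h → (∣ A ∣P ℕ.<ᵇ q ℕ.^ h) ≡ true
      <-norm A h a with nlen A | nlen-≤ a
      ... | zero | _ = T⇒true (ℕₚ.<⇒<ᵇ (1≤q^ h))
      ... | suc d | le = T⇒true (ℕₚ.<⇒<ᵇ (ℕₚ.^-monoʳ-< q 2≤q le))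

      -- Each element of the interval is F + H for exactly one H of degree < h, and all of them
      -- occur among the enumerated polynomials of degree < max(n, h).
      N-window : ∀ h {F} → F <° n → ℕ→ℚ (N Q h F) ≡ (∑[ H ∈ polys h ] g (F +P H))
      N-window h {F} f = begin
        ℕ→ℚ (N Q h F)
          ≡⟨ ∑-count (λ G → (∣ F -P G ∣P ℕ.<ᵇ q ℕ.^ h) ∧ coprimeᵇ G Q) (polys (deg Q ℕ.⊔ h)) ⟩
        ∑ (polys (deg Q ℕ.⊔ h)) (λ G → 𝟙 ((∣ F -P G ∣P ℕ.<ᵇ q ℕ.^ h) ∧ coprimeᵇ G Q))
          ≡⟨ cong (λ m → ∑ (polys (m ℕ.⊔ h)) (λ G → 𝟙 ((∣ F -P G ∣P ℕ.<ᵇ q ℕ.^ h) ∧ coprimeᵇ G Q))) deg-Q ⟩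
        ∑ (polys (n ℕ.⊔ h)) (λ G → 𝟙 ((∣ F -P G ∣P ℕ.<ᵇ q ℕ.^ h) ∧ coprimeᵇ G Q))
          ≡⟨ ∑-cong (polys (n ℕ.⊔ h)) (λ G → trans (𝟙-∧ (∣ F -P G ∣P ℕ.<ᵇ q ℕ.^ h) (coprimeᵇ G Q)) (trans (cong₂ _*_ (near G) (coprimeᵇ-g G)) (sym (∑-*ʳ (g G) (polys h) (λ H → 𝟙 (G ==P (F +P H))))))) ⟩
        (∑[ G ∈ polys (n ℕ.⊔ h) ] ∑[ H ∈ polys h ] (𝟙 (G ==P (F +P H)) * g G))
          ≡⟨ ∑-swap (polys (n ℕ.⊔ h)) (polys h) (λ G H → 𝟙 (G ==P (F +P H)) * g G) ⟩
        (∑[ H ∈ polys h ] ∑[ G ∈ polys (n ℕ.⊔ h) ] (𝟙 (G ==P (F +P H)) * g G))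
          ≡⟨ ∑-cong-∈ (polys h) (λ m → ∑-polys-δ (n ℕ.⊔ h) g g-resp
               (<°-+ (<°-mono (ℕₚ.m≤m⊔n n h) f) (<°-mono (ℕₚ.m≤n⊔m n h) (polys-bound h m)))) ⟩
        (∑[ H ∈ polys h ] g (F +P H)) ∎
        where
          open ≡-Reasoning
          shift : ∀ G → F +P (G -P F) ≈ G
          shift G = ≈-trans (+-comm F (G -P F)) (sub-cancel G F)
          unshift : ∀ G H → G ≈ F +P H → H ≈ G -P F
          unshift G H e = +⇒sub {H} {F} (≈-trans (+-comm H F) (≈-sym e))
          reflect : ∀ A B → -P (A -P B) ≈ B -P A
          reflect A B = ≈-trans (≈-sym (-‿+-comm A (-P B))) (≈-trans (+-cong (≈-refl { -P A}) (Pₚ.-‿involutive B)) (+-comm (-P A) B))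
            where open import Algebra.Properties.AbelianGroup PR.+-abelianGroup using () renaming (⁻¹-∙-comm to -‿+-comm)
          near : ∀ G → 𝟙 (∣ F -P G ∣P ℕ.<ᵇ q ℕ.^ h) ≡ (∑[ H ∈ polys h ] 𝟙 (G ==P (F +P H)))
          near G = go (∣ F -P G ∣P ℕ.<ᵇ q ℕ.^ h) refl
            where
              go : ∀ t → (∣ F -P G ∣P ℕ.<ᵇ q ℕ.^ h) ≡ t → 𝟙 t ≡ (∑[ H ∈ polys h ] 𝟙 (G ==P (F +P H)))
              go true e = sym (trans (∑-cong (polys h) (λ H → cong 𝟙 (bool-⇔
                  (λ z → ==P-true {H} {G -P F} (unshift G H (==P⇒≈ z)))
                  (λ z → ==P-true {G} {F +P H} (≈-trans (≈-sym (shift G)) (+-cong (≈-refl {F}) (≈-sym (==P⇒≈ {H} {G -P F} z))))))))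
                (∑-polys-δ1 h (<°-resp (reflect F G) (<°-neg (norm-< (F -P G) h e)))))
              go false e = sym (trans (∑-cong-∈ (polys h) empty) (∑-zero (polys h)))
                where
                  empty : ∀ {H} → H ∈ polys h → 𝟙 (G ==P (F +P H)) ≡ 0ℚ
                  empty {H} m = go′ (G ==P (F +P H)) refl
                    where
                      go′ : ∀ t → (G ==P (F +P H)) ≡ t → 𝟙 t ≡ 0ℚ
                      go′ false _ = refl
                      go′ true z = case trans (sym e) (<-norm (F -P G) h (<°-resp
                        (≈-trans (neg-cong (unshift G H (==P⇒≈ z))) (reflect G F)) (<°-neg (polys-bound h m)))) of λ ()

      module _ (h : ℕ) where
        open Window h
        open Moments 𝔽

        mean : (ℕ→ℚ (q ℕ.^ h ℕ.* φ Q) ÷ℕ ∣ Q ∣P) ≡ qh * ĝ []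
        mean = begin
          ℕ→ℚ (q ℕ.^ h ℕ.* φ Q) ÷ℕ ∣ Q ∣P
            ≡⟨ cong (ℕ→ℚ (q ℕ.^ h ℕ.* φ Q) ÷ℕ_) ∣Q∣ ⟩
          ℕ→ℚ (q ℕ.^ h ℕ.* φ Q) ÷ℕ (q ℕ.^ n)
            ≡⟨ ÷ℕ-inv (ℕ→ℚ (q ℕ.^ h ℕ.* φ Q)) (q ℕ.^ n) ⟩
          ℕ→ℚ (q ℕ.^ h ℕ.* φ Q) * inv (q ℕ.^ n)
            ≡⟨ cong (_* inv (q ℕ.^ n)) (trans (ℕ→ℚ-* (q ℕ.^ h) (φ Q)) (cong (qh *_) φ-ĝ)) ⟩
          qh * (ℕ→ℚ (q ℕ.^ n) * ĝ []) * inv (q ℕ.^ n)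
            ≡⟨ solve 4 (λ a b c i → a :* (b :* c) :* i := a :* c :* (b :* i)) refl qh (ℕ→ℚ (q ℕ.^ n)) (ĝ []) (inv (q ℕ.^ n)) ⟩
          qh * ĝ [] * (ℕ→ℚ (q ℕ.^ n) * inv (q ℕ.^ n))
            ≡⟨ trans (cong (qh * ĝ [] *_) (inv-inverseʳ (1≤q^ n))) (ℚₚ.*-identityʳ (qh * ĝ [])) ⟩
          qh * ĝ [] ∎
          where open ≡-Reasoning

        m₅-conv : m₅ Q h ≡ ℕ→ℚ (q ℕ.^ n) * conv 5 []
        m₅-conv = begin
          m₅ Q h
            ≡⟨ ∑-sumQ (polys (deg Q)) (λ F → (ℕ→ℚ (N Q h F) - (ℕ→ℚ (q ℕ.^ h ℕ.* φ Q) ÷ℕ ∣ Q ∣P)) ^Q 5) ⟩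
          ∑ (polys (deg Q)) (λ F → (ℕ→ℚ (N Q h F) - (ℕ→ℚ (q ℕ.^ h ℕ.* φ Q) ÷ℕ ∣ Q ∣P)) ^Q 5)
            ≡⟨ cong (λ m → ∑ (polys m) (λ F → (ℕ→ℚ (N Q h F) - (ℕ→ℚ (q ℕ.^ h ℕ.* φ Q) ÷ℕ ∣ Q ∣P)) ^Q 5)) deg-Q ⟩
          ∑ (polys n) (λ F → (ℕ→ℚ (N Q h F) - (ℕ→ℚ (q ℕ.^ h ℕ.* φ Q) ÷ℕ ∣ Q ∣P)) ^Q 5)
            ≡⟨ ∑-cong-∈ (polys n) (λ m → cong (_^Q 5) (cong₂ _-_ (N-window h (polys-bound n m)) mean)) ⟩
          ∑ (polys n) (λ F → f F ^Q 5)
            ≡⟨ moment 5 ⟩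
          ℕ→ℚ (q ℕ.^ n) * conv 5 [] ∎
          where open ≡-Reasoning

-- Constants, and the comparison of q^(εh) with powers of |Q|/φ(Q)

module Conclusion (𝔽 : FiniteField) where
  open import Data.Rational using (_+_; _*_; _-_; -_; _≤_)
  open +-*-Solver using (solve; _:=_; _:+_; _:*_; _:-_; :-_; con)
  open PolyRing 𝔽
  open Divisibility 𝔽
  open Enumeration 𝔽
  open Duality 𝔽
  open Weights 𝔽
  open Extension 𝔽

  pow-+ : ∀ i j → ℕ→ℚ (q ℕ.^ (i ℕ.+ j)) ≡ ℕ→ℚ (q ℕ.^ i) * ℕ→ℚ (q ℕ.^ j)
  pow-+ i j = trans (cong ℕ→ℚ (ℕₚ.^-distribˡ-+-* q i j)) (ℕ→ℚ-* (q ℕ.^ i) (q ℕ.^ j))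

  Kconst : ℕ → ℕ → ℕ
  Kconst s k = 1 ℕ.+ suc s ℕ.* Mconst k s

  -- The 8 comes from the three symmetrisations, the other factors from the four splittings.
  Ktotal : ℕ → ℕ
  Ktotal s = 8 ℕ.* (Kconst s 3 ℕ.* (Kconst s 2 ℕ.* (Kconst s 1 ℕ.* Kconst s 0)))

  1+a≤q^a : ∀ a → suc a ℕ.≤ q ℕ.^ a
  1+a≤q^a zero = s≤s z≤n
  1+a≤q^a (suc a) = ℕₚ.≤-trans (ℕₚ.+-mono-≤ (1≤q^ a) (1+a≤q^a a))
    (subst (ℕ._≤ q ℕ.^ suc a) (cong (q ℕ.^ a ℕ.+_) (ℕₚ.+-identityʳ (q ℕ.^ a))) (ℕₚ.*-monoˡ-≤ (q ℕ.^ a) 2≤q))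

  -- Turns the h + 1 classes into a power of q: with E the quotient of h by s + 1, h + 1 ≤ (s + 1)(E
  -- + 1) and E + 1 ≤ q^E.
  window-bound : ∀ h s → suc h ℕ.≤ suc s ℕ.* q ℕ.^ (h / suc s)
  window-bound h s = ℕₚ.≤-trans (subst (h ℕ.<_) (ℕₚ.*-comm (suc (h / suc s)) (suc s))
      (subst (ℕ._< suc (h / suc s) ℕ.* suc s) (sym (m≡m%n+[m/n]*n h (suc s))) (ℕₚ.+-monoˡ-< (h / suc s ℕ.* suc s) (m%n<n h (suc s)))))
    (ℕₚ.*-monoʳ-≤ (suc s) (1+a≤q^a (h / suc s)))

  module _ (ps : List Prm) (apart : Apart ps) (s : ℕ) where
    open Expansion ps apart using (n; ĝ)

    Z : ℚ
    Z = ∏[ p ∈ ps ] y p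

    1≤Z : 1ℚ ≤ Z
    1≤Z = subst (_≤ Z) (∏-one ps) (∏-mono ps (λ _ → 0≤1) 1≤y)

    0≤Z : 0ℚ ≤ Z
    0≤Z = ℚₚ.≤-trans 0≤1 1≤Z

    -- absorbs powers of h and divisor functions
    ε : ℕ → ℚ
    ε h = ℕ→ℚ (q ℕ.^ (h / suc s))

    1≤ε : ∀ h → 1ℚ ≤ ε h
    1≤ε h = 1≤ℕ→ℚ (1≤q^ (h / suc s))

    0≤ε : ∀ h → 0ℚ ≤ ε h
    0≤ε h = ℚₚ.≤-trans 0≤1 (1≤ε h)

    module _ (h : ℕ) (h≤n : h ℕ.≤ n) where
      open Sum ps apart h h≤n using (K; M₀; qh)
      open FifthMoment 𝔽 using (∏K; K≥0; P≥0; S; q3h; conv-bound; S-bound)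
      open Expansion.Window ps apart h using (conv)

      -- Both terms of `K` take a common form, the first by ε ≥ 1 and the second by Z ≥ 1. One
      -- factor ε stands for the h + 1 classes, the other for the divisor bound in `M₀`.
      K-bound : ∀ k → K s k ≤ Z ^Q (2 ℕ.^ suc k) * (ℕ→ℚ (Kconst s k) * ε h ^Q 2)
      K-bound k = begin
        Zk + ℕ→ℚ (suc h ℕ.* M₀ s k)
          ≤⟨ ℚₚ.+-mono-≤ (subst (_≤ Zk * ε h ^Q 2) (ℚₚ.*-identityʳ Zk) (*-monoʳ (^Q-nonneg (2 ℕ.^ suc k) 0≤Z) (1≤^Q 2 (1≤ε h)))) second ⟩
        Zk * ε h ^Q 2 + Zk * (ℕ→ℚ (suc s ℕ.* Mconst k s) * ε h ^Q 2)
          ≡⟨ trans (solve 3 (λ z m e → z :* e :+ z :* (m :* e) := z :* ((con 1ℚ :+ m) :* e)) refl Zk (ℕ→ℚ (suc s ℕ.* Mconst k s)) (ε h ^Q 2))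
               (cong (λ r → Zk * (r * ε h ^Q 2)) (sym (ℕ→ℚ-+ 1 (suc s ℕ.* Mconst k s)))) ⟩
        Zk * (ℕ→ℚ (Kconst s k) * ε h ^Q 2) ∎
        where
          open ℚₚ.≤-Reasoning
          Zk : ℚ
          Zk = Z ^Q (2 ℕ.^ suc k)
          second : ℕ→ℚ (suc h ℕ.* M₀ s k) ≤ Zk * (ℕ→ℚ (suc s ℕ.* Mconst k s) * ε h ^Q 2)
          second = begin
            ℕ→ℚ (suc h ℕ.* M₀ s k)
              ≤⟨ ℕ→ℚ-mono (ℕₚ.*-monoˡ-≤ (M₀ s k) (window-bound h s)) ⟩
            ℕ→ℚ (suc s ℕ.* q ℕ.^ (h / suc s) ℕ.* (Mconst k s ℕ.* q ℕ.^ (h / suc s)))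
              ≡⟨ trans (ℕ→ℚ-* (suc s ℕ.* q ℕ.^ (h / suc s)) (Mconst k s ℕ.* q ℕ.^ (h / suc s)))
                   (trans (cong₂ _*_ (ℕ→ℚ-* (suc s) (q ℕ.^ (h / suc s))) (ℕ→ℚ-* (Mconst k s) (q ℕ.^ (h / suc s))))
                     (trans (solve 3 (λ a m e → (a :* e) :* (m :* e) := con 1ℚ :* ((a :* m) :* (e :* (e :* con 1ℚ)))) refl (ℕ→ℚ (suc s)) (ℕ→ℚ (Mconst k s)) (ε h))
                       (cong (λ r → 1ℚ * (r * ε h ^Q 2)) (sym (ℕ→ℚ-* (suc s) (Mconst k s)))))) ⟩
            1ℚ * (ℕ→ℚ (suc s ℕ.* Mconst k s) * ε h ^Q 2)
              ≤⟨ *-monoˡ (0≤* (ℕ→ℚ-nonneg (suc s ℕ.* Mconst k s)) (^Q-nonneg 2 (0≤ε h))) (1≤^Q (2 ℕ.^ suc k) 1≤Z) ⟩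
            Zk * (ℕ→ℚ (suc s ℕ.* Mconst k s) * ε h ^Q 2) ∎

      ∏K-bound : ℕ→ℚ 8 * ∏K ps apart h h≤n s 4 ≤ ℕ→ℚ (Ktotal s) * (Z ^Q 30 * ε h ^Q 8)
      ∏K-bound = begin
        ℕ→ℚ 8 * (K s 3 * (K s 2 * (K s 1 * (K s 0 * 1ℚ))))
          ≤⟨ *-monoʳ (ℕ→ℚ-nonneg 8) (*-mono-≤ (K0 3) (K-bound 3) (0≤* (K0 2) (0≤* (K0 1) (0≤* (K0 0) 0≤1)))
               (*-mono-≤ (K0 2) (K-bound 2) (0≤* (K0 1) (0≤* (K0 0) 0≤1))
                 (*-mono-≤ (K0 1) (K-bound 1) (0≤* (K0 0) 0≤1) (*-monoˡ 0≤1 (K-bound 0))))) ⟩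
        ℕ→ℚ 8 * (B 3 * (B 2 * (B 1 * (B 0 * 1ℚ))))
          ≡⟨ solve 10 (λ i a b c d z₁ z₂ z₃ z₄ e → i :* ((z₄ :* (d :* e)) :* ((z₃ :* (c :* e)) :* ((z₂ :* (b :* e)) :* ((z₁ :* (a :* e)) :* con 1ℚ))))
               := (i :* (d :* (c :* (b :* a)))) :* ((z₄ :* (z₃ :* (z₂ :* z₁))) :* (e :* (e :* (e :* e))))) refl
               (ℕ→ℚ 8) (κ 0) (κ 1) (κ 2) (κ 3) (Z ^Q 2) (Z ^Q 4) (Z ^Q 8) (Z ^Q 16) (ε h ^Q 2) ⟩
        (ℕ→ℚ 8 * (κ 3 * (κ 2 * (κ 1 * κ 0)))) * ((Z ^Q 16 * (Z ^Q 8 * (Z ^Q 4 * Z ^Q 2))) * (ε h ^Q 2 * (ε h ^Q 2 * (ε h ^Q 2 * ε h ^Q 2))))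
          ≡⟨ cong₂ _*_ (sym constants) (cong₂ _*_ (sym (trans (^Q-+ Z 16 14) (cong (Z ^Q 16 *_) (trans (^Q-+ Z 8 6) (cong (Z ^Q 8 *_) (^Q-+ Z 4 2))))))
               (sym (trans (^Q-+ (ε h) 2 6) (cong (ε h ^Q 2 *_) (trans (^Q-+ (ε h) 2 4) (cong (ε h ^Q 2 *_) (^Q-+ (ε h) 2 2))))))) ⟩
        ℕ→ℚ (Ktotal s) * (Z ^Q 30 * ε h ^Q 8) ∎
        where
          open ℚₚ.≤-Reasoning
          K0 : ∀ k → 0ℚ ≤ K s k
          K0 k = K≥0 ps apart h h≤n s k
          κ B : ℕ → ℚ
          κ k = ℕ→ℚ (Kconst s k)
          B k = Z ^Q (2 ℕ.^ suc k) * (κ k * ε h ^Q 2)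
          constants : ℕ→ℚ (Ktotal s) ≡ ℕ→ℚ 8 * (κ 3 * (κ 2 * (κ 1 * κ 0)))
          constants = trans (ℕ→ℚ-* 8 (Kconst s 3 ℕ.* (Kconst s 2 ℕ.* (Kconst s 1 ℕ.* Kconst s 0))))
            (cong (ℕ→ℚ 8 *_) (trans (ℕ→ℚ-* (Kconst s 3) (Kconst s 2 ℕ.* (Kconst s 1 ℕ.* Kconst s 0)))
            (cong (κ 3 *_) (trans (ℕ→ℚ-* (Kconst s 2) (Kconst s 1 ℕ.* Kconst s 0)) (cong (κ 2 *_) (ℕ→ℚ-* (Kconst s 1) (Kconst s 0)))))))

      conv-bound-≤ : ℚ.∣ conv 5 [] ∣ ≤ ℕ→ℚ (Ktotal s) * (ℕ→ℚ (q ℕ.^ (2 ℕ.* h)) * (ĝ [] ^Q 5 * (Z ^Q 30 * ε h ^Q 8)))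
      conv-bound-≤ = begin
        ℚ.∣ conv 5 [] ∣
          ≤⟨ conv-bound ps apart h h≤n s 4 <°-[] ⟩
        (qh * ĝ []) ^Q 5 * Sum₄
          ≡⟨ cong (_* Sum₄) (trans (^Q-*-distrib qh (ĝ []) 5) (cong (_* ĝ [] ^Q 5) qh⁵)) ⟩
        q2h * q3h ps apart h h≤n s * ĝ [] ^Q 5 * Sum₄
          ≡⟨ solve 4 (λ a b c e → a :* b :* c :* e := a :* c :* (e :* b)) refl q2h (q3h ps apart h h≤n s) (ĝ [] ^Q 5) Sum₄ ⟩
        q2h * ĝ [] ^Q 5 * (Sum₄ * q3h ps apart h h≤n s)
          ≤⟨ *-monoʳ (0≤* (ℕ→ℚ-nonneg (q ℕ.^ (2 ℕ.* h))) (^Q-nonneg 5 (P≥0 ps apart h h≤n s))) (ℚₚ.≤-trans (S-bound ps apart h h≤n s) ∏K-bound) ⟩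
        q2h * ĝ [] ^Q 5 * (ℕ→ℚ (Ktotal s) * (Z ^Q 30 * ε h ^Q 8))
          ≡⟨ solve 4 (λ a b c e → a :* b :* (c :* e) := c :* (a :* (b :* e))) refl q2h (ĝ [] ^Q 5) (ℕ→ℚ (Ktotal s)) (Z ^Q 30 * ε h ^Q 8) ⟩
        ℕ→ℚ (Ktotal s) * (q2h * (ĝ [] ^Q 5 * (Z ^Q 30 * ε h ^Q 8))) ∎
        where
          open ℚₚ.≤-Reasoning
          Sum₄ q2h : ℚ
          Sum₄ = S ps apart h h≤n s 4 []
          q2h = ℕ→ℚ (q ℕ.^ (2 ℕ.* h))
          qh⁵ : qh ^Q 5 ≡ q2h * q3h ps apart h h≤n s
          qh⁵ = trans (solve 1 (λ a → a :* (a :* (a :* (a :* (a :* con 1ℚ)))) := (a :* a) :* (a :* (a :* a))) refl qh)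
            (cong₂ _*_ (sym (trans (cong (λ m → ℕ→ℚ (q ℕ.^ (h ℕ.+ m))) (ℕₚ.+-identityʳ h)) (pow-+ h h)))
                       (sym (trans (pow-+ h (h ℕ.+ h)) (cong (qh *_) (pow-+ h h)))))

    Z*ĝ : Z * ĝ [] ≡ 1ℚ
    Z*ĝ = FifthMoment.Z*P 𝔽 ps apart 0 z≤n s

    0≤ĝ : 0ℚ ≤ ĝ []
    0≤ĝ = FifthMoment.P≥0 𝔽 ps apart 0 z≤n s

    module _ (h : ℕ) where
      open Expansion.Window ps apart h using (conv; α)

      ĝ⁵Z³⁰ : ĝ [] ^Q 5 * (Z ^Q 30 * ε h ^Q 8) ≡ Z ^Q 25 * ε h ^Q 8
      ĝ⁵Z³⁰ = begin
        ĝ [] ^Q 5 * (Z ^Q 30 * ε h ^Q 8)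
          ≡⟨ cong (λ r → ĝ [] ^Q 5 * (r * ε h ^Q 8)) (^Q-+ Z 5 25) ⟩
        ĝ [] ^Q 5 * (Z ^Q 5 * Z ^Q 25 * ε h ^Q 8)
          ≡⟨ solve 4 (λ a b c e → a :* (b :* c :* e) := (b :* a) :* (c :* e)) refl (ĝ [] ^Q 5) (Z ^Q 5) (Z ^Q 25) (ε h ^Q 8) ⟩
        (Z ^Q 5 * ĝ [] ^Q 5) * (Z ^Q 25 * ε h ^Q 8)
          ≡⟨ cong (_* (Z ^Q 25 * ε h ^Q 8)) (trans (sym (^Q-*-distrib Z (ĝ []) 5)) (trans (cong (_^Q 5) Z*ĝ) (1^Q 5))) ⟩
        1ℚ * (Z ^Q 25 * ε h ^Q 8)
          ≡⟨ ℚₚ.*-identityˡ (Z ^Q 25 * ε h ^Q 8) ⟩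
        Z ^Q 25 * ε h ^Q 8 ∎
        where open ≡-Reasoning

      conv-small : ℚ.∣ conv 5 [] ∣ ≤ ℕ→ℚ (Ktotal s) * (ℕ→ℚ (q ℕ.^ (2 ℕ.* h)) * (Z ^Q 25 * ε h ^Q 8))
      conv-small = by-size (h ℕ.≤? n)
        where
          by-size : Dec (h ℕ.≤ n) → ℚ.∣ conv 5 [] ∣ ≤ ℕ→ℚ (Ktotal s) * (ℕ→ℚ (q ℕ.^ (2 ℕ.* h)) * (Z ^Q 25 * ε h ^Q 8))
          by-size (yes h≤n) = subst (λ r → ℚ.∣ conv 5 [] ∣ ≤ ℕ→ℚ (Ktotal s) * (ℕ→ℚ (q ℕ.^ (2 ℕ.* h)) * r)) ĝ⁵Z³⁰ (conv-bound-≤ h h≤n)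
          -- For h > n the truncated n - h is 0, so 0 is the only frequency, and `α` vanishes there.
          by-size (no ¬h≤n) = subst (_≤ ℕ→ℚ (Ktotal s) * (ℕ→ℚ (q ℕ.^ (2 ℕ.* h)) * (Z ^Q 25 * ε h ^Q 8))) (sym (cong ℚ.∣_∣ vanishes))
            (0≤* (ℕ→ℚ-nonneg (Ktotal s)) (0≤* (ℕ→ℚ-nonneg (q ℕ.^ (2 ℕ.* h))) (0≤* (^Q-nonneg 25 0≤Z) (^Q-nonneg 8 (0≤ε h)))))
            where
              α[] : α [] ≡ 0ℚ
              α[] = solve 2 (λ a p → a :* (p :- p :* con 1ℚ) := con 0ℚ) refl (ℕ→ℚ (q ℕ.^ h)) (ĝ [])
              vanishes : conv 5 [] ≡ 0ℚ
              vanishes = trans (cong (λ m → ∑ (polys m) (λ A → α A * conv 4 A)) (ℕₚ.m≤n⇒m∸n≡0 (ℕₚ.<⇒≤ (ℕₚ.≰⇒> ¬h≤n))))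
                (trans (ℚₚ.+-identityʳ (α [] * conv 4 [])) (trans (cong (_* conv 4 []) α[]) (ℚₚ.*-zeroˡ (conv 4 []))))

  -- The two regimes: either q^(8⌊h/(s+1)⌋) ≤ Z², or powers of Z are absorbed by q^(εh).
  trade-off : ∀ {m B Z P e C : ℚ} (b : ℕ) → 0ℚ ≤ m → 0ℚ ≤ B → 0ℚ ≤ C → 1ℚ ≤ Z → Z * P ≡ 1ℚ → 0ℚ ≤ P → 1ℚ ≤ e →
              m ≤ C * (B * (Z ^Q 25 * e)) →
              (m - C * (B * Z ^Q 27) ≤ 0ℚ) ⊎
              ((m - C * (B * Z ^Q 27)) ^Q suc b ≤ (C * (B * P ^Q 4)) ^Q suc b * (e ^Q 16) ^Q suc b)
  trade-off {m} {B} {Z} {P} {e} {C} b 0≤m 0≤B 0≤C 1≤Z ZP 0≤P 1≤e m≤ with ℚₚ.≤-total e (Z ^Q 2)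
  ... | inj₁ e≤Z² = inj₁ (subst (m - T₂ ≤_) (ℚₚ.+-inverseʳ T₂) (ℚₚ.+-monoˡ-≤ (- T₂) (ℚₚ.≤-trans m≤ (*-monoʳ 0≤C (*-monoʳ 0≤B
          (subst (Z ^Q 25 * e ≤_) (trans (ℚₚ.*-comm (Z ^Q 25) (Z ^Q 2)) (sym (^Q-+ Z 2 25))) (*-monoʳ (^Q-nonneg 25 (ℚₚ.≤-trans 0≤1 1≤Z)) e≤Z²)))))))
    where
      T₂ : ℚ
      T₂ = C * (B * Z ^Q 27)
  ... | inj₂ Z²≤e with ℚₚ.≤-total (m - C * (B * Z ^Q 27)) 0ℚ
  ...   | inj₁ neg = inj₁ neg
  ...   | inj₂ pos = inj₂ (subst ((m - T₂) ^Q suc b ≤_) (^Q-*-distrib (C * (B * P ^Q 4)) (e ^Q 16) (suc b)) (^Q-mono (suc b) pos (ℚₚ.≤-trans drop-T₂ (ℚₚ.≤-trans m≤ absorb))))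
    where
      T₂ : ℚ
      T₂ = C * (B * Z ^Q 27)
      0≤z : 0ℚ ≤ Z
      0≤z = ℚₚ.≤-trans 0≤1 1≤Z
      0≤e : 0ℚ ≤ e
      0≤e = ℚₚ.≤-trans 0≤1 1≤e
      drop-T₂ : m - T₂ ≤ m
      drop-T₂ = subst (m - T₂ ≤_) (ℚₚ.+-identityʳ m) (ℚₚ.+-monoʳ-≤ m (ℚₚ.neg-antimono-≤ (0≤* 0≤C (0≤* 0≤B (^Q-nonneg 27 0≤z)))))
      open ℚₚ.≤-Reasoning
      -- Inserting Z^4 P^4 = 1 leaves Z^29 ≤ Z^30 = (Z^2)^15 ≤ e^15.
      powers : Z ^Q 25 * e ≤ P ^Q 4 * e ^Q 16
      powers = begin
        Z ^Q 25 * e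
          ≡⟨ ℚₚ.*-identityˡ (Z ^Q 25 * e) ⟨
        1ℚ * (Z ^Q 25 * e)
          ≡⟨ cong (_* (Z ^Q 25 * e)) (sym (trans (sym (^Q-*-distrib Z P 4)) (trans (cong (_^Q 4) ZP) (1^Q 4)))) ⟩
        Z ^Q 4 * P ^Q 4 * (Z ^Q 25 * e)
          ≡⟨ solve 4 (λ a b c e → a :* b :* (c :* e) := b :* ((a :* c) :* e)) refl (Z ^Q 4) (P ^Q 4) (Z ^Q 25) e ⟩
        P ^Q 4 * (Z ^Q 4 * Z ^Q 25 * e)
          ≡⟨ cong (λ r → P ^Q 4 * (r * e)) (sym (^Q-+ Z 4 25)) ⟩
        P ^Q 4 * (Z ^Q 29 * e)
          ≤⟨ *-monoʳ (^Q-nonneg 4 0≤P) (*-monoˡ 0≤e (ℚₚ.≤-trans (^Q-monoʳ {m = 29} {n = 30} 1≤Z (ℕₚ.n≤1+n 29))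
               (subst (_≤ e ^Q 15) (sym Z³⁰) (^Q-mono 15 (^Q-nonneg 2 0≤z) Z²≤e)))) ⟩
        P ^Q 4 * (e ^Q 15 * e)
          ≡⟨ cong (P ^Q 4 *_) (ℚₚ.*-comm (e ^Q 15) e) ⟩
        P ^Q 4 * e ^Q 16 ∎
        where
          Z³⁰ : Z ^Q 30 ≡ (Z ^Q 2) ^Q 15
          Z³⁰ = go 15
            where
              go : ∀ i → Z ^Q (i ℕ.* 2) ≡ (Z ^Q 2) ^Q i
              go zero = refl
              go (suc i) = trans (^Q-+ Z 2 (i ℕ.* 2)) (cong (Z ^Q 2 *_) (go i))
      absorb : C * (B * (Z ^Q 25 * e)) ≤ C * (B * P ^Q 4) * e ^Q 16
      absorb = ℚₚ.≤-trans (*-monoʳ 0≤C (*-monoʳ 0≤B powers))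
        (ℚₚ.≤-reflexive (solve 4 (λ c b p e → c :* (b :* (p :* e)) := c :* (b :* p) :* e) refl C B (P ^Q 4) (e ^Q 16)))

  -- chosen so that 16 · 8 ⌊h/(s+1)⌋ (b+1) ≤ h for s = exponent b
  exponent : ℕ → ℕ
  exponent b = b ℕ.+ 127 ℕ.* suc b

  module _ (a b : ℕ) where
    open Bridge 𝔽
    open Moments 𝔽

    s : ℕ
    s = exponent b

    -- Here ε is (a + 1)/(b + 1). The second main term is moved to the left, so that a single real
    -- power remains on the right.
    FifthMomentBound : Pol → ℕ → Set
    FifthMomentBound Q h = LeMulRPow
      (ℚ.∣ m₅ Q h ∣ - (ℕ→ℚ (Ktotal s) * (ℕ→ℚ (∣ Q ∣P ℕ.* q ℕ.^ (2 ℕ.* h)) * ((ℕ→ℚ ∣ Q ∣P ÷ℕ φ Q) ^Q 27))))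
      (ℕ→ℚ (Ktotal s) * (ℕ→ℚ (∣ Q ∣P ℕ.* q ℕ.^ (2 ℕ.* h)) * ((ℕ→ℚ (φ Q) ÷ℕ ∣ Q ∣P) ^Q 4))) q (suc a ℕ.* h) b

    fifth-moment-bound : ∀ Q → Monic Q → Squarefree Q → ∀ h → FifthMomentBound Q h
    fifth-moment-bound Q monicQ sq h =
      let d , μ = Monic⇒Mon monicQ
          ps , factors , apart = squarefree-factorisation Q d μ sq
      in factored ps factors apart
      where
      factored : ∀ ps → prodAll ps ≈ Q → Apart ps → FifthMomentBound Q h
      factored ps factors apart = subst₂ Goal (sym Z≡) (sym P≡) (weaken
        (trade-off {ℚ.∣ m₅ Q h ∣} {B} {Zq} {ĝ []} {ε ps apart s h ^Q 8} {ℕ→ℚ (Ktotal s)} b (ℚₚ.0≤∣p∣ (m₅ Q h)) (ℕ→ℚ-nonneg (∣ Q ∣P ℕ.* q ℕ.^ (2 ℕ.* h))) (ℕ→ℚ-nonneg (Ktotal s))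
          (1≤Z ps apart s) (Z*ĝ ps apart s) (0≤ĝ ps apart s) (1≤^Q 8 (1≤ε ps apart s h)) bounded))
        where
        open Expansion ps apart using (n; ĝ)
        B Zq e : ℚ
        B = ℕ→ℚ (∣ Q ∣P ℕ.* q ℕ.^ (2 ℕ.* h))
        Zq = Z ps apart s
        e = ε ps apart s h

        Goal : ℚ → ℚ → Set
        Goal z p = LeMulRPow (ℚ.∣ m₅ Q h ∣ - (ℕ→ℚ (Ktotal s) * (B * (z ^Q 27)))) (ℕ→ℚ (Ktotal s) * (B * (p ^Q 4))) q (suc a ℕ.* h) b

        qn : ℚ
        qn = ℕ→ℚ (q ℕ.^ n)

        P≡ : (ℕ→ℚ (φ Q) ÷ℕ ∣ Q ∣P) ≡ ĝ []
        P≡ = trans (trans (cong (ℕ→ℚ (φ Q) ÷ℕ_) (∣Q∣ {Q} {ps} factors)) (÷ℕ-inv (ℕ→ℚ (φ Q)) (q ℕ.^ n)))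
          (trans (cong (_* inv (q ℕ.^ n)) (φ-ĝ {Q} {ps} factors apart)) (trans (solve 3 (λ a g i → a :* g :* i := g :* (a :* i)) refl qn (ĝ []) (inv (q ℕ.^ n)))
            (trans (cong (ĝ [] *_) (inv-inverseʳ (1≤q^ n))) (ℚₚ.*-identityʳ (ĝ [])))))

        -- Keeps `÷ℕ` away from its default value at 0.
        φ≥1 : 1 ℕ.≤ φ Q
        φ≥1 = positive′ (φ Q) refl
          where
            positive′ : ∀ m → φ Q ≡ m → 1 ℕ.≤ m
            positive′ (suc m) _ = s≤s z≤n
            positive′ zero eq = case ℕ→ℚ-cancel-≤ {1} {0} (ℚₚ.≤-reflexive (begin
                1ℚ ≡⟨ cong₂ _*_ (inv-inverseʳ (1≤q^ n)) (Z*ĝ ps apart s) ⟨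
                qn * inv (q ℕ.^ n) * (Zq * ĝ []) ≡⟨ solve 4 (λ a i z g → a :* i :* (z :* g) := (a :* g) :* (i :* z)) refl qn (inv (q ℕ.^ n)) Zq (ĝ []) ⟩
                qn * ĝ [] * (inv (q ℕ.^ n) * Zq) ≡⟨ cong (_* (inv (q ℕ.^ n) * Zq)) (trans (sym (φ-ĝ {Q} {ps} factors apart)) (cong ℕ→ℚ eq)) ⟩
                0ℚ * (inv (q ℕ.^ n) * Zq) ≡⟨ ℚₚ.*-zeroˡ (inv (q ℕ.^ n) * Zq) ⟩
                0ℚ ∎)) of λ ()
              where open ≡-Reasoning

        Z≡ : (ℕ→ℚ ∣ Q ∣P ÷ℕ φ Q) ≡ Zq
        Z≡ = begin
          ℕ→ℚ ∣ Q ∣P ÷ℕ φ Q ≡⟨ trans (÷ℕ-inv (ℕ→ℚ ∣ Q ∣P) (φ Q)) (cong (λ m → ℕ→ℚ m * inv (φ Q)) (∣Q∣ {Q} {ps} factors)) ⟩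
          qn * inv (φ Q) ≡⟨ cong (_* inv (φ Q)) (trans (sym (ℚₚ.*-identityʳ qn)) (cong (qn *_) (sym (Z*ĝ ps apart s)))) ⟩
          qn * (Zq * ĝ []) * inv (φ Q) ≡⟨ solve 4 (λ a z g i → a :* (z :* g) :* i := z :* ((a :* g) :* i)) refl qn Zq (ĝ []) (inv (φ Q)) ⟩
          Zq * (qn * ĝ [] * inv (φ Q)) ≡⟨ cong (λ r → Zq * (r * inv (φ Q))) (sym (φ-ĝ {Q} {ps} factors apart)) ⟩
          Zq * (ℕ→ℚ (φ Q) * inv (φ Q)) ≡⟨ trans (cong (Zq *_) (inv-inverseʳ φ≥1)) (ℚₚ.*-identityʳ Zq) ⟩
          Zq ∎
          where open ≡-Reasoning

        bounded : ℚ.∣ m₅ Q h ∣ ≤ ℕ→ℚ (Ktotal s) * (B * (Zq ^Q 25 * e ^Q 8))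
        bounded = begin
          ℚ.∣ m₅ Q h ∣ ≡⟨ cong ℚ.∣_∣ (m₅-conv {Q} {ps} factors apart h) ⟩
          ℚ.∣ qn * conv 5 [] ∣ ≡⟨ trans (ℚₚ.∣p*q∣≡∣p∣*∣q∣ qn (conv 5 [])) (cong (_* ℚ.∣ conv 5 [] ∣) (ℚₚ.0≤p⇒∣p∣≡p (ℕ→ℚ-nonneg (q ℕ.^ n)))) ⟩
          qn * ℚ.∣ conv 5 [] ∣ ≤⟨ *-monoʳ (ℕ→ℚ-nonneg (q ℕ.^ n)) (conv-small ps apart s h) ⟩
          qn * (ℕ→ℚ (Ktotal s) * (ℕ→ℚ (q ℕ.^ (2 ℕ.* h)) * (Zq ^Q 25 * e ^Q 8)))
            ≡⟨ solve 4 (λ a c m r → a :* (c :* (m :* r)) := c :* ((a :* m) :* r)) refl qn (ℕ→ℚ (Ktotal s)) (ℕ→ℚ (q ℕ.^ (2 ℕ.* h))) (Zq ^Q 25 * e ^Q 8) ⟩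
          ℕ→ℚ (Ktotal s) * (qn * ℕ→ℚ (q ℕ.^ (2 ℕ.* h)) * (Zq ^Q 25 * e ^Q 8))
            ≡⟨ cong (λ r → ℕ→ℚ (Ktotal s) * (r * (Zq ^Q 25 * e ^Q 8))) (trans (cong (λ m → ℕ→ℚ m * ℕ→ℚ (q ℕ.^ (2 ℕ.* h))) (sym (∣Q∣ {Q} {ps} factors))) (sym (ℕ→ℚ-* (∣ Q ∣P) (q ℕ.^ (2 ℕ.* h))))) ⟩
          ℕ→ℚ (Ktotal s) * (B * (Zq ^Q 25 * e ^Q 8)) ∎
          where
            open ℚₚ.≤-Reasoning
            open Expansion.Window ps apart h using (conv)

        e-power : ((e ^Q 8) ^Q 16) ^Q suc b ≤ ℕ→ℚ (q ℕ.^ (suc a ℕ.* h))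
        e-power = subst (_≤ ℕ→ℚ (q ℕ.^ (suc a ℕ.* h))) (sym exact) (ℕ→ℚ-mono (q^-mono (ℕₚ.≤-trans small (ℕₚ.m≤m+n h (a ℕ.* h)))))
          where
            E : ℕ
            E = h / suc s
            pow-pow : ∀ i j → ℕ→ℚ (q ℕ.^ i) ^Q j ≡ ℕ→ℚ (q ℕ.^ (i ℕ.* j))
            pow-pow i j = trans (sym (ℕ→ℚ-^ (q ℕ.^ i) j)) (cong ℕ→ℚ (ℕₚ.^-*-assoc q i j))
            exact : ((e ^Q 8) ^Q 16) ^Q suc b ≡ ℕ→ℚ (q ℕ.^ (E ℕ.* 8 ℕ.* 16 ℕ.* suc b))
            exact = trans (cong (λ r → (r ^Q 16) ^Q suc b) (pow-pow E 8)) (trans (cong (_^Q suc b) (pow-pow (E ℕ.* 8) 16)) (pow-pow (E ℕ.* 8 ℕ.* 16) (suc b)))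
            small : E ℕ.* 8 ℕ.* 16 ℕ.* suc b ℕ.≤ h
            -- By the choice of `exponent`, s + 1 = 128 (b + 1), and 128 = 8 · 16.
            small = subst (ℕ._≤ h) (trans (sym (ℕₚ.*-assoc E 128 (suc b))) (cong (ℕ._* suc b) (sym (ℕₚ.*-assoc E 8 16)))) (m/n*n≤m h (suc s))

        weaken : (ℚ.∣ m₅ Q h ∣ - ℕ→ℚ (Ktotal s) * (B * Zq ^Q 27) ≤ 0ℚ) ⊎
                 ((ℚ.∣ m₅ Q h ∣ - ℕ→ℚ (Ktotal s) * (B * Zq ^Q 27)) ^Q suc b ≤ (ℕ→ℚ (Ktotal s) * (B * ĝ [] ^Q 4)) ^Q suc b * ((e ^Q 8) ^Q 16) ^Q suc b) →
                 Goal Zq (ĝ [])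
        weaken (inj₁ neg) = inj₁ neg
        weaken (inj₂ le) = inj₂ (ℚₚ.≤-trans le (*-monoʳ (^Q-nonneg (suc b) (0≤* (ℕ→ℚ-nonneg (Ktotal s)) (0≤* (ℕ→ℚ-nonneg (∣ Q ∣P ℕ.* q ℕ.^ (2 ℕ.* h))) (^Q-nonneg 4 (0≤ĝ ps apart s))))) e-power))

open import Data.Nat using (_*_; _^_)

theorem4p6 : (𝔽 : FiniteField) →
    let open Poly 𝔽
        open Moments 𝔽
    in (a b : ℕ) →
       ∃ λ (C : ℕ) →
         ∀ (Q : Pol) → Monic Q → Squarefree Q → ∀ (h : ℕ) →
           LeMulRPow
             (ℚ.∣ m₅ Q h ∣ ℚ.- (ℕ→ℚ C ℚ.* (ℕ→ℚ (∣ Q ∣P * q ^ (2 * h)) ℚ.* ((ℕ→ℚ ∣ Q ∣P ÷ℕ φ Q) ^Q 27))))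
             (ℕ→ℚ C ℚ.* (ℕ→ℚ (∣ Q ∣P * q ^ (2 * h)) ℚ.* ((ℕ→ℚ (φ Q) ÷ℕ ∣ Q ∣P) ^Q 4)))
             q (suc a * h) b
theorem4p6 𝔽 a b = Ktotal (exponent b) , fifth-moment-bound a b
  where open Conclusion 𝔽
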